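{- Let $k\ge 3$. (a) For every finite field $F$, every subgroup $\Phi\le F^*$ of order $k$ and every generator $\varphi$ of $\Phi$, one has $\mathcal{O}(\mathbb{C},k)\subseteq\mathcal{O}_\varphi(F,k)$. (b) The set $\mathcal{Q}_k$ of exceptional primes is finite.
   Context: Notation: $\mathbf{k}=\{1,\dots,k-1\}$, $\mathbf{k}_0=\{0,1,\dots,k-1\}$. For a field $F$, a subgroup $\Phi\le F^*$ of order $k$ and a generator $\varphi$ of $\Phi$: a quadruple $(i,j\mid s,t)$ with $i,j,s,t\in\mathbf{k}$ and $i\neq s$ is an overlap (with respect to $\varphi$) if there is $\omega\in\mathbf{k}_0$ with $\varphi^\omega(\varphi^j-1)(\varphi^s-1)=(\varphi^i-1)(\varphi^t-1)$. The overlap is trivial if at least one of $i\equiv\pm j$, $j\equiv\pm t$, $t\equiv\pm s$, $s\equiv\pm i\pmod k$ holds, and nontrivial otherwise. $\mathcal{O}_\varphi(F,k)$ is the set of nontrivial overlaps. For $F=\mathbb{C}$ take $\Phi=\{z\in\mathbb{C}:z^k=1\}$ and $\varphi=\exp(2\pi\mathrm{i}/k)$, and write $\mathcal{O}(\mathbb{C},k)$. The set $\mathcal{Q}_k$ of exceptional primes is the set of primes $p$ such that $p\mid k$, or there exist a finite field $F$ of characteristic $p$, a subgroup $\Phi\le F^*$ of order $k$ and a generator $\varphi$ of $\Phi$ with $\mathcal{O}_\varphi(F,k)\neq\mathcal{O}(\mathbb{C},k)$. -}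

module Defs where

open import Algebra.Bundles using (RawRing; CommutativeRing)
import Algebra.Definitions.RawSemiring as RawSemiringDefinitions
open import Data.Fin.Base using (Fin)
open import Data.Integer.Base as ℤ using (ℤ; +_)
import Data.Integer.Properties as ℤ
import Data.Integer.Divisibility as ℤ
open import Data.List.Base using (List)
open import Data.List.Membership.Propositional using (_∈_)
open import Data.Nat.Base as ℕ using (ℕ; zero; suc; NonZero)
import Data.Nat.Divisibility as ℕ
open import Data.Nat.Primality using (Prime)
import Data.Nat.Properties as ℕ
open import Data.Product using (Σ; ∃; ∃-syntax; _×_; _,_; proj₁; proj₂)
open import Data.Rational.Base
  using (ℚ; 0ℚ; 1ℚ; _+_; _*_; -_; _-_; _/_; 1/_; ∣_∣; _≤_; _<_; ↥_; mkℚ;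
         toℚᵘ; positive; nonNegative; >-nonZero)
open import Data.Rational.Unnormalised.Base as ℚᵘ using (mkℚᵘ)
import Data.Rational.Unnormalised.Properties as ℚᵘ
import Data.Rational.Properties as ℚ
open import Data.Rational.Solver using (module +-*-Solver)
open import Data.Sum.Base using (_⊎_; inj₁; inj₂)
open import Function.Bundles using (Inverse; _⇔_)
open import Level using (Level; 0ℓ; _⊔_) renaming (suc to lsuc)
open import Relation.Binary.Bundles using (Setoid)
import Relation.Binary.Construct.On as On
open import Relation.Binary.PropositionalEquality as ≡ using (_≡_; refl; cong; cong₂; sym; trans; subst)
open import Relation.Nullary using (¬_)
open import Relation.Unary using (Pred; _⊆_; _≐_)

-- Cauchy sequences of rationals; equality of reals is `_≈ᴿ_`, not `_≡_`.

IsCauchy : (ℕ → ℚ) → Set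
IsCauchy x = ∀ ε → 0ℚ < ε → ∃[ N ] ∀ m n → N ℕ.≤ m → N ℕ.≤ n → ∣ x m - x n ∣ < ε

record ℝ : Set where
  field
    seq    : ℕ → ℚ
    cauchy : IsCauchy seq

open ℝ public

infix 4 _≈ᴿ_ _<ᴿ_

_≈ᴿ_ : ℝ → ℝ → Set
x ≈ᴿ y = ∀ ε → 0ℚ < ε → ∃[ N ] ∀ n → N ℕ.≤ n → ∣ seq x n - seq y n ∣ < ε

_<ᴿ_ : ℝ → ℝ → Set
x <ᴿ y = ∃[ ε ] (0ℚ < ε × ∃[ N ] ∀ n → N ℕ.≤ n → ε ≤ seq y n - seq x n)

recip : ℕ → ℚ
recip n = + 1 / suc n

module Estimates where

  *-monoˡ-≤ : ∀ {r p q} → 0ℚ ≤ r → p ≤ q → r * p ≤ r * q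
  *-monoˡ-≤ {r} 0≤r p≤q = ℚ.*-monoˡ-≤-nonNeg r {{nonNegative 0≤r}} p≤q

  *-monoʳ-≤ : ∀ {r p q} → 0ℚ ≤ r → p ≤ q → p * r ≤ q * r
  *-monoʳ-≤ {r} 0≤r p≤q = ℚ.*-monoʳ-≤-nonNeg r {{nonNegative 0≤r}} p≤q

  *-mono-≤ : ∀ {a b c d} → 0ℚ ≤ a → a ≤ b → 0ℚ ≤ c → c ≤ d → a * c ≤ b * d
  *-mono-≤ 0≤a a≤b 0≤c c≤d =
    ℚ.≤-trans (*-monoʳ-≤ 0≤c a≤b) (*-monoˡ-≤ (ℚ.≤-trans 0≤a a≤b) c≤d)

  *-nonNeg : ∀ {p q} → 0ℚ ≤ p → 0ℚ ≤ q → 0ℚ ≤ p * q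
  *-nonNeg {p} {q} 0≤p 0≤q =
    ℚ.≤-trans (ℚ.≤-reflexive (sym (ℚ.*-zeroʳ p))) (*-monoˡ-≤ 0≤p 0≤q)

  +-nonNeg : ∀ {p q} → 0ℚ ≤ p → 0ℚ ≤ q → 0ℚ ≤ p + q
  +-nonNeg 0≤p 0≤q =
    ℚ.≤-trans (ℚ.≤-reflexive (sym (ℚ.+-identityˡ 0ℚ))) (ℚ.+-mono-≤ 0≤p 0≤q)

  0≤1 : 0ℚ ≤ 1ℚ
  0≤1 = ℚ.nonNegative⁻¹ 1ℚ

  0<1 : 0ℚ < 1ℚ
  0<1 = ℚ.positive⁻¹ 1ℚ

  p≤p+q : ∀ {p q} → 0ℚ ≤ q → p ≤ p + q
  p≤p+q {p} 0≤q = ℚ.≤-trans (ℚ.≤-reflexive (sym (ℚ.+-identityʳ p))) (ℚ.+-monoʳ-≤ p 0≤q)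

  p≤q+p : ∀ {p q} → 0ℚ ≤ q → p ≤ q + p
  p≤q+p {p} {q} 0≤q = ℚ.≤-trans (p≤p+q 0≤q) (ℚ.≤-reflexive (ℚ.+-comm p q))

  ∣p-q∣≡∣q-p∣ : ∀ p q → ∣ p - q ∣ ≡ ∣ q - p ∣
  ∣p-q∣≡∣q-p∣ p q = trans (sym (ℚ.∣-p∣≡∣p∣ (p - q))) (cong ∣_∣ eq)
    where
    open +-*-Solver
    eq : - (p - q) ≡ q - p
    eq = solve 2 (λ p q → :- (p :- q) := q :- p) refl p q

  fromℕ : ℕ → ℚ
  fromℕ n = + n / 1

  toℚᵘ-/ : ∀ i d → toℚᵘ (i / suc d) ℚᵘ.≃ mkℚᵘ i d
  toℚᵘ-/ i d = ℚ.toℚᵘ-fromℚᵘ (mkℚᵘ i d)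

  fromℕ-suc : ∀ n → fromℕ (suc n) ≡ 1ℚ + fromℕ n
  fromℕ-suc n = ℚ.toℚᵘ-injective (begin-equality
    toℚᵘ (fromℕ (suc n))             ≃⟨ toℚᵘ-/ (+ suc n) 0 ⟩
    mkℚᵘ (+ suc n) 0                 ≃⟨ ℚᵘ.*≡* (cong (ℤ._* + 1) (cong (ℤ._+_ (+ 1)) (sym (ℤ.*-identityʳ (+ n))))) ⟩
    mkℚᵘ (+ 1) 0 ℚᵘ.+ mkℚᵘ (+ n) 0   ≃⟨ ℚᵘ.+-congʳ (mkℚᵘ (+ 1) 0) (toℚᵘ-/ (+ n) 0) ⟨
    toℚᵘ 1ℚ ℚᵘ.+ toℚᵘ (fromℕ n)      ≃⟨ ℚ.toℚᵘ-homo-+ 1ℚ (fromℕ n) ⟨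
    toℚᵘ (1ℚ + fromℕ n)              ∎)
    where open ℚᵘ.≤-Reasoning

  fromℕ*recip : ∀ n → fromℕ (suc n) * recip n ≡ 1ℚ
  fromℕ*recip n = ℚ.toℚᵘ-injective (begin-equality
    toℚᵘ (fromℕ (suc n) * recip n)           ≃⟨ ℚ.toℚᵘ-homo-* (fromℕ (suc n)) (recip n) ⟩
    toℚᵘ (fromℕ (suc n)) ℚᵘ.* toℚᵘ (recip n) ≃⟨ ℚᵘ.*-cong (toℚᵘ-/ (+ suc n) 0) (toℚᵘ-/ (+ 1) n) ⟩
    mkℚᵘ (+ suc n) 0 ℚᵘ.* mkℚᵘ (+ 1) n       ≃⟨ ℚᵘ.*≡* (trans (ℤ.*-identityʳ _) (trans (ℤ.*-identityʳ _) (sym (trans (ℤ.*-identityˡ _) (cong +_ (ℕ.+-identityʳ (suc n))))))) ⟩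
    toℚᵘ 1ℚ                                  ∎)
    where open ℚᵘ.≤-Reasoning

  fromℕ-mono : ∀ {m n} → m ℕ.≤ n → fromℕ m ≤ fromℕ n
  fromℕ-mono {m} {n} m≤n = ℚ.toℚᵘ-cancel-≤ (begin
    toℚᵘ (fromℕ m) ≃⟨ toℚᵘ-/ (+ m) 0 ⟩
    mkℚᵘ (+ m) 0   ≤⟨ ℚᵘ.*≤* (ℤ.*-monoʳ-≤-nonNeg (+ 1) (ℤ.+≤+ m≤n)) ⟩
    mkℚᵘ (+ n) 0   ≃⟨ toℚᵘ-/ (+ n) 0 ⟨
    toℚᵘ (fromℕ n) ∎)
    where open ℚᵘ.≤-Reasoning

  0≤fromℕ : ∀ n → 0ℚ ≤ fromℕ n
  0≤fromℕ n = fromℕ-mono {0} {n} ℕ.z≤n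

  0<recip : ∀ n → 0ℚ < recip n
  0<recip n = ℚ.positive⁻¹ (recip n) {{ℚ.normalize-pos 1 (suc n)}}

  0≤recip : ∀ n → 0ℚ ≤ recip n
  0≤recip n = ℚ.<⇒≤ (0<recip n)

  archimedean : ∀ p → ∃[ n ] p ≤ fromℕ n
  archimedean p@(mkℚ i d _) = ℤ.∣ i ∣ , ℚ.toℚᵘ-cancel-≤ (begin
    toℚᵘ p                 ≤⟨ ℚᵘ.*≤* bound ⟩
    mkℚᵘ (+ ℤ.∣ i ∣) 0     ≃⟨ toℚᵘ-/ (+ ℤ.∣ i ∣) 0 ⟨
    toℚᵘ (fromℕ ℤ.∣ i ∣)   ∎)
    where
    open ℚᵘ.≤-Reasoning
    i≤∣i∣ : ∀ i → i ℤ.≤ + ℤ.∣ i ∣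
    i≤∣i∣ (+ n)      = ℤ.≤-refl
    i≤∣i∣ ℤ.-[1+ n ] = ℤ.-≤+
    bound : i ℤ.* + 1 ℤ.≤ + ℤ.∣ i ∣ ℤ.* + suc d
    bound = ℤ.≤-trans (ℤ.≤-reflexive (ℤ.*-identityʳ i))
              (ℤ.≤-trans (i≤∣i∣ i)
                (ℤ.≤-trans (ℤ.+≤+ (ℕ.m≤m*n ℤ.∣ i ∣ (suc d)))
                  (ℤ.≤-reflexive (ℤ.pos-* ℤ.∣ i ∣ (suc d)))))

  *-pos : ∀ {p q} → 0ℚ < p → 0ℚ < q → 0ℚ < p * q
  *-pos {p} {q} 0<p 0<q =
    ℚ.positive⁻¹ (p * q) {{ℚ.pos*pos⇒pos p {{positive 0<p}} q {{positive 0<q}}}}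

  -- δ = ε / (C + 1)
  shrink : ∀ C ε → 0ℚ ≤ C → 0ℚ < ε → ∃[ δ ] (0ℚ < δ × C * δ < ε)
  shrink C ε 0≤C 0<ε = δ , 0<δ , (begin-strict
    C * δ        ≡⟨ ℚ.+-identityʳ (C * δ) ⟨
    C * δ + 0ℚ   <⟨ ℚ.+-monoʳ-< (C * δ) 0<δ ⟩
    C * δ + δ    ≡⟨ regroup ⟩
    ε * (D * r)  ≡⟨ cong (ε *_) (ℚ.*-inverseʳ D {{D≢0}}) ⟩
    ε * 1ℚ       ≡⟨ ℚ.*-identityʳ ε ⟩
    ε            ∎)
    where
    open ℚ.≤-Reasoning
    D   = C + 1ℚ
    0<D : 0ℚ < D
    0<D = ℚ.+-mono-≤-< 0≤C 0<1
    D≢0 = >-nonZero 0<D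
    r   = (1/ D) {{D≢0}}
    0<r : 0ℚ < r
    0<r = ℚ.positive⁻¹ r {{ℚ.1/pos⇒pos D {{positive 0<D}}}}
    δ   = ε * r
    0<δ : 0ℚ < δ
    0<δ = *-pos 0<ε 0<r
    regroup : C * (ε * r) + ε * r ≡ ε * ((C + 1ℚ) * r)
    regroup = solve 3 (λ C ε r → C :* (ε :* r) :+ ε :* r := ε :* ((C :+ con 1ℚ) :* r)) refl C ε r
      where open +-*-Solver

  recip-small : ∀ C ε → 0ℚ ≤ C → 0ℚ < ε → ∃[ N ] ∀ n → N ℕ.≤ n → C * recip n ≤ ε
  recip-small C ε 0≤C 0<ε = N , λ n N≤n → begin
    C * recip n                    ≡⟨ cong (_* recip n) C≡ ⟩
    (C * r) * ε * recip n          ≤⟨ *-monoʳ-≤ (0≤recip n) (*-monoʳ-≤ (ℚ.<⇒≤ 0<ε)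
                                        (ℚ.≤-trans (proj₂ arch) (fromℕ-mono (ℕ.≤-trans N≤n (ℕ.n≤1+n n))))) ⟩
    fromℕ (suc n) * ε * recip n    ≡⟨ solve 3 (λ a b c → a :* b :* c := b :* (a :* c)) refl (fromℕ (suc n)) ε (recip n) ⟩
    ε * (fromℕ (suc n) * recip n)  ≡⟨ cong (ε *_) (fromℕ*recip n) ⟩
    ε * 1ℚ                         ≡⟨ ℚ.*-identityʳ ε ⟩
    ε                              ∎
    where
    open ℚ.≤-Reasoning
    open +-*-Solver
    ε≢0 = >-nonZero 0<ε
    r    = (1/ ε) {{ε≢0}}
    arch = archimedean (C * r)
    N    = proj₁ arch
    C≡ : C ≡ C * r * ε
    C≡ = sym (trans (ℚ.*-assoc C r ε) (trans (cong (C *_) (ℚ.*-inverseˡ ε {{ε≢0}})) (ℚ.*-identityʳ C)))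

  isCauchy : ∀ x C → 0ℚ ≤ C →
             (∀ δ → 0ℚ < δ → ∃[ N ] ∀ m n → N ℕ.≤ m → N ℕ.≤ n → ∣ x m - x n ∣ ≤ C * δ) →
             IsCauchy x
  isCauchy x C 0≤C bound ε 0<ε =
    let δ , 0<δ , Cδ<ε = shrink C ε 0≤C 0<ε
        N , b          = bound δ 0<δ
    in N , λ m n N≤m N≤n → ℚ.≤-<-trans (b m n N≤m N≤n) Cδ<ε

  bounded : ∀ x → ∃[ B ] (0ℚ ≤ B × ∃[ N ] ∀ n → N ℕ.≤ n → ∣ seq x n ∣ ≤ B)
  bounded x = ∣ a ∣ + 1ℚ , +-nonNeg (ℚ.0≤∣p∣ a) 0≤1 , N , λ n N≤n → begin
    ∣ seq x n ∣                ≡⟨ cong ∣_∣ (solve 2 (λ p q → q := p :+ (q :- p)) refl a (seq x n)) ⟩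
    ∣ a + (seq x n - a) ∣      ≤⟨ ℚ.∣p+q∣≤∣p∣+∣q∣ a (seq x n - a) ⟩
    ∣ a ∣ + ∣ seq x n - a ∣    ≤⟨ ℚ.+-monoʳ-≤ ∣ a ∣ (ℚ.<⇒≤ (close n N N≤n ℕ.≤-refl)) ⟩
    ∣ a ∣ + 1ℚ                 ∎
    where
    open ℚ.≤-Reasoning
    open +-*-Solver
    N     = proj₁ (cauchy x 1ℚ 0<1)
    close = proj₂ (cauchy x 1ℚ 0<1)
    a     = seq x N

  ≤-max₁ : ∀ {m n o} → m ℕ.⊔ n ℕ.≤ o → m ℕ.≤ o
  ≤-max₁ {m} {n} = ℕ.≤-trans (ℕ.m≤m⊔n m n)

  ≤-max₂ : ∀ {m n o} → m ℕ.⊔ n ℕ.≤ o → n ℕ.≤ o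
  ≤-max₂ {m} {n} = ℕ.≤-trans (ℕ.m≤n⊔m m n)

open Estimates

infixl 6 _+ᴿ_
infixl 7 _*ᴿ_
infix  8 -ᴿ_

fromℚ : ℚ → ℝ
fromℚ q = record
  { seq    = λ _ → q
  ; cauchy = λ ε 0<ε → 0 , λ _ _ _ _ →
      subst (_< ε) (cong ∣_∣ (sym (ℚ.+-inverseʳ q))) 0<ε
  }

_+ᴿ_ : ℝ → ℝ → ℝ
x +ᴿ y = record
  { seq    = λ n → seq x n + seq y n
  ; cauchy = isCauchy (λ n → seq x n + seq y n) (1ℚ + 1ℚ) (+-nonNeg 0≤1 0≤1) λ δ 0<δ →
      let M , p = cauchy x δ 0<δ
          N , q = cauchy y δ 0<δ
      in M ℕ.⊔ N , λ m n M⊔N≤m M⊔N≤n → estimate (seq x m) (seq x n) (seq y m) (seq y n)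
           (ℚ.<⇒≤ (p m n (≤-max₁ {M} {N} M⊔N≤m) (≤-max₁ {M} {N} M⊔N≤n)))
           (ℚ.<⇒≤ (q m n (≤-max₂ {M} {N} M⊔N≤m) (≤-max₂ {M} {N} M⊔N≤n)))
  }
  where
  estimate : ∀ a b c d {δ} → ∣ a - b ∣ ≤ δ → ∣ c - d ∣ ≤ δ → ∣ (a + c) - (b + d) ∣ ≤ (1ℚ + 1ℚ) * δ
  estimate a b c d {δ} p q = begin
    ∣ (a + c) - (b + d) ∣   ≡⟨ cong ∣_∣ (solve 4 (λ a b c d → (a :+ c) :- (b :+ d) := (a :- b) :+ (c :- d)) refl a b c d) ⟩
    ∣ (a - b) + (c - d) ∣   ≤⟨ ℚ.∣p+q∣≤∣p∣+∣q∣ (a - b) (c - d) ⟩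
    ∣ a - b ∣ + ∣ c - d ∣   ≤⟨ ℚ.+-mono-≤ p q ⟩
    δ + δ                   ≡⟨ cong₂ _+_ (ℚ.*-identityˡ δ) (ℚ.*-identityˡ δ) ⟨
    1ℚ * δ + 1ℚ * δ         ≡⟨ ℚ.*-distribʳ-+ δ 1ℚ 1ℚ ⟨
    (1ℚ + 1ℚ) * δ           ∎
    where
    open ℚ.≤-Reasoning
    open +-*-Solver

-ᴿ_ : ℝ → ℝ
-ᴿ x = record
  { seq    = λ n → - seq x n
  ; cauchy = λ ε 0<ε →
      let N , p = cauchy x ε 0<ε
      in N , λ m n N≤m N≤n → subst (_< ε) (estimate (seq x m) (seq x n)) (p m n N≤m N≤n)
  }
  where
  estimate : ∀ a b → ∣ a - b ∣ ≡ ∣ - a - - b ∣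
  estimate a b = trans (∣p-q∣≡∣q-p∣ a b)
    (cong ∣_∣ (solve 2 (λ a b → b :- a := :- a :- :- b) refl a b))
    where open +-*-Solver

_*ᴿ_ : ℝ → ℝ → ℝ
x *ᴿ y = record
  { seq    = λ n → seq x n * seq y n
  ; cauchy =
      let A , 0≤A , K , a = bounded x
          B , 0≤B , L , b = bounded y
      in isCauchy (λ n → seq x n * seq y n) (A + B) (+-nonNeg 0≤A 0≤B) λ δ 0<δ →
      let M , p = cauchy x δ 0<δ
          N , q = cauchy y δ 0<δ
      in (K ℕ.⊔ L) ℕ.⊔ (M ℕ.⊔ N) , λ m n h h′ →
         let k = ≤-max₁ {K ℕ.⊔ L} {M ℕ.⊔ N} h ; k′ = ≤-max₁ {K ℕ.⊔ L} {M ℕ.⊔ N} h′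
             l = ≤-max₂ {K ℕ.⊔ L} {M ℕ.⊔ N} h ; l′ = ≤-max₂ {K ℕ.⊔ L} {M ℕ.⊔ N} h′
         in estimate (seq x m) (seq x n) (seq y m) (seq y n)
              (a m (≤-max₁ {K} {L} k)) (b n (≤-max₂ {K} {L} k′))
              (ℚ.<⇒≤ (p m n (≤-max₁ {M} {N} l) (≤-max₁ {M} {N} l′)))
              (ℚ.<⇒≤ (q m n (≤-max₂ {M} {N} l) (≤-max₂ {M} {N} l′)))
  }
  where
  estimate : ∀ a a′ b b′ {A B δ} → ∣ a ∣ ≤ A → ∣ b′ ∣ ≤ B → ∣ a - a′ ∣ ≤ δ → ∣ b - b′ ∣ ≤ δ →
             ∣ a * b - a′ * b′ ∣ ≤ (A + B) * δ
  estimate a a′ b b′ {A} {B} {δ} p q r s = begin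
    ∣ a * b - a′ * b′ ∣                    ≡⟨ cong ∣_∣ (solve 4 (λ a a′ b b′ →
                                                a :* b :- a′ :* b′ := a :* (b :- b′) :+ b′ :* (a :- a′)) refl a a′ b b′) ⟩
    ∣ a * (b - b′) + b′ * (a - a′) ∣       ≤⟨ ℚ.∣p+q∣≤∣p∣+∣q∣ (a * (b - b′)) (b′ * (a - a′)) ⟩
    ∣ a * (b - b′) ∣ + ∣ b′ * (a - a′) ∣   ≡⟨ cong₂ _+_ (ℚ.∣p*q∣≡∣p∣*∣q∣ a (b - b′)) (ℚ.∣p*q∣≡∣p∣*∣q∣ b′ (a - a′)) ⟩
    ∣ a ∣ * ∣ b - b′ ∣ + ∣ b′ ∣ * ∣ a - a′ ∣  ≤⟨ ℚ.+-mono-≤ (*-mono-≤ (ℚ.0≤∣p∣ a) p (ℚ.0≤∣p∣ (b - b′)) s)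
                                                       (*-mono-≤ (ℚ.0≤∣p∣ b′) q (ℚ.0≤∣p∣ (a - a′)) r) ⟩
    A * δ + B * δ                          ≡⟨ ℚ.*-distribʳ-+ δ A B ⟨
    (A + B) * δ                            ∎
    where
    open ℚ.≤-Reasoning
    open +-*-Solver

-- q ^ n / n !
expTerm : ℕ → ℚ → ℚ
expTerm zero    q = 1ℚ
expTerm (suc n) q = expTerm n q * q * recip n

partialSum : (ℕ → ℚ) → ℕ → ℚ → ℚ
partialSum c zero    q = 0ℚ
partialSum c (suc n) q = partialSum c n q + c n * expTerm n q

module Bound {B : ℚ} (0≤B : 0ℚ ≤ B) where

  open ℚ.≤-Reasoning
  open +-*-Solver

  t : ℕ → ℚ
  t n = expTerm n B

  T : ℕ → ℚ
  T zero    = 0ℚ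
  T (suc n) = T n + t n

  0≤t : ∀ n → 0ℚ ≤ t n
  0≤t zero    = 0≤1
  0≤t (suc n) = *-nonNeg (*-nonNeg (0≤t n) 0≤B) (0≤recip n)

  0≤T : ∀ n → 0ℚ ≤ T n
  0≤T zero    = ℚ.≤-refl
  0≤T (suc n) = +-nonNeg (0≤T n) (0≤t n)

  T-mono′ : ∀ m d → T m ≤ T (d ℕ.+ m)
  T-mono′ m zero    = ℚ.≤-refl
  T-mono′ m (suc d) = ℚ.≤-trans (T-mono′ m d) (p≤p+q (0≤t (d ℕ.+ m)))

  T-mono : ∀ {m n} → m ℕ.≤ n → T m ≤ T n
  T-mono {m} {n} m≤n = subst (λ z → T m ≤ T z) (ℕ.m∸n+n≡m m≤n) (T-mono′ m (n ℕ.∸ m))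

  M : ℕ
  M = proj₁ (archimedean (B + B))

  halving : ∀ n → M ℕ.≤ n → t (suc n) + t (suc n) ≤ t n
  halving n M≤n = begin
    t (suc n) + t (suc n)                  ≡⟨ solve 3 (λ t b r → t :* b :* r :+ t :* b :* r := t :* ((b :+ b) :* r)) refl (t n) B (recip n) ⟩
    t n * ((B + B) * recip n)              ≤⟨ *-monoˡ-≤ (0≤t n) (*-monoʳ-≤ (0≤recip n)
                                                (ℚ.≤-trans (proj₂ (archimedean (B + B)))
                                                  (fromℕ-mono (ℕ.≤-trans M≤n (ℕ.n≤1+n n))))) ⟩
    t n * (fromℕ (suc n) * recip n)        ≡⟨ cong (t n *_) (fromℕ*recip n) ⟩
    t n * 1ℚ                               ≡⟨ ℚ.*-identityʳ (t n) ⟩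
    t n                                    ∎

  U : ℕ → ℚ
  U n = T n + (t n + t n)

  U-step : ∀ n → M ℕ.≤ n → U (suc n) ≤ U n
  U-step n M≤n = begin
    T n + t n + (t (suc n) + t (suc n))   ≤⟨ ℚ.+-monoʳ-≤ (T n + t n) (halving n M≤n) ⟩
    T n + t n + t n                       ≡⟨ ℚ.+-assoc (T n) (t n) (t n) ⟩
    T n + (t n + t n)                     ∎

  U-anti′ : ∀ m d → M ℕ.≤ m → U (d ℕ.+ m) ≤ U m
  U-anti′ m zero    M≤m = ℚ.≤-refl
  U-anti′ m (suc d) M≤m =
    ℚ.≤-trans (U-step (d ℕ.+ m) (ℕ.≤-trans M≤m (ℕ.m≤n+m m d))) (U-anti′ m d M≤m)

  U-anti : ∀ {m n} → M ℕ.≤ m → m ℕ.≤ n → U n ≤ U m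
  U-anti {m} {n} M≤m m≤n = subst (λ z → U z ≤ U m) (ℕ.m∸n+n≡m m≤n) (U-anti′ m (n ℕ.∸ m) M≤m)

  K : ℚ
  K = U M

  0≤K : 0ℚ ≤ K
  0≤K = +-nonNeg (0≤T M) (+-nonNeg (0≤t M) (0≤t M))

  T≤K : ∀ n → M ℕ.≤ n → T n ≤ K
  T≤K n M≤n = ℚ.≤-trans (p≤p+q (+-nonNeg (0≤t n) (0≤t n))) (U-anti ℕ.≤-refl M≤n)

  t≤K : ∀ n → M ℕ.≤ n → t n ≤ K
  t≤K n M≤n = ℚ.≤-trans (p≤q+p (0≤T n)) (T≤K (suc n) (ℕ.≤-trans M≤n (ℕ.n≤1+n n)))

  t-small : ∀ δ → 0ℚ < δ → ∃[ N ] ∀ n → N ℕ.≤ n → t n ≤ δ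
  t-small δ 0<δ =
    let N , r = recip-small (K * B) δ (*-nonNeg 0≤K 0≤B) 0<δ
    in suc (M ℕ.⊔ N) , λ where
      (suc n) (ℕ.s≤s h) → ℚ.≤-trans
        (*-monoʳ-≤ (0≤recip n) (*-monoʳ-≤ 0≤B (t≤K n (≤-max₁ {M} {N} h))))
        (r n (≤-max₂ {M} {N} h))

  term-bound : ∀ n {x} → ∣ x ∣ ≤ B → ∣ expTerm n x ∣ ≤ t n
  term-bound zero          x≤B = ℚ.≤-refl
  term-bound (suc n) {x} x≤B = begin
    ∣ expTerm n x * x * recip n ∣        ≡⟨ ℚ.∣p*q∣≡∣p∣*∣q∣ (expTerm n x * x) (recip n) ⟩
    ∣ expTerm n x * x ∣ * ∣ recip n ∣    ≡⟨ cong₂ _*_ (ℚ.∣p*q∣≡∣p∣*∣q∣ (expTerm n x) x) (ℚ.0≤p⇒∣p∣≡p (0≤recip n)) ⟩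
    ∣ expTerm n x ∣ * ∣ x ∣ * recip n    ≤⟨ *-monoʳ-≤ (0≤recip n)
                                             (*-mono-≤ (ℚ.0≤∣p∣ (expTerm n x)) (term-bound n x≤B) (ℚ.0≤∣p∣ x) x≤B) ⟩
    t n * B * recip n                    ∎

  -- Bound on the derivative of `expTerm n` over [-B , B]
  t′ : ℕ → ℚ
  t′ zero    = 0ℚ
  t′ (suc n) = t n

  t′*B : ∀ n → t′ n * B ≡ fromℕ n * t n
  t′*B zero    = trans (ℚ.*-zeroˡ B) (sym (ℚ.*-zeroˡ 1ℚ))
  t′*B (suc n) = begin-equality
    t n * B                                      ≡⟨ ℚ.*-identityˡ (t n * B) ⟨
    1ℚ * (t n * B)                               ≡⟨ cong (_* (t n * B)) (fromℕ*recip n) ⟨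
    fromℕ (suc n) * recip n * (t n * B)          ≡⟨ solve 3 (λ a b c → a :* b :* c := a :* (c :* b)) refl (fromℕ (suc n)) (recip n) (t n * B) ⟩
    fromℕ (suc n) * (t n * B * recip n)          ∎

  t′-suc : ∀ n → (t′ n * B + t n) * recip n ≡ t n
  t′-suc n = begin-equality
    (t′ n * B + t n) * recip n          ≡⟨ cong (λ z → (z + t n) * recip n) (t′*B n) ⟩
    (fromℕ n * t n + t n) * recip n     ≡⟨ solve 3 (λ a b c → (a :* b :+ b) :* c := b :* ((con 1ℚ :+ a) :* c)) refl (fromℕ n) (t n) (recip n) ⟩
    t n * ((1ℚ + fromℕ n) * recip n)    ≡⟨ cong (λ z → t n * (z * recip n)) (fromℕ-suc n) ⟨
    t n * (fromℕ (suc n) * recip n)     ≡⟨ cong (t n *_) (fromℕ*recip n) ⟩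
    t n * 1ℚ                            ≡⟨ ℚ.*-identityʳ (t n) ⟩
    t n                                 ∎

  term-lipschitz : ∀ n {x y} → ∣ x ∣ ≤ B → ∣ y ∣ ≤ B → ∣ expTerm n x - expTerm n y ∣ ≤ t′ n * ∣ x - y ∣
  term-lipschitz zero    {x} {y} _ _ = ℚ.≤-reflexive (sym (ℚ.*-zeroˡ ∣ x - y ∣))
  term-lipschitz (suc n) {x} {y} p q = begin
    ∣ X * x * r - Y * y * r ∣                       ≡⟨ cong ∣_∣ (solve 5 (λ X Y x y r →
                                                         X :* x :* r :- Y :* y :* r := ((X :- Y) :* x :+ Y :* (x :- y)) :* r) refl X Y x y r) ⟩
    ∣ ((X - Y) * x + Y * (x - y)) * r ∣             ≡⟨ trans (ℚ.∣p*q∣≡∣p∣*∣q∣ ((X - Y) * x + Y * (x - y)) r)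
                                                         (cong (∣ (X - Y) * x + Y * (x - y) ∣ *_) (ℚ.0≤p⇒∣p∣≡p (0≤recip n))) ⟩
    ∣ (X - Y) * x + Y * (x - y) ∣ * r               ≤⟨ *-monoʳ-≤ (0≤recip n) (ℚ.∣p+q∣≤∣p∣+∣q∣ ((X - Y) * x) (Y * (x - y))) ⟩
    (∣ (X - Y) * x ∣ + ∣ Y * (x - y) ∣) * r         ≡⟨ cong (_* r) (cong₂ _+_ (ℚ.∣p*q∣≡∣p∣*∣q∣ (X - Y) x) (ℚ.∣p*q∣≡∣p∣*∣q∣ Y (x - y))) ⟩
    (∣ X - Y ∣ * ∣ x ∣ + ∣ Y ∣ * ∣ x - y ∣) * r     ≤⟨ *-monoʳ-≤ (0≤recip n) (ℚ.+-mono-≤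
                                                         (*-mono-≤ (ℚ.0≤∣p∣ (X - Y)) (term-lipschitz n p q) (ℚ.0≤∣p∣ x) p)
                                                         (*-monoʳ-≤ (ℚ.0≤∣p∣ (x - y)) (term-bound n q))) ⟩
    (t′ n * D * B + t n * D) * r                    ≡⟨ solve 5 (λ t′ D B t r →
                                                         (t′ :* D :* B :+ t :* D) :* r := (t′ :* B :+ t) :* r :* D) refl (t′ n) D B (t n) r ⟩
    (t′ n * B + t n) * r * D                        ≡⟨ cong (_* D) (t′-suc n) ⟩
    t n * D                                         ∎
    where
    X = expTerm n x
    Y = expTerm n y
    r = recip n
    D = ∣ x - y ∣

  T′ : ℕ → ℚ
  T′ zero    = 0ℚ
  T′ (suc n) = T n

  T′-suc : ∀ n → T′ n + t′ n ≡ T′ (suc n)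
  T′-suc zero    = refl
  T′-suc (suc n) = refl

  T′≤T : ∀ n → T′ n ≤ T n
  T′≤T zero    = ℚ.≤-refl
  T′≤T (suc n) = p≤p+q (0≤t n)

module Series {c : ℕ → ℚ} (c≤1 : ∀ n → ∣ c n ∣ ≤ 1ℚ) {B : ℚ} (0≤B : 0ℚ ≤ B) where

  open ℚ.≤-Reasoning
  open +-*-Solver
  open Bound 0≤B

  S : ℕ → ℚ → ℚ
  S = partialSum c

  ∣c*∣≤ : ∀ n p → ∣ c n * p ∣ ≤ ∣ p ∣
  ∣c*∣≤ n p = begin
    ∣ c n * p ∣       ≡⟨ ℚ.∣p*q∣≡∣p∣*∣q∣ (c n) p ⟩
    ∣ c n ∣ * ∣ p ∣   ≤⟨ *-monoʳ-≤ (ℚ.0≤∣p∣ p) (c≤1 n) ⟩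
    1ℚ * ∣ p ∣        ≡⟨ ℚ.*-identityˡ ∣ p ∣ ⟩
    ∣ p ∣             ∎

  lipschitz : ∀ n {x y} → ∣ x ∣ ≤ B → ∣ y ∣ ≤ B → ∣ S n x - S n y ∣ ≤ T′ n * ∣ x - y ∣
  lipschitz zero    {x} {y} p q = ℚ.≤-reflexive (sym (ℚ.*-zeroˡ ∣ x - y ∣))
  lipschitz (suc n) {x} {y} p q = begin
    ∣ S n x + c n * X - (S n y + c n * Y) ∣       ≡⟨ cong ∣_∣ (solve 5 (λ a b c X Y →
                                                       a :+ c :* X :- (b :+ c :* Y) := (a :- b) :+ c :* (X :- Y)) refl (S n x) (S n y) (c n) X Y) ⟩
    ∣ (S n x - S n y) + c n * (X - Y) ∣           ≤⟨ ℚ.∣p+q∣≤∣p∣+∣q∣ (S n x - S n y) (c n * (X - Y)) ⟩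
    ∣ S n x - S n y ∣ + ∣ c n * (X - Y) ∣         ≤⟨ ℚ.+-mono-≤ (lipschitz n p q)
                                                       (ℚ.≤-trans (∣c*∣≤ n (X - Y)) (term-lipschitz n p q)) ⟩
    T′ n * D + t′ n * D                           ≡⟨ ℚ.*-distribʳ-+ D (T′ n) (t′ n) ⟨
    (T′ n + t′ n) * D                             ≡⟨ cong (_* D) (T′-suc n) ⟩
    T n * D                                       ∎
    where
    X = expTerm n x
    Y = expTerm n y
    D = ∣ x - y ∣

  tail′ : ∀ m d {x} → ∣ x ∣ ≤ B → ∣ S (d ℕ.+ m) x - S m x ∣ ≤ T (d ℕ.+ m) - T m
  tail′ m zero    {x} p = ℚ.≤-reflexive (trans (cong ∣_∣ (ℚ.+-inverseʳ (S m x))) (sym (ℚ.+-inverseʳ (T m))))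
  tail′ m (suc d) {x} p = begin
    ∣ S n x + c n * X - S m x ∣              ≡⟨ cong ∣_∣ (solve 3 (λ a b c → a :+ b :- c := (a :- c) :+ b) refl (S n x) (c n * X) (S m x)) ⟩
    ∣ (S n x - S m x) + c n * X ∣            ≤⟨ ℚ.∣p+q∣≤∣p∣+∣q∣ (S n x - S m x) (c n * X) ⟩
    ∣ S n x - S m x ∣ + ∣ c n * X ∣          ≤⟨ ℚ.+-mono-≤ (tail′ m d p) (ℚ.≤-trans (∣c*∣≤ n X) (term-bound n p)) ⟩
    T n - T m + t n                          ≡⟨ solve 3 (λ a b c → a :- b :+ c := a :+ c :- b) refl (T n) (T m) (t n) ⟩
    T n + t n - T m                          ∎
    where
    n = d ℕ.+ m
    X = expTerm n x

  tail : ∀ {m n x} → M ℕ.≤ m → m ℕ.≤ n → ∣ x ∣ ≤ B → ∣ S n x - S m x ∣ ≤ t m + t m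
  tail {m} {n} {x} M≤m m≤n p = begin
    ∣ S n x - S m x ∣            ≤⟨ subst (λ z → ∣ S z x - S m x ∣ ≤ T z - T m) (ℕ.m∸n+n≡m m≤n) (tail′ m (n ℕ.∸ m) p) ⟩
    T n - T m                    ≤⟨ ℚ.+-monoˡ-≤ (- T m) (ℚ.≤-trans (p≤p+q {T n} (+-nonNeg (0≤t n) (0≤t n))) (U-anti M≤m m≤n)) ⟩
    T m + (t m + t m) - T m      ≡⟨ solve 2 (λ a b → a :+ b :- a := b) refl (T m) (t m + t m) ⟩
    t m + t m                    ∎

  C : ℚ
  C = 1ℚ + 1ℚ + K

  0≤C : 0ℚ ≤ C
  0≤C = +-nonNeg (+-nonNeg 0≤1 0≤1) 0≤K

  estimate : ∀ m n x y {δ} → M ℕ.≤ m → m ℕ.≤ n → ∣ x ∣ ≤ B → ∣ y ∣ ≤ B → t m ≤ δ → ∣ x - y ∣ ≤ δ →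
             ∣ S m x - S n y ∣ ≤ C * δ
  estimate m n x y {δ} M≤m m≤n p q r s = begin
    ∣ S m x - S n y ∣                           ≡⟨ cong ∣_∣ (solve 3 (λ a b c → a :- c := (b :- c) :+ (a :- b)) refl (S m x) (S m y) (S n y)) ⟩
    ∣ (S m y - S n y) + (S m x - S m y) ∣       ≤⟨ ℚ.∣p+q∣≤∣p∣+∣q∣ (S m y - S n y) (S m x - S m y) ⟩
    ∣ S m y - S n y ∣ + ∣ S m x - S m y ∣       ≡⟨ cong (_+ ∣ S m x - S m y ∣) (∣p-q∣≡∣q-p∣ (S m y) (S n y)) ⟩
    ∣ S n y - S m y ∣ + ∣ S m x - S m y ∣       ≤⟨ ℚ.+-mono-≤ (ℚ.≤-trans (tail M≤m m≤n q) (ℚ.+-mono-≤ r r))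
                                                     (ℚ.≤-trans (lipschitz m p q)
                                                       (*-mono-≤ (0≤T′ m) (ℚ.≤-trans (T′≤T m) (T≤K m M≤m)) (ℚ.0≤∣p∣ (x - y)) s)) ⟩
    (δ + δ) + K * δ                             ≡⟨ solve 2 (λ δ K → (δ :+ δ) :+ K :* δ := (con 1ℚ :+ con 1ℚ :+ K) :* δ) refl δ K ⟩
    C * δ                                       ∎
    where
    0≤T′ : ∀ n → 0ℚ ≤ T′ n
    0≤T′ zero    = ℚ.≤-refl
    0≤T′ (suc n) = 0≤T n

-- The sum c₀ + c₁ x + c₂ x² / 2! + ⋯; its n-th approximation is the n-th
-- partial sum evaluated at the n-th approximation of x.
sumSeries : (c : ℕ → ℚ) → (∀ n → ∣ c n ∣ ≤ 1ℚ) → ℝ → ℝ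
sumSeries c c≤1 x = record
  { seq    = λ n → partialSum c n (seq x n)
  ; cauchy =
      let B , 0≤B , L , b = bounded x
          open Bound 0≤B using (M; t-small)
          open Series {c} c≤1 0≤B using (C; 0≤C; estimate)
      in isCauchy (λ n → partialSum c n (seq x n)) C 0≤C λ δ 0<δ →
      let N , p = cauchy x δ 0<δ
          P , q = t-small δ 0<δ
      in (L ℕ.⊔ M) ℕ.⊔ (N ℕ.⊔ P) , wlog (λ n → partialSum c n (seq x n)) λ m n h m≤n →
         let h₁ = ≤-max₁ {L ℕ.⊔ M} {N ℕ.⊔ P} h
             h₂ = ≤-max₂ {L ℕ.⊔ M} {N ℕ.⊔ P} h
             L≤m = ≤-max₁ {L} {M} h₁
             N≤m = ≤-max₁ {N} {P} h₂
         in estimate m n (seq x m) (seq x n) (≤-max₂ {L} {M} h₁) m≤n (b m L≤m) (b n (ℕ.≤-trans L≤m m≤n))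
              (q m (≤-max₂ {N} {P} h₂)) (ℚ.<⇒≤ (p m n N≤m (ℕ.≤-trans N≤m m≤n)))
  }
  where
  wlog : ∀ (y : ℕ → ℚ) {N ε} → (∀ m n → N ℕ.≤ m → m ℕ.≤ n → ∣ y m - y n ∣ ≤ ε) →
         ∀ m n → N ℕ.≤ m → N ℕ.≤ n → ∣ y m - y n ∣ ≤ ε
  wlog y {N} {ε} f m n N≤m N≤n with ℕ.≤-total m n
  ... | inj₁ m≤n = f m n N≤m m≤n
  ... | inj₂ n≤m = subst (_≤ ε) (∣p-q∣≡∣q-p∣ (y n) (y m)) (f n m N≤n n≤m)

sinCoefficient cosCoefficient : ℕ → ℚ
sinCoefficient zero    = 0ℚ
sinCoefficient (suc n) = cosCoefficient n
cosCoefficient zero    = 1ℚ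
cosCoefficient (suc n) = - sinCoefficient n

∣sinCoefficient∣≤1 : ∀ n → ∣ sinCoefficient n ∣ ≤ 1ℚ
∣cosCoefficient∣≤1 : ∀ n → ∣ cosCoefficient n ∣ ≤ 1ℚ
∣sinCoefficient∣≤1 zero    = 0≤1
∣sinCoefficient∣≤1 (suc n) = ∣cosCoefficient∣≤1 n
∣cosCoefficient∣≤1 zero    = ℚ.≤-refl
∣cosCoefficient∣≤1 (suc n) =
  subst (_≤ 1ℚ) (sym (ℚ.∣-p∣≡∣p∣ (sinCoefficient n))) (∣sinCoefficient∣≤1 n)

sin cos : ℝ → ℝ
sin = sumSeries sinCoefficient ∣sinCoefficient∣≤1
cos = sumSeries cosCoefficient ∣cosCoefficient∣≤1

-- π is the least positive zero of the sine; this determines it up to `_≈ᴿ_`.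
record IsPi (π : ℝ) : Set where
  field
    0<π     : fromℚ 0ℚ <ᴿ π
    sinπ≈0  : sin π ≈ᴿ fromℚ 0ℚ
    minimal : ∀ x → fromℚ 0ℚ <ᴿ x → x <ᴿ π → ¬ sin x ≈ᴿ fromℚ 0ℚ

record ℂ : Set where
  field
    re : ℝ
    im : ℝ

open ℂ public

ℂ-rawRing : RawRing 0ℓ 0ℓ
ℂ-rawRing = record
  { Carrier = ℂ
  ; _≈_     = λ z w → re z ≈ᴿ re w × im z ≈ᴿ im w
  ; _+_     = λ z w → record { re = re z +ᴿ re w ; im = im z +ᴿ im w }
  ; _*_     = λ z w → record
    { re = re z *ᴿ re w +ᴿ (-ᴿ (im z *ᴿ im w))
    ; im = re z *ᴿ im w +ᴿ im z *ᴿ re w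
    }
  ; -_      = λ z → record { re = -ᴿ re z ; im = -ᴿ im z }
  ; 0#      = record { re = fromℚ 0ℚ ; im = fromℚ 0ℚ }
  ; 1#      = record { re = fromℚ 1ℚ ; im = fromℚ 0ℚ }
  }

-- Euler's formula as the definition of exp (i θ).
exp[i_] : ℝ → ℂ
exp[i θ ] = record { re = cos θ ; im = sin θ }

rootOfUnity : (π : ℝ) (k : ℕ) .{{_ : NonZero k}} → ℂ
rootOfUnity π k = exp[i fromℚ (+ 2 / k) *ᴿ π ]

infix 4 _≡_[mod_] _≡±_[mod_]

_≡_[mod_] : ℤ → ℤ → ℕ → Set
a ≡ b [mod k ] = + k ℤ.∣ a ℤ.- b

_≡±_[mod_] : ℕ → ℕ → ℕ → Set
i ≡± j [mod k ] = (+ i ≡ + j [mod k ]) ⊎ (+ i ≡ ℤ.- + j [mod k ])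

-- (i , j , s , t) stands for (i, j ∣ s, t).
Quadruple : Set
Quadruple = ℕ × ℕ × ℕ × ℕ

IsTrivial : ℕ → Pred Quadruple 0ℓ
IsTrivial k (i , j , s , t) =
  (i ≡± j [mod k ]) ⊎ (j ≡± t [mod k ]) ⊎ (t ≡± s [mod k ]) ⊎ (s ≡± i [mod k ])

module Overlaps {c ℓ} (R : RawRing c ℓ) where

  open RawRing R using (Carrier; _≈_; 1#; rawSemiring) renaming (_+_ to _+ʳ_; _*_ to _*ʳ_; -_ to -ʳ_)
  open RawSemiringDefinitions rawSemiring using (_^_)

  record IsOverlap (φ : Carrier) (k : ℕ) (q : Quadruple) : Set ℓ where
    private
      i = proj₁ q
      j = proj₁ (proj₂ q)
      s = proj₁ (proj₂ (proj₂ q))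
      t = proj₂ (proj₂ (proj₂ q))
    field
      i-range  : 1 ℕ.≤ i × i ℕ.< k
      j-range  : 1 ℕ.≤ j × j ℕ.< k
      s-range  : 1 ℕ.≤ s × s ℕ.< k
      t-range  : 1 ℕ.≤ t × t ℕ.< k
      i≢s      : ¬ i ≡ s
      relation : ∃[ ω ] (ω ℕ.< k ×
        φ ^ ω *ʳ (φ ^ j +ʳ -ʳ 1#) *ʳ (φ ^ s +ʳ -ʳ 1#) ≈ (φ ^ i +ʳ -ʳ 1#) *ʳ (φ ^ t +ʳ -ʳ 1#))

  NontrivialOverlaps : Carrier → ℕ → Pred Quadruple ℓ
  NontrivialOverlaps φ k q = IsOverlap φ k q × ¬ IsTrivial k q

𝒪ℂ : (π : ℝ) (k : ℕ) .{{_ : NonZero k}} → Pred Quadruple 0ℓ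
𝒪ℂ π k = Overlaps.NontrivialOverlaps ℂ-rawRing (rootOfUnity π k) k

HasSize : ∀ {c ℓ} → Setoid c ℓ → ℕ → Set (c ⊔ ℓ)
HasSize S n = Inverse S (≡.setoid (Fin n))

record FiniteField c ℓ : Set (lsuc (c ⊔ ℓ)) where
  field
    commutativeRing : CommutativeRing c ℓ
  open CommutativeRing commutativeRing using (Carrier; _≈_; 0#; 1#; setoid) renaming (_*_ to _*ʳ_)
  field
    nontrivial : ¬ 0# ≈ 1#
    inverse    : ∀ x → ¬ x ≈ 0# → ∃[ y ] x *ʳ y ≈ 1#
    size       : ℕ
    finite     : HasSize setoid size

module _ {c ℓ} (F : FiniteField c ℓ) where

  open CommutativeRing (FiniteField.commutativeRing F)
    using (Carrier; _≈_; 0#; 1#; setoid; rawRing) renaming (_*_ to _*ʳ_)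
  private module R = RawSemiringDefinitions (RawRing.rawSemiring rawRing)

  HasCharacteristic : ℕ → Set ℓ
  HasCharacteristic p = ∀ n → (n R.× 1# ≈ 0#) ⇔ (p ℕ.∣ n)

  -- Subgroups of the multiplicative group F*
  record UnitSubgroup p : Set (c ⊔ ℓ ⊔ lsuc p) where
    field
      member         : Pred Carrier p
      respects       : ∀ {x y} → x ≈ y → member x → member y
      nonzero        : ∀ {x} → member x → ¬ x ≈ 0#
      1-member       : member 1#
      *-closed       : ∀ {x y} → member x → member y → member (x *ʳ y)
      inverse-closed : ∀ {x y} → member x → x *ʳ y ≈ 1# → member y

    elements : Setoid (c ⊔ p) ℓ
    elements = On.setoid {B = Σ Carrier member} setoid proj₁

  HasOrder : ∀ {p} → UnitSubgroup p → ℕ → Set (c ⊔ ℓ ⊔ p)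
  HasOrder Φ k = HasSize (UnitSubgroup.elements Φ) k

  -- Natural exponents suffice in a finite group.
  IsGenerator : ∀ {p} → Carrier → UnitSubgroup p → Set (c ⊔ ℓ ⊔ p)
  IsGenerator φ Φ = member φ × (∀ x → member x → ∃[ n ] x ≈ φ R.^ n)
    where open UnitSubgroup Φ

  𝒪 : Carrier → ℕ → Pred Quadruple ℓ
  𝒪 = Overlaps.NontrivialOverlaps rawRing

module _ (c ℓ p : Level) where

  ExceptionalPrime : (π : ℝ) (k : ℕ) .{{_ : NonZero k}} → Pred ℕ (lsuc (c ⊔ ℓ ⊔ p))
  ExceptionalPrime π k q =
    Prime q ×
    ( q ℕ.∣ k
    ⊎ Σ (FiniteField c ℓ) λ F →
      HasCharacteristic F q ×
      Σ (UnitSubgroup F p) λ Φ →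
      HasOrder F Φ k ×
      ∃[ φ ] (IsGenerator F φ Φ × ¬ (𝒪 F φ k ≐ 𝒪ℂ π k)))

-- Any set contained in a finite list counts as finite: no decision
-- procedure for membership is demanded.
IsFinite : ∀ {a ℓ} {A : Set a} → Pred A ℓ → Set (a ⊔ ℓ)
IsFinite {A = A} P = Σ (List A) λ xs → P ⊆ (_∈ xs)

module Submission where

-- In ℤ[x]/(xᵏ − 1) let σ_a be the endomorphism x ↦ xᵃ. If p is a prime not
-- dividing k, then h σ_p(h) = 0 forces h = 0: modulo p it reads h^(p+1) = 0,
-- so p divides h, and the quotient h / p satisfies the same equation. Applied to
-- h = σ_p(f) g this shows that f g = 0 implies σ_p(f) g = 0, hence σ_a(f) g = 0
-- for all a coprime to k. This replaces the irreducibility of the cyclotomic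
-- polynomial.
--
-- Since 1, f, …, fᵏ are linearly dependent over ℤ, there is an annihilating
-- product fⁿ (c + f u) = 0 with an integer c ≠ 0. Let z be a primitive k-th root
-- of unity in a domain where c ≠ 0. If f(z) = 0, then σ_a(fⁿ) (c + f u) = 0
-- evaluates to f(zᵃ)ⁿ c = 0, so f vanishes at all conjugates zᵃ, and f P, where
-- P = ∏ (xᵈ − 1) over 0 < d < k, vanishes at all k-th roots of unity. By Fourier
-- inversion k times each coefficient of f P is 0 in the domain. Over ℂ this
-- means f P = 0, and then f vanishes at the primitive k-th roots of unity of
-- every domain, because P does not: this is (a). Over a field of characteristic
-- q the conclusion f P = 0 remains true once q exceeds c and k times the
-- coefficients of f P. For (b) take the maximum of these bounds over the finitely
-- many f = x^ω (xʲ − 1)(xˢ − 1) − (xⁱ − 1)(xᵗ − 1).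

open import Defs

-- The step from h^(p+1) = 0 to h = 0 modulo p needs the group ring modulo p to be reduced. It is,
-- because Frobenius there is σ_p, and σ_p is injective as soon as p is invertible modulo k. The
-- obstacle is that equality of Cauchy reals is undecidable: a proof cannot branch on whether a
-- complex number vanishes. All case distinctions are therefore made over ℤ, where the linear
-- relation, its lowest nonzero coefficient and the final bound are computed. A domain enters only
-- when a finished identity of ℤ[x]/(xᵏ - 1) is evaluated in it and a factor already known to be
-- nonzero is cancelled. Negative conclusions reached this way become positive ones because equality
-- with 0 is stable under double negation, in ℂ as in a finite field. On the analytic side nothing
-- is known of π beyond its minimality as a positive zero of the sine, so the addition theorem has
-- to be derived from the power series before exp(2πi/k) can be seen to be primitive.

module CyclotomicTransfer where

  open import Algebra.Bundles using (CommutativeRing; RawRing)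
  import Algebra.Definitions.RawSemiring as RawSemiringDefinitions
  import Algebra.Properties.CommutativeSemigroup as CommutativeSemigroupProperties
  import Algebra.Properties.CommutativeSemiring.Binomial as Binomial
  import Algebra.Properties.CommutativeSemiring.Exp as Exp
  import Algebra.Properties.Ring as RingProperties
  import Algebra.Properties.Semiring.Mult as Mult
  import Algebra.Properties.Semiring.Sum as Sum
  open import Data.Bool.Base using (if_then_else_)
  open import Data.Fin.Base as Fin using (Fin; zero; suc; toℕ; fromℕ<)
  import Data.Fin.Properties as Fin
  open import Data.Integer.Base as ℤ using (ℤ; +_; -[1+_]; 0ℤ; 1ℤ)
  open import Data.Integer.Divisibility.Signed as ℤ using (divides)
  import Data.Integer.Properties as ℤ
  open import Data.Integer.Solver using (module +-*-Solver)
  open import Data.List.Base using (List; []; _∷_; _++_; map; upTo)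
  open import Data.List.Membership.Propositional.Properties using (∈-upTo⁺)
  open import Data.List.Relation.Unary.All using (All; []; _∷_)
  open import Data.Nat.Base as ℕ using (ℕ; zero; suc; NonZero; _≤_; _<_; s≤s; z≤n; _!)
  open import Data.Nat.Combinatorics
    using (nCn≡1; nCk≡n!/k![n-k]!; k![n∸k]!∣n!) renaming (_C_ to _choose_)
  open import Data.Nat.Coprimality using (Coprime)
  import Data.Nat.Coprimality as Coprimality
  open import Data.Nat.DivMod using (_%_)
  import Data.Nat.DivMod as ℕ
  import Data.Nat.Divisibility as ℕ
  open import Data.Nat.GCD using (module Bézout; gcd; gcd[m,n]∣m; gcd[m,n]∣n)
  open import Data.Nat.ListAction using (product)
  open import Data.Nat.Primality using (Prime; euclidsLemma; prime⇒nonZero; prime⇒nonTrivial)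
  open import Data.Nat.Primality.Factorisation using (factorise)
  import Data.Nat.Properties as ℕ
  open import Data.Nat.Solver using () renaming (module +-*-Solver to ℕ-Solver)
  open import Data.Product.Base using (∃-syntax; _×_; _,_; proj₁; proj₂; Σ)
  open import Data.Sum.Base using (_⊎_; inj₁; inj₂)
  open import Data.Vec.Base as Vec using (Vec; []; _∷_; lookup; insertAt; removeAt)
  import Data.Vec.Properties as Vec
  open import Function.Base using (_∘_; id)
  open import Function.Bundles using (Inverse; Equivalence)
  open import Level using (Level; 0ℓ) renaming (_⊔_ to _⊔ˡ_)
  open import Relation.Binary.Definitions using (tri<; tri≈; tri>)
  open import Relation.Binary.PropositionalEquality as ≡ using (_≡_)
  import Relation.Binary.Reasoning.Setoid as SetoidReasoning
  open import Relation.Nullary using (¬_; yes; no; contradiction; Dec; does)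
  open import Relation.Nullary.Decidable using (dec-true; dec-false; ¬?; decidable-stable)
  open import Relation.Unary using (_⊆_; _≐_)

  -- Binomial coefficients modulo p and the Frobenius endomorphism.

  prime∤! : ∀ {p} → Prime p → ∀ n → n < p → ¬ p ℕ.∣ n !
  prime∤! {p} pr zero    n<p p∣ = ℕ.<⇒≱ (ℕ.nonTrivial⇒n>1 p {{prime⇒nonTrivial pr}}) (ℕ.∣⇒≤ p∣)
  prime∤! pr (suc n) n<p p∣ with euclidsLemma (suc n) (n !) pr p∣
  ... | inj₁ p∣1+n = ℕ.<⇒≱ n<p (ℕ.∣⇒≤ p∣1+n)
  ... | inj₂ p∣n!  = prime∤! pr n (ℕ.<-trans (ℕ.n<1+n n) n<p) p∣n!

  n∣n! : ∀ n .{{_ : NonZero n}} → n ℕ.∣ n !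
  n∣n! (suc n) = ℕ.m∣m*n (n !)

  -- The product of the binomial coefficient with k ! and (p - k) ! is p !, which p divides. Both
  -- factorials are prime to p, since k and p - k are smaller than p.
  prime∣C : ∀ {p} → Prime p → ∀ {k} → 0 < k → k < p → p ℕ.∣ p choose k
  prime∣C {p} pr {k} 0<k k<p with euclidsLemma (p choose k) (k ! ℕ.* (p ℕ.∸ k) !) pr p∣C*d
    where
    instance
      _ = prime⇒nonZero pr
      _ = k ℕ.!* (p ℕ.∸ k) !≢0
    p∣C*d : p ℕ.∣ (p choose k) ℕ.* (k ! ℕ.* (p ℕ.∸ k) !)
    p∣C*d = ≡.subst (p ℕ.∣_)
      (≡.sym (≡.trans (≡.cong (ℕ._* (k ! ℕ.* (p ℕ.∸ k) !)) (nCk≡n!/k![n-k]! (ℕ.<⇒≤ k<p)))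
                      (ℕ.m/n*n≡m (k![n∸k]!∣n! (ℕ.<⇒≤ k<p)))))
      (n∣n! p)
  ... | inj₁ p∣C = p∣C
  ... | inj₂ p∣d with euclidsLemma (k !) _ pr p∣d
  ...   | inj₁ p∣k! = contradiction p∣k! (prime∤! pr k k<p)
  ...   | inj₂ p∣q! = contradiction p∣q! (prime∤! pr (p ℕ.∸ k) (ℕ.∸-monoʳ-< 0<k (ℕ.<⇒≤ k<p)))

  module Frobenius {c ℓ} (A : CommutativeRing c ℓ) {p} (pr : Prime p)
    (p×1≈0 : CommutativeRing._≈_ A
      (RawSemiringDefinitions._×_ (RawRing.rawSemiring (CommutativeRing.rawRing A)) p (CommutativeRing.1# A))
      (CommutativeRing.0# A)) where

    open CommutativeRing A hiding (zero)
    open Binomial commutativeSemiring using (binomialTerm; theorem)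
    open Exp commutativeSemiring using (_^_)
    open Mult semiring using (×-assocˡ; ×-assoc-*; ×-congʳ; ×-homo-1) renaming (_×_ to _·_)
    open Sum semiring using (sum; sum-init-last; sum-cong-≋; sum-replicate-zero)
    open SetoidReasoning setoid

    p×x≈0 : ∀ x → p · x ≈ 0#
    p×x≈0 x = begin
      p · x           ≈⟨ ×-congʳ p (*-identityˡ x) ⟨
      p · (1# * x)    ≈⟨ ×-assoc-* p 1# x ⟨
      (p · 1#) * x    ≈⟨ *-congʳ p×1≈0 ⟩
      0# * x          ≈⟨ zeroˡ x ⟩
      0#              ∎

    multiple×x≈0 : ∀ {m} → p ℕ.∣ m → ∀ x → m · x ≈ 0#
    multiple×x≈0 (ℕ.divides q ≡.refl) x = begin
      (q ℕ.* p) · x   ≡⟨ ≡.cong (_· x) (ℕ.*-comm q p) ⟩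
      (p ℕ.* q) · x   ≈⟨ ×-assocˡ x p q ⟨
      p · (q · x)     ≈⟨ p×x≈0 (q · x) ⟩
      0#              ∎

    -- All binomial terms except the two outer ones are multiples of p. Splitting off the last one
    -- requires p to be a visible successor, hence the equation as an argument.
    frobenius-+′ : ∀ n → p ≡ suc n → ∀ x y → (x + y) ^ p ≈ x ^ p + y ^ p
    frobenius-+′ n ≡.refl x y = begin
      (x + y) ^ p                                         ≈⟨ theorem p x y ⟩
      b zero + sum (b ∘ suc)                              ≈⟨ +-cong first (sum-init-last (b ∘ suc)) ⟩
      y ^ p + (sum (b ∘ suc ∘ Fin.inject₁) + b (suc (Fin.fromℕ n))) ≈⟨ +-congˡ (+-cong middle last) ⟩
      y ^ p + (0# + x ^ p)                                ≈⟨ +-congˡ (+-identityˡ _) ⟩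
      y ^ p + x ^ p                                       ≈⟨ +-comm _ _ ⟩
      x ^ p + y ^ p                                       ∎
      where
      b = binomialTerm x y p
      first : b zero ≈ y ^ p
      first = trans (×-homo-1 _) (*-identityˡ _)
      middle : sum (b ∘ suc ∘ Fin.inject₁) ≈ 0#
      middle = trans
        (sum-cong-≋ {y = λ _ → 0#} λ i → multiple×x≈0
          (prime∣C pr (s≤s z≤n) (s≤s (≡.subst (_< n) (≡.sym (Fin.toℕ-inject₁ i)) (Fin.toℕ<n i)))) _)
        (sum-replicate-zero n)
      last : b (suc (Fin.fromℕ n)) ≈ x ^ p
      last = begin
        b (suc (Fin.fromℕ n))                ≡⟨ ≡.cong (λ m → (p choose suc m) · (x ^ suc m * y ^ (p ℕ.∸ suc m))) (Fin.toℕ-fromℕ n) ⟩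
        (p choose p) · (x ^ p * y ^ (p ℕ.∸ p))    ≡⟨ ≡.cong₂ (λ m d → m · (x ^ p * y ^ d)) (nCn≡1 p) (ℕ.n∸n≡0 p) ⟩
        1 · (x ^ p * 1#)                     ≈⟨ ×-homo-1 _ ⟩
        x ^ p * 1#                           ≈⟨ *-identityʳ _ ⟩
        x ^ p                                ∎

    frobenius-+ : ∀ x y → (x + y) ^ p ≈ x ^ p + y ^ p
    frobenius-+ = frobenius-+′ (ℕ.pred p) (≡.sym (ℕ.suc-pred p {{prime⇒nonZero pr}}))

    frobenius-0 : 0# ^ p ≈ 0#
    frobenius-0 = aux p {{prime⇒nonZero pr}}
      where
      aux : ∀ n .{{_ : NonZero n}} → 0# ^ n ≈ 0#
      aux (suc n) = zeroˡ _

  -- Homomorphisms from ℤ.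

  -- Kept as a parameter because three instances are used: the identity of ℤ, reduction modulo m,
  -- and the canonical map to an arbitrary ring.
  record IntegerHom {c ℓ} (D : CommutativeRing c ℓ) : Set (c Level.⊔ ℓ) where
    open CommutativeRing D hiding (zero)
    field
      ι   : ℤ → Carrier
      ι-0 : ι 0ℤ ≈ 0#
      ι-1 : ι 1ℤ ≈ 1#
      ι-+ : ∀ i j → ι (i ℤ.+ j) ≈ ι i + ι j
      ι-* : ∀ i j → ι (i ℤ.* j) ≈ ι i * ι j

    open RingProperties ring using (+-inverseˡ-unique)

    ι-neg : ∀ i → ι (ℤ.- i) ≈ - ι i
    ι-neg i = +-inverseˡ-unique _ _ (trans (sym (ι-+ (ℤ.- i) i)) (trans (reflexive (≡.cong ι (ℤ.+-inverseˡ i))) ι-0))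

  module _ {c ℓ} (D : CommutativeRing c ℓ) where

    open CommutativeRing D hiding (zero)
    open Mult semiring using (×-homo-+; ×-homo-1; ×1-homo-*) renaming (_×_ to _·_)
    open RingProperties ring
    open SetoidReasoning setoid

    private
      ι : ℤ → Carrier
      ι (+ n)    = n · 1#
      ι -[1+ n ] = - (suc n · 1#)

      ι-neg⁺ : ∀ n → ι (ℤ.- + n) ≈ - (n · 1#)
      ι-neg⁺ zero    = sym -0#≈0#
      ι-neg⁺ (suc n) = refl

      ι-⊖ : ∀ m n → ι (m ℤ.⊖ n) ≈ m · 1# - n · 1#
      ι-⊖ m       zero    = sym (trans (+-congˡ -0#≈0#) (+-identityʳ _))
      ι-⊖ zero    (suc n) = sym (+-identityˡ _)
      ι-⊖ (suc m) (suc n) = begin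
        ι (suc m ℤ.⊖ suc n)            ≡⟨ ≡.cong ι (ℤ.[1+m]⊖[1+n]≡m⊖n m n) ⟩
        ι (m ℤ.⊖ n)                    ≈⟨ ι-⊖ m n ⟩
        a - b                          ≈⟨ +-congʳ (+-identityʳ a) ⟨
        a + 0# - b                     ≈⟨ +-congʳ (+-congˡ (-‿inverseʳ 1#)) ⟨
        a + (1# - 1#) - b              ≈⟨ +-congʳ (+-assoc a 1# (- 1#)) ⟨
        a + 1# - 1# - b                ≈⟨ +-assoc _ _ _ ⟩
        a + 1# + (- 1# - b)            ≈⟨ +-cong (+-comm a 1#) (-‿+-comm 1# b) ⟩
        1# + a - (1# + b)              ∎
        where
        a = m · 1#
        b = n · 1#

      ι-neg′ : ∀ i → ι (ℤ.- i) ≈ - ι i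
      ι-neg′ (+ n)    = ι-neg⁺ n
      ι-neg′ -[1+ n ] = sym (-‿involutive _)

      ι-+′ : ∀ i j → ι (i ℤ.+ j) ≈ ι i + ι j
      ι-+′ (+ m)    (+ n)    = ×-homo-+ 1# m n
      ι-+′ (+ m)    -[1+ n ] = ι-⊖ m (suc n)
      ι-+′ -[1+ m ] (+ n)    = trans (ι-⊖ n (suc m)) (+-comm _ _)
      ι-+′ -[1+ m ] -[1+ n ] = begin
        - (suc (suc (m ℕ.+ n)) · 1#)       ≡⟨ ≡.cong (λ z → - (suc z · 1#)) (≡.sym (ℕ.+-suc m n)) ⟩
        - ((suc m ℕ.+ suc n) · 1#)         ≈⟨ -‿cong (×-homo-+ 1# (suc m) (suc n)) ⟩
        - (suc m · 1# + suc n · 1#)        ≈⟨ -‿+-comm _ _ ⟨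
        - (suc m · 1#) - suc n · 1#        ∎

      ι-*⁺ : ∀ m j → ι (+ m ℤ.* j) ≈ m · 1# * ι j
      ι-*⁺ m (+ n) = trans (reflexive (≡.cong ι (≡.sym (ℤ.pos-* m n)))) (×1-homo-* m n)
      ι-*⁺ m -[1+ n ] = begin
        ι (+ m ℤ.* ℤ.- + suc n)       ≡⟨ ≡.cong ι (≡.sym (ℤ.neg-distribʳ-* (+ m) (+ suc n))) ⟩
        ι (ℤ.- (+ m ℤ.* + suc n))     ≈⟨ ι-neg′ (+ m ℤ.* + suc n) ⟩
        - ι (+ m ℤ.* + suc n)         ≈⟨ -‿cong (ι-*⁺ m (+ suc n)) ⟩
        - (m · 1# * (suc n · 1#))     ≈⟨ -‿distribʳ-* _ _ ⟩
        m · 1# * - (suc n · 1#)       ∎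

      ι-*′ : ∀ i j → ι (i ℤ.* j) ≈ ι i * ι j
      ι-*′ (+ m)    j = ι-*⁺ m j
      ι-*′ -[1+ m ] j = begin
        ι (ℤ.- + suc m ℤ.* j)         ≡⟨ ≡.cong ι (≡.sym (ℤ.neg-distribˡ-* (+ suc m) j)) ⟩
        ι (ℤ.- (+ suc m ℤ.* j))       ≈⟨ ι-neg′ (+ suc m ℤ.* j) ⟩
        - ι (+ suc m ℤ.* j)           ≈⟨ -‿cong (ι-*⁺ (suc m) j) ⟩
        - (suc m · 1# * ι j)          ≈⟨ -‿distribˡ-* _ _ ⟩
        - (suc m · 1#) * ι j          ∎

    integerHom : IntegerHom D
    integerHom = record
      { ι = ι ; ι-0 = refl ; ι-1 = ×-homo-1 1# ; ι-+ = ι-+′ ; ι-* = ι-*′ }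

  -- Integer polynomials, linear functionals on them, and the group ring.

  -- (c , n) ∷ f stands for c xⁿ + f.
  Poly : Set
  Poly = List (ℤ × ℕ)

  infixl 7 _⊛_

  scale : ℤ → ℕ → Poly → Poly
  scale c m = map λ (d , n) → c ℤ.* d , m ℕ.+ n

  _⊛_ : Poly → Poly → Poly
  []            ⊛ g = []
  ((c , m) ∷ f) ⊛ g = scale c m g ++ f ⊛ g

  ⊖_ : Poly → Poly
  ⊖_ = scale (ℤ.- 1ℤ) 0

  monomial : ℤ → ℕ → Poly
  monomial c n = (c , n) ∷ []

  𝟙 : Poly
  𝟙 = monomial 1ℤ 0

  -- f (x) ↦ f (xᵃ)
  σ : ℕ → Poly → Poly
  σ a = map λ (c , n) → c , a ℕ.* n

  module Pairing {c ℓ} {D : CommutativeRing c ℓ} (H : IntegerHom D) where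

    open CommutativeRing D hiding (zero)
    open IntegerHom H
    open CommutativeSemigroupProperties +-commutativeSemigroup
      using () renaming (interchange to +-interchange)
    open CommutativeSemigroupProperties *-commutativeSemigroup
      using (x∙yz≈y∙xz)
    open SetoidReasoning setoid

    -- The linear functional sending xⁿ to θ n. Evaluation at a point and extraction of a
    -- coefficient are both of this form, so one calculus serves both.
    pair : Poly → (ℕ → Carrier) → Carrier
    pair []            θ = 0#
    pair ((c , n) ∷ f) θ = ι c * θ n + pair f θ

    pair-cong : ∀ f {θ η} → (∀ n → θ n ≈ η n) → pair f θ ≈ pair f η
    pair-cong []            θ≈η = refl
    pair-cong ((c , n) ∷ f) θ≈η = +-cong (*-congˡ (θ≈η n)) (pair-cong f θ≈η)

    pair-++ : ∀ f g θ → pair (f ++ g) θ ≈ pair f θ + pair g θ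
    pair-++ []            g θ = sym (+-identityˡ _)
    pair-++ ((c , n) ∷ f) g θ = trans (+-congˡ (pair-++ f g θ)) (sym (+-assoc _ _ _))

    pair-+ : ∀ f θ η → pair f (λ n → θ n + η n) ≈ pair f θ + pair f η
    pair-+ []            θ η = sym (+-identityˡ _)
    pair-+ ((c , n) ∷ f) θ η = trans (+-cong (distribˡ _ _ _) (pair-+ f θ η)) (+-interchange _ _ _ _)

    pair-*ˡ : ∀ f d θ → pair f (λ n → d * θ n) ≈ d * pair f θ
    pair-*ˡ []            d θ = sym (zeroʳ d)
    pair-*ˡ ((c , n) ∷ f) d θ = trans (+-cong (x∙yz≈y∙xz _ _ _) (pair-*ˡ f d θ)) (sym (distribˡ _ _ _))

    pair-0 : ∀ f → pair f (λ _ → 0#) ≈ 0#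
    pair-0 []            = refl
    pair-0 ((c , n) ∷ f) = trans (+-cong (zeroʳ _) (pair-0 f)) (+-identityˡ _)

    -- Interchange of two finite sums; it is what makes `_⊛_` commutative.
    pair-swap : ∀ f g (θ : ℕ → ℕ → Carrier) → pair f (λ m → pair g (λ n → θ m n)) ≈ pair g (λ n → pair f (λ m → θ m n))
    pair-swap []            g θ = sym (pair-0 g)
    pair-swap ((c , m) ∷ f) g θ = begin
      ι c * pair g (θ m) + pair f (λ m → pair g (θ m))                    ≈⟨ +-cong (sym (pair-*ˡ g (ι c) (θ m))) (pair-swap f g θ) ⟩
      pair g (λ n → ι c * θ m n) + pair g (λ n → pair f (λ m → θ m n))   ≈⟨ pair-+ g _ _ ⟨
      pair g (λ n → ι c * θ m n + pair f (λ m → θ m n))                  ∎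

    pair-scale : ∀ c m g θ → pair (scale c m g) θ ≈ ι c * pair g (λ n → θ (m ℕ.+ n))
    pair-scale c m []            θ = sym (zeroʳ _)
    pair-scale c m ((d , n) ∷ g) θ = begin
      ι (c ℤ.* d) * θ (m ℕ.+ n) + pair (scale c m g) θ      ≈⟨ +-cong (trans (*-congʳ (ι-* c d)) (*-assoc _ _ _)) (pair-scale c m g θ) ⟩
      ι c * (ι d * θ (m ℕ.+ n)) + ι c * pair g (θ ∘ (m ℕ.+_))  ≈⟨ distribˡ _ _ _ ⟨
      ι c * (ι d * θ (m ℕ.+ n) + pair g (θ ∘ (m ℕ.+_)))     ∎

    pair-⊛ : ∀ f g θ → pair (f ⊛ g) θ ≈ pair f (λ m → pair g (λ n → θ (m ℕ.+ n)))
    pair-⊛ []            g θ = refl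
    pair-⊛ ((c , m) ∷ f) g θ = begin
      pair (scale c m g ++ f ⊛ g) θ              ≈⟨ pair-++ (scale c m g) (f ⊛ g) θ ⟩
      pair (scale c m g) θ + pair (f ⊛ g) θ      ≈⟨ +-cong (pair-scale c m g θ) (pair-⊛ f g θ) ⟩
      ι c * pair g (λ n → θ (m ℕ.+ n)) + pair f (λ m → pair g (λ n → θ (m ℕ.+ n)))  ∎

    pair-monomial : ∀ c n θ → pair (monomial c n) θ ≈ ι c * θ n
    pair-monomial c n θ = +-identityʳ _

    pair-⊖ : ∀ f θ → pair (⊖ f) θ ≈ - pair f θ
    pair-⊖ f θ = begin
      pair (⊖ f) θ              ≈⟨ pair-scale (ℤ.- 1ℤ) 0 f θ ⟩
      ι (ℤ.- 1ℤ) * pair f θ     ≈⟨ *-congʳ (trans (ι-neg 1ℤ) (-‿cong ι-1)) ⟩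
      - 1# * pair f θ           ≈⟨ -1*x≈-x _ ⟩
      - pair f θ                ∎
      where open RingProperties ring using (-1*x≈-x)

    pair-σ : ∀ a f θ → pair (σ a f) θ ≈ pair f (λ n → θ (a ℕ.* n))
    pair-σ a []            θ = refl
    pair-σ a ((c , n) ∷ f) θ = +-congˡ (pair-σ a f θ)

  -- The group ring D[x]/(xᵏ − 1), its elements being represented by integer
  -- polynomials. They are identified when every k-periodic function of the
  -- exponents pairs equally with both.
  module GroupRing (k : ℕ) {c ℓ} {D : CommutativeRing c ℓ} (H : IntegerHom D) where

    open CommutativeRing D hiding (zero; isCommutativeRing)
    open IntegerHom H
    open Pairing H public
    open SetoidReasoning setoid

    Periodic : (ℕ → Carrier) → Set ℓ
    Periodic θ = ∀ n → θ (k ℕ.+ n) ≈ θ n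

    infix 4 _≃_

    record _≃_ (f g : Poly) : Set (c ⊔ˡ ℓ) where
      constructor equal
      field pair-≃ : ∀ θ → Periodic θ → pair f θ ≈ pair g θ

    open _≃_ public

    private
      shiftˡ : ∀ m {θ} → Periodic θ → Periodic (λ n → θ (m ℕ.+ n))
      shiftˡ m {θ} per n = trans (reflexive (≡.cong θ eq)) (per (m ℕ.+ n))
        where
        eq : m ℕ.+ (k ℕ.+ n) ≡ k ℕ.+ (m ℕ.+ n)
        eq = ≡.trans (≡.sym (ℕ.+-assoc m k n)) (≡.trans (≡.cong (ℕ._+ n) (ℕ.+-comm m k)) (ℕ.+-assoc k m n))

    groupRing : CommutativeRing 0ℓ (c ⊔ˡ ℓ)
    groupRing = record
      { Carrier = Poly ; _≈_ = _≃_ ; _+_ = _++_ ; _*_ = _⊛_ ; -_ = ⊖_ ; 0# = [] ; 1# = 𝟙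
      ; isCommutativeRing = record
        { isRing = record
          { +-isAbelianGroup = record
            { isGroup = record
              { isMonoid = record
                { isSemigroup = record
                  { isMagma = record
                    { isEquivalence = record
                      { refl  = equal λ _ _ → refl
                      ; sym   = λ p → equal λ θ per → sym (pair-≃ p θ per)
                      ; trans = ≃-trans
                      }
                    ; ∙-cong = +-cong₁
                    }
                  ; assoc = λ f g h → equal λ θ per → begin
                      pair ((f ++ g) ++ h) θ              ≈⟨ trans (pair-++ (f ++ g) h θ) (+-congʳ (pair-++ f g θ)) ⟩
                      pair f θ + pair g θ + pair h θ      ≈⟨ +-assoc _ _ _ ⟩
                      pair f θ + (pair g θ + pair h θ)    ≈⟨ trans (pair-++ f (g ++ h) θ) (+-congˡ (pair-++ g h θ)) ⟨
                      pair (f ++ (g ++ h)) θ              ∎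
                  }
                ; identity = (λ f → equal λ _ _ → refl)
                           , (λ f → equal λ θ _ → trans (pair-++ f [] θ) (+-identityʳ _))
                }
              ; inverse = (λ f → equal λ θ _ → trans (pair-++ (⊖ f) f θ) (trans (+-congʳ (pair-⊖ f θ)) (-‿inverseˡ _)))
                        , (λ f → equal λ θ _ → trans (pair-++ f (⊖ f) θ) (trans (+-congˡ (pair-⊖ f θ)) (-‿inverseʳ _)))
              ; ⁻¹-cong = λ {f} {g} p → equal λ θ per →
                  trans (pair-⊖ f θ) (trans (-‿cong (pair-≃ p θ per)) (sym (pair-⊖ g θ)))
              }
            ; comm = λ f g → equal λ θ _ → trans (pair-++ f g θ) (trans (+-comm _ _) (sym (pair-++ g f θ)))
            }
          ; *-cong = λ {f} {f′} {g} {g′} p q → equal λ θ per → begin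
              pair (f ⊛ g) θ                                ≈⟨ pair-⊛ f g θ ⟩
              pair f (λ m → pair g (λ n → θ (m ℕ.+ n)))     ≈⟨ pair-cong f (λ m → pair-≃ q _ (shiftˡ m per)) ⟩
              -- The inner pairing is itself a k-periodic function of m, so `p` applies to the outer
              -- one.
              pair f (λ m → pair g′ (λ n → θ (m ℕ.+ n)))    ≈⟨ pair-≃ p _ (λ m → pair-cong g′ (λ n →
                                                                 trans (reflexive (≡.cong θ (ℕ.+-assoc k m n))) (per _))) ⟩
              pair f′ (λ m → pair g′ (λ n → θ (m ℕ.+ n)))   ≈⟨ pair-⊛ f′ g′ θ ⟨
              pair (f′ ⊛ g′) θ                              ∎
          ; *-assoc = λ f g h → equal λ θ _ → begin
              pair ((f ⊛ g) ⊛ h) θ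
                ≈⟨ pair-⊛ (f ⊛ g) h θ ⟩
              pair (f ⊛ g) (λ m → pair h (λ n → θ (m ℕ.+ n)))
                ≈⟨ pair-⊛ f g _ ⟩
              pair f (λ l → pair g (λ m → pair h (λ n → θ (l ℕ.+ m ℕ.+ n))))
                ≈⟨ pair-cong f (λ l → pair-cong g (λ m → pair-cong h (λ n → reflexive (≡.cong θ (ℕ.+-assoc l m n))))) ⟩
              pair f (λ l → pair g (λ m → pair h (λ n → θ (l ℕ.+ (m ℕ.+ n)))))
                ≈⟨ pair-cong f (λ l → pair-⊛ g h _) ⟨
              pair f (λ l → pair (g ⊛ h) (λ n → θ (l ℕ.+ n)))
                ≈⟨ pair-⊛ f (g ⊛ h) θ ⟨
              pair (f ⊛ (g ⊛ h)) θ ∎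
          ; *-identity = *-identity₁ , λ f → ≃-trans (⊛-comm f 𝟙) (*-identity₁ f)
          ; distrib = (λ f g h → ≃-trans (⊛-comm f (g ++ h)) (≃-trans (distribʳ₁ f g h) (+-cong₁ (⊛-comm g f) (⊛-comm h f))))
                    , distribʳ₁
          }
        ; *-comm = ⊛-comm
        }
      }
      where
      ≃-trans : ∀ {f g h} → f ≃ g → g ≃ h → f ≃ h
      ≃-trans p q = equal λ θ per → trans (pair-≃ p θ per) (pair-≃ q θ per)
      ⊛-comm : ∀ g f → g ⊛ f ≃ f ⊛ g
      ⊛-comm g f = equal λ θ _ → begin
        pair (g ⊛ f) θ                              ≈⟨ pair-⊛ g f θ ⟩
        pair g (λ n → pair f (λ m → θ (n ℕ.+ m)))   ≈⟨ pair-swap g f _ ⟩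
        pair f (λ m → pair g (λ n → θ (n ℕ.+ m)))   ≈⟨ pair-cong f (λ m → pair-cong g (λ n → reflexive (≡.cong θ (ℕ.+-comm n m)))) ⟩
        pair f (λ m → pair g (λ n → θ (m ℕ.+ n)))   ≈⟨ pair-⊛ f g θ ⟨
        pair (f ⊛ g) θ                              ∎
      *-identity₁ : ∀ f → 𝟙 ⊛ f ≃ f
      *-identity₁ f = equal λ θ _ → begin
        pair (𝟙 ⊛ f) θ           ≈⟨ pair-⊛ 𝟙 f θ ⟩
        ι 1ℤ * pair f θ + 0#     ≈⟨ +-identityʳ _ ⟩
        ι 1ℤ * pair f θ          ≈⟨ *-congʳ ι-1 ⟩
        1# * pair f θ            ≈⟨ *-identityˡ _ ⟩
        pair f θ                 ∎
      distribʳ₁ : ∀ f g h → (g ++ h) ⊛ f ≃ g ⊛ f ++ h ⊛ f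
      distribʳ₁ f g h = equal λ θ _ → begin
        pair ((g ++ h) ⊛ f) θ              ≈⟨ pair-⊛ (g ++ h) f θ ⟩
        pair (g ++ h) _                    ≈⟨ pair-++ g h _ ⟩
        pair g _ + pair h _                ≈⟨ +-cong (pair-⊛ g f θ) (pair-⊛ h f θ) ⟨
        pair (g ⊛ f) θ + pair (h ⊛ f) θ    ≈⟨ pair-++ (g ⊛ f) (h ⊛ f) θ ⟨
        pair (g ⊛ f ++ h ⊛ f) θ            ∎
      +-cong₁ : ∀ {f f′ g g′} → f ≃ f′ → g ≃ g′ → f ++ g ≃ f′ ++ g′
      +-cong₁ {f} {f′} {g} {g′} p q = equal λ θ per →
        trans (pair-++ f g θ) (trans (+-cong (pair-≃ p θ per) (pair-≃ q θ per)) (sym (pair-++ f′ g′ θ)))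

  -- Finite sums, coefficients modulo xᵏ - 1, and the endomorphisms σ.

  module Summation {c ℓ} (D : CommutativeRing c ℓ) where

    open CommutativeRing D hiding (zero)
    open CommutativeSemigroupProperties +-commutativeSemigroup using (interchange)

    ∑ : ℕ → (ℕ → Carrier) → Carrier
    ∑ zero    g = 0#
    ∑ (suc n) g = g n + ∑ n g

    ∑-cong : ∀ n {g h} → (∀ r → r < n → g r ≈ h r) → ∑ n g ≈ ∑ n h
    ∑-cong zero    g≈h = refl
    ∑-cong (suc n) g≈h = +-cong (g≈h n (ℕ.n<1+n n)) (∑-cong n λ r r<n → g≈h r (ℕ.<-trans r<n (ℕ.n<1+n n)))

    ∑-+ : ∀ n g h → ∑ n (λ r → g r + h r) ≈ ∑ n g + ∑ n h
    ∑-+ zero    g h = sym (+-identityˡ _)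
    ∑-+ (suc n) g h = trans (+-congˡ (∑-+ n g h)) (interchange _ _ _ _)

    ∑-*ˡ : ∀ n d g → ∑ n (λ r → d * g r) ≈ d * ∑ n g
    ∑-*ˡ zero    d g = sym (zeroʳ d)
    ∑-*ˡ (suc n) d g = trans (+-congˡ (∑-*ˡ n d g)) (sym (distribˡ _ _ _))

    ∑-0 : ∀ n {g} → (∀ r → r < n → g r ≈ 0#) → ∑ n g ≈ 0#
    ∑-0 zero    g≈0 = refl
    ∑-0 (suc n) g≈0 =
      trans (+-cong (g≈0 n (ℕ.n<1+n n)) (∑-0 n λ r r<n → g≈0 r (ℕ.<-trans r<n (ℕ.n<1+n n)))) (+-identityˡ _)

    ∑-single : ∀ n {s g} → s < n → (∀ r → r < n → ¬ r ≡ s → g r ≈ 0#) → ∑ n g ≈ g s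
    ∑-single (suc n) {s} {g} s<1+n g≈0 with n ℕ.≟ s
    ... | yes ≡.refl = trans (+-congˡ (∑-0 n λ r r<n → g≈0 r (ℕ.<-trans r<n (ℕ.n<1+n n)) (ℕ.<⇒≢ r<n))) (+-identityʳ _)
    ... | no  n≢s    = trans (+-cong (g≈0 n (ℕ.n<1+n n) n≢s)
                               (∑-single n (ℕ.≤∧≢⇒< (ℕ.≤-pred s<1+n) (n≢s ∘ ≡.sym)) λ r r<n → g≈0 r (ℕ.<-trans r<n (ℕ.n<1+n n))))
                             (+-identityˡ _)

  idHom : IntegerHom ℤ.+-*-commutativeRing
  idHom = record { ι = id ; ι-0 = ≡.refl ; ι-1 = ≡.refl ; ι-+ = λ _ _ → ≡.refl ; ι-* = λ _ _ → ≡.refl }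

  module PairingSums {c ℓ} {D : CommutativeRing c ℓ} (H : IntegerHom D) where

    open CommutativeRing D hiding (zero)
    open Pairing H
    open Summation D

    pair-∑ : ∀ f n (θ : ℕ → ℕ → Carrier) → pair f (λ m → ∑ n (λ j → θ j m)) ≈ ∑ n (λ j → pair f (θ j))
    pair-∑ f zero    θ = pair-0 f
    pair-∑ f (suc n) θ = trans (pair-+ f _ _) (+-congˡ (pair-∑ f n θ))

  tabulate : (ℕ → ℤ) → ℕ → Poly
  tabulate v zero    = []
  tabulate v (suc n) = (v n , n) ∷ tabulate v n

  module _ (k : ℕ) .{{_ : NonZero k}} where

    δ : ℕ → ℕ → ℤ
    δ r n = if does (n % k ℕ.≟ r) then 1ℤ else 0ℤ

    -- The coefficient of x^r once exponents are reduced modulo k. Being a pairing with a periodic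
    -- function, it depends only on the class of f in the group ring.
    coefficient : Poly → ℕ → ℤ
    coefficient f r = Pairing.pair idHom f (δ r)

    δ-periodic : ∀ r → GroupRing.Periodic k idHom (δ r)
    δ-periodic r n = ≡.cong (λ m → if does (m ℕ.≟ r) then 1ℤ else 0ℤ)
      (≡.trans (≡.cong (_% k) (ℕ.+-comm k n)) (ℕ.[m+n]%n≡m%n n k))

    δ-≡ : ∀ n → δ (n % k) n ≡ 1ℤ
    δ-≡ n = ≡.cong (λ b → if b then 1ℤ else 0ℤ) (dec-true (n % k ℕ.≟ n % k) ≡.refl)

    δ-≢ : ∀ {r n} → ¬ n % k ≡ r → δ r n ≡ 0ℤ
    δ-≢ {r} {n} p = ≡.cong (λ b → if b then 1ℤ else 0ℤ) (dec-false (n % k ℕ.≟ r) p)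

  module Coefficients (k : ℕ) .{{_ : NonZero k}} {c ℓ} {D : CommutativeRing c ℓ} (H : IntegerHom D) where

    open CommutativeRing D hiding (zero)
    open IntegerHom H
    open GroupRing k H
    open Summation D
    open PairingSums H public
    open SetoidReasoning setoid

    periodic-* : ∀ {θ} → Periodic θ → ∀ q n → θ (q ℕ.* k ℕ.+ n) ≈ θ n
    periodic-* per zero    n = refl
    periodic-* {θ} per (suc q) n =
      trans (reflexive (≡.cong θ (ℕ.+-assoc k (q ℕ.* k) n))) (trans (per _) (periodic-* per q n))

    periodic-% : ∀ {θ} → Periodic θ → ∀ n → θ (n % k) ≈ θ n
    periodic-% {θ} per n = trans (sym (periodic-* per (n ℕ./ k) (n % k)))
      (reflexive (≡.cong θ (≡.trans (ℕ.+-comm _ (n % k)) (≡.sym (ℕ.m≡m%n+[m/n]*n n k)))))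

    pair-tabulate : ∀ v n θ → pair (tabulate v n) θ ≈ ∑ n (λ r → ι (v r) * θ r)
    pair-tabulate v zero    θ = refl
    pair-tabulate v (suc n) θ = +-congˡ (pair-tabulate v n θ)

    -- A periodic function is the combination of the indicators `δ k r` with weights θ r. Hence the
    -- integer coefficients determine every pairing over every D, which lets identities of the
    -- integral group ring pass to D in `≃ℤ⇒≃`.
    expansion : ∀ f {θ} → Periodic θ → pair f θ ≈ ∑ k (λ r → ι (coefficient k f r) * θ r)
    expansion [] {θ} per = sym (∑-0 k λ r _ → trans (*-congʳ ι-0) (zeroˡ _))
    expansion ((c , n) ∷ f) {θ} per = sym (begin
      ∑ k (λ r → ι (c ℤ.* δ k r n ℤ.+ coefficient k f r) * θ r)
        ≈⟨ ∑-cong k (λ r _ → trans (*-congʳ (trans (ι-+ _ _) (+-congʳ (ι-* _ _)))) (distribʳ _ _ _)) ⟩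
      ∑ k (λ r → ι c * ι (δ k r n) * θ r + ι (coefficient k f r) * θ r)
        ≈⟨ ∑-+ k _ _ ⟩
      ∑ k (λ r → ι c * ι (δ k r n) * θ r) + ∑ k (λ r → ι (coefficient k f r) * θ r)
        ≈⟨ +-cong (∑-single k (ℕ.m%n<n n k) λ r _ r≢ → off r (r≢ ∘ ≡.sym)) (sym (expansion f per)) ⟩
      ι c * ι (δ k (n % k) n) * θ (n % k) + pair f θ
        ≈⟨ +-congʳ (*-cong (trans (*-congˡ (trans (reflexive (≡.cong ι (δ-≡ k n))) ι-1)) (*-identityʳ _)) (periodic-% per n)) ⟩
      ι c * θ n + pair f θ ∎)
      where
      off : ∀ r → ¬ n % k ≡ r → ι c * ι (δ k r n) * θ r ≈ 0#
      off r p = trans (*-congʳ (trans (*-congˡ (trans (reflexive (≡.cong ι (δ-≢ k p))) ι-0)) (zeroʳ _))) (zeroˡ _)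

    coefficients⇒≃ : ∀ {f g} → (∀ r → r < k → ι (coefficient k f r) ≈ ι (coefficient k g r)) → f ≃ g
    coefficients⇒≃ {f} {g} eq = equal λ θ per →
      trans (expansion f per) (trans (∑-cong k λ r r<k → *-congʳ (eq r r<k)) (sym (expansion g per)))

    ≃ℤ⇒≃ : ∀ {f g} → GroupRing._≃_ k idHom f g → f ≃ g
    ≃ℤ⇒≃ p = coefficients⇒≃ λ r _ → reflexive (≡.cong ι (GroupRing.pair-≃ p (δ k r) (δ-periodic k r)))

    scale-periodic : ∀ a {θ} → Periodic θ → Periodic (λ n → θ (a ℕ.* n))
    scale-periodic a {θ} per n =
      trans (reflexive (≡.cong θ (ℕ.*-distribˡ-+ a k n))) (periodic-* per a (a ℕ.* n))

    σ-cong : ∀ a {f g} → f ≃ g → σ a f ≃ σ a g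
    σ-cong a {f} {g} p = equal λ θ per →
      trans (pair-σ a f θ) (trans (pair-≃ p _ (scale-periodic a per)) (sym (pair-σ a g θ)))

    σ-⊛ : ∀ a f g → σ a (f ⊛ g) ≃ σ a f ⊛ σ a g
    σ-⊛ a f g = equal λ θ _ → begin
      pair (σ a (f ⊛ g)) θ                                      ≈⟨ trans (pair-σ a (f ⊛ g) θ) (pair-⊛ f g _) ⟩
      pair f (λ m → pair g (λ n → θ (a ℕ.* (m ℕ.+ n))))         ≈⟨ pair-cong f (λ m → pair-cong g λ n → reflexive (≡.cong θ (ℕ.*-distribˡ-+ a m n))) ⟩
      pair f (λ m → pair g (λ n → θ (a ℕ.* m ℕ.+ a ℕ.* n)))     ≈⟨ pair-cong f (λ m → pair-σ a g _) ⟨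
      pair f (λ m → pair (σ a g) (λ n → θ (a ℕ.* m ℕ.+ n)))     ≈⟨ pair-σ a f _ ⟨
      pair (σ a f) (λ m → pair (σ a g) (λ n → θ (m ℕ.+ n)))     ≈⟨ pair-⊛ (σ a f) (σ a g) θ ⟨
      pair (σ a f ⊛ σ a g) θ                                    ∎

    σ-∘ : ∀ a b f → σ a (σ b f) ≃ σ (a ℕ.* b) f
    σ-∘ a b f = equal λ θ _ → begin
      pair (σ a (σ b f)) θ                     ≈⟨ trans (pair-σ a (σ b f) θ) (pair-σ b f _) ⟩
      pair f (λ n → θ (a ℕ.* (b ℕ.* n)))       ≈⟨ pair-cong f (λ n → reflexive (≡.cong θ (≡.sym (ℕ.*-assoc a b n)))) ⟩
      pair f (λ n → θ (a ℕ.* b ℕ.* n))         ≈⟨ pair-σ (a ℕ.* b) f θ ⟨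
      pair (σ (a ℕ.* b) f) θ                   ∎

    -- If b a ≡ 1 modulo k, pairing σ a f with n ↦ θ (b n) recovers the pairing of f with θ. The
    -- congruence carries multiples of k on both sides to avoid subtraction in ℕ.
    σ-injective : ∀ {a} → Coprime a k → ∀ {f} → σ a f ≃ [] → f ≃ []
    σ-injective {a} a⊥k {f} p = let b , y , z , eq = inverse in equal λ θ per → begin
      pair f θ                                 ≈⟨ pair-cong f (λ n → undo b y z eq per n) ⟨
      pair f (λ n → θ (b ℕ.* (a ℕ.* n)))       ≈⟨ pair-σ a f _ ⟨
      pair (σ a f) (λ n → θ (b ℕ.* n))         ≈⟨ pair-≃ p _ (scale-periodic b per) ⟩
      0#                                       ∎
      where
      inverse : ∃[ b ] ∃[ y ] ∃[ z ] b ℕ.* a ℕ.+ y ℕ.* k ≡ 1 ℕ.+ z ℕ.* k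
      inverse with Coprimality.coprime-Bézout a⊥k
      ... | Bézout.+- x y eq = x , 0 , y , ≡.trans (ℕ.+-identityʳ _) (≡.sym eq)
      -- From 1 + x a = y k, the inverse of a is − x ≡ x (k − 1).
      ... | Bézout.-+ x y eq = x ℕ.* ℕ.pred k , y , x ℕ.* a , main (ℕ.pred k) (≡.sym (ℕ.suc-pred k))
        where
        main : ∀ k′ → k ≡ suc k′ → x ℕ.* k′ ℕ.* a ℕ.+ y ℕ.* k ≡ 1 ℕ.+ x ℕ.* a ℕ.* k
        main k′ ≡.refl = ≡.trans (≡.cong (x ℕ.* k′ ℕ.* a ℕ.+_) (≡.sym eq)) (solve 3
          (λ x k′ a → x :* k′ :* a :+ (con 1 :+ x :* a) := con 1 :+ x :* a :* (con 1 :+ k′)) ≡.refl x k′ a)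
          where open ℕ-Solver
      undo : ∀ b y z → b ℕ.* a ℕ.+ y ℕ.* k ≡ 1 ℕ.+ z ℕ.* k → ∀ {θ} → Periodic θ →
             ∀ n → θ (b ℕ.* (a ℕ.* n)) ≈ θ n
      undo b y z eq {θ} per n = begin
        θ (b ℕ.* (a ℕ.* n))                            ≈⟨ periodic-* per (y ℕ.* n) _ ⟨
        θ (y ℕ.* n ℕ.* k ℕ.+ b ℕ.* (a ℕ.* n))          ≡⟨ ≡.cong θ (≡.trans (regroup b a y k n) (≡.trans (≡.cong (ℕ._* n) eq) (regroup′ z k n))) ⟩
        θ (z ℕ.* n ℕ.* k ℕ.+ n)                        ≈⟨ periodic-* per (z ℕ.* n) n ⟩
        θ n                                            ∎
        where
        open ℕ-Solver
        regroup : ∀ b a y k n → y ℕ.* n ℕ.* k ℕ.+ b ℕ.* (a ℕ.* n) ≡ (b ℕ.* a ℕ.+ y ℕ.* k) ℕ.* n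
        regroup = solve 5 (λ b a y k n → y :* n :* k :+ b :* (a :* n) := (b :* a :+ y :* k) :* n) ≡.refl
        regroup′ : ∀ z k n → (1 ℕ.+ z ℕ.* k) ℕ.* n ≡ z ℕ.* n ℕ.* k ℕ.+ n
        regroup′ = solve 3 (λ z k n → (con 1 :+ z :* k) :* n := z :* n :* k :+ n) ≡.refl

  -- Reduction modulo p: Fermat's little theorem and Frobenius on the group ring.

  record Congruent (m : ℕ) (a b : ℤ) : Set where
    constructor congruent
    field divisible : + m ℤ.∣ a ℤ.- b

  -- The carrier stays ℤ and only equality is weakened, so `moduloHom` is the identity on integers
  -- and pairings modulo m agree with the integral ones.
  integersModulo : ℕ → CommutativeRing 0ℓ 0ℓ
  integersModulo m = record
    { Carrier = ℤ ; _≈_ = Congruent m ; _+_ = ℤ._+_ ; _*_ = ℤ._*_ ; -_ = ℤ.-_ ; 0# = 0ℤ ; 1# = 1ℤ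
    ; isCommutativeRing = record
      { isRing = record
        { +-isAbelianGroup = record
          { isGroup = record
            { isMonoid = record
              { isSemigroup = record
                { isMagma = record
                  { isEquivalence = record
                    { refl  = ≡⇒≈ ≡.refl
                    ; sym   = λ {a} {b} (congruent p) → congruent
                        (≡.subst (+ m ℤ.∣_) (solve 2 (λ a b → :- (a :- b) := b :- a) ≡.refl a b) (ℤ.∣m⇒∣-m p))
                    ; trans = λ {a} {b} {c} (congruent p) (congruent q) → congruent
                        (≡.subst (+ m ℤ.∣_) (solve 3 (λ a b c → (a :- b) :+ (b :- c) := a :- c) ≡.refl a b c) (ℤ.∣m∣n⇒∣m+n p q))
                    }
                  ; ∙-cong = λ {a} {b} {c} {d} (congruent p) (congruent q) → congruent
                      (≡.subst (+ m ℤ.∣_) (solve 4 (λ a b c d → (a :- b) :+ (c :- d) := (a :+ c) :- (b :+ d)) ≡.refl a b c d)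
                        (ℤ.∣m∣n⇒∣m+n p q))
                  }
                ; assoc = λ a b c → ≡⇒≈ (ℤ.+-assoc a b c)
                }
              ; identity = (λ a → ≡⇒≈ (ℤ.+-identityˡ a)) , (λ a → ≡⇒≈ (ℤ.+-identityʳ a))
              }
            ; inverse = (λ a → ≡⇒≈ (ℤ.+-inverseˡ a)) , (λ a → ≡⇒≈ (ℤ.+-inverseʳ a))
            ; ⁻¹-cong = λ {a} {b} (congruent p) → congruent
                (≡.subst (+ m ℤ.∣_) (solve 2 (λ a b → :- (a :- b) := :- a :- :- b) ≡.refl a b) (ℤ.∣m⇒∣-m p))
            }
          ; comm = λ a b → ≡⇒≈ (ℤ.+-comm a b)
          }
        ; *-cong = λ {a} {b} {c} {d} (congruent p) (congruent q) → congruent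
            (≡.subst (+ m ℤ.∣_) (solve 4 (λ a b c d → a :* (c :- d) :+ d :* (a :- b) := a :* c :- b :* d) ≡.refl a b c d)
              (ℤ.∣m∣n⇒∣m+n (ℤ.∣n⇒∣m*n a q) (ℤ.∣n⇒∣m*n d p)))
        ; *-assoc = λ a b c → ≡⇒≈ (ℤ.*-assoc a b c)
        ; *-identity = (λ a → ≡⇒≈ (ℤ.*-identityˡ a)) , (λ a → ≡⇒≈ (ℤ.*-identityʳ a))
        ; distrib = (λ a b c → ≡⇒≈ (ℤ.*-distribˡ-+ a b c)) , (λ a b c → ≡⇒≈ (ℤ.*-distribʳ-+ a b c))
        }
      ; *-comm = λ a b → ≡⇒≈ (ℤ.*-comm a b)
      }
    }
    where
    open +-*-Solver
    ≡⇒≈ : ∀ {a b} → a ≡ b → Congruent m a b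
    ≡⇒≈ {a} ≡.refl = congruent (divides 0ℤ (ℤ.+-inverseʳ a))

  moduloHom : ∀ m → IntegerHom (integersModulo m)
  moduloHom m = record { ι = id ; ι-0 = refl ; ι-1 = refl ; ι-+ = λ _ _ → refl ; ι-* = λ _ _ → refl }
    where open CommutativeRing (integersModulo m)

  pair-modulo : ∀ m f θ → Pairing.pair (moduloHom m) f θ ≡ Pairing.pair idHom f θ
  pair-modulo m []            θ = ≡.refl
  pair-modulo m ((c , n) ∷ f) θ = ≡.cong (ℤ._+_ (c ℤ.* θ n)) (pair-modulo m f θ)

  module ModPrime {p} (pr : Prime p) where

    open CommutativeRing (integersModulo p) hiding (zero)
    open Exp commutativeSemiring using (_^_)
    open Mult semiring using () renaming (_×_ to _·_)
    open RingProperties ring using (+-inverseˡ-unique)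
    open SetoidReasoning setoid

    private
      n·1 : ∀ n → n · 1ℤ ≡ + n
      n·1 zero    = ≡.refl
      n·1 (suc n) = ≡.cong (ℤ._+_ 1ℤ) (n·1 n)

    p·1≈0 : p · 1ℤ ≈ 0ℤ
    p·1≈0 = trans (reflexive (n·1 p)) (congruent (divides 1ℤ (≡.trans (ℤ.+-identityʳ (+ p)) (≡.sym (ℤ.*-identityˡ (+ p))))))

    open Frobenius (integersModulo p) pr p·1≈0 public using (frobenius-+; frobenius-0; p×x≈0)

    1^ : ∀ n → 1ℤ ^ n ≈ 1ℤ
    1^ zero    = refl
    1^ (suc n) = trans (*-identityˡ _) (1^ n)

    fermat⁺ : ∀ n → (+ n) ^ p ≈ + n
    fermat⁺ zero    = frobenius-0
    fermat⁺ (suc n) = trans (frobenius-+ 1ℤ (+ n)) (+-cong (1^ p) (fermat⁺ n))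

    -- For negative c, additivity of the p-th power applied to c + (- c) = 0 avoids distinguishing p
    -- = 2 from odd p.
    fermat : ∀ c → c ^ p ≈ c
    fermat (+ n)    = fermat⁺ n
    fermat -[1+ n ] = begin
      x ^ p             ≈⟨ +-inverseˡ-unique _ _ (trans (sym (frobenius-+ x (+ suc n))) frobenius-0′) ⟩
      - (+ suc n) ^ p   ≈⟨ -‿cong (fermat⁺ (suc n)) ⟩
      x                 ∎
      where
      x = -[1+ n ]
      frobenius-0′ : (x + + suc n) ^ p ≈ 0ℤ
      frobenius-0′ = trans (reflexive (≡.cong (_^ p) (ℤ.+-inverseˡ (+ suc n)))) frobenius-0

  module GroupRingModPrime (k : ℕ) .{{_ : NonZero k}} {p} (pr : Prime p) where

    open GroupRing k (moduloHom p) using (pair; equal; groupRing)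
    open Coefficients k (moduloHom p)
    open CommutativeRing groupRing hiding (zero)
    open Exp commutativeSemiring using (_^_)
    open Mult semiring using () renaming (_×_ to _·_)
    open SetoidReasoning setoid
    private
      module Z  = CommutativeRing (integersModulo p)
      module ZM = Mult Z.semiring
      module ZE = Exp Z.commutativeSemiring
      module P  = Pairing (moduloHom p)
      module MP = ModPrime pr

      pair-· : ∀ n f θ → pair (n · f) θ Z.≈ n ZM.× pair f θ
      pair-· zero    f θ = Z.refl
      pair-· (suc n) f θ = Z.trans (P.pair-++ f (n · f) θ) (Z.+-congˡ {x = pair f θ} (pair-· n f θ))

      p·1≈0 : p · 1# ≈ 0#
      p·1≈0 = equal λ θ _ → Z.trans (pair-· p 1# θ) (MP.p×x≈0 _)

      open Frobenius groupRing pr p·1≈0 using (frobenius-+; frobenius-0)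

      monomial-cong : ∀ {c d} n → c Z.≈ d → monomial c n ≈ monomial d n
      monomial-cong {c} {d} n c≈d = equal λ θ _ → Z.+-congʳ {x = 0ℤ} (Z.*-congʳ {x = θ n} c≈d)

      monomial-^ : ∀ c n j → monomial c n ^ j ≈ monomial (c ZE.^ j) (j ℕ.* n)
      monomial-^ c n zero    = refl
      monomial-^ c n (suc j) = *-congˡ {x = monomial c n} (monomial-^ c n j)

    -- Additivity reduces this to monomials, where the exponent is multiplied by p and the
    -- coefficient is unchanged by Fermat.
    frobenius : ∀ f → f ^ p ≈ σ p f
    frobenius []            = frobenius-0
    frobenius ((c , n) ∷ f) = begin
      (monomial c n + f) ^ p                           ≈⟨ frobenius-+ (monomial c n) f ⟩
      monomial c n ^ p + f ^ p                         ≈⟨ +-cong (monomial-^ c n p) (frobenius f) ⟩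
      monomial (c ZE.^ p) (p ℕ.* n) + σ p f            ≈⟨ +-congʳ (monomial-cong (p ℕ.* n) (MP.fermat c)) ⟩
      monomial c (p ℕ.* n) + σ p f                     ∎

    -- (f^p)² is a multiple of f · f^p, hence so is (f^p)^p, which is σ_p (σ_p f).
    f*σf≈0⇒f≈0 : Coprime p k → ∀ f → f * σ p f ≈ 0# → f ≈ 0#
    f*σf≈0⇒f≈0 p⊥k f fσf≈0 = σ-injective p⊥k (σ-injective p⊥k (begin
      σ p (σ p f)          ≈⟨ frobenius (σ p f) ⟨
      σ p f ^ p            ≈⟨ power (ℕ.nonTrivial⇒n>1 p {{prime⇒nonTrivial pr}}) ⟩
      0#                   ∎))
      where
      square : ∀ {n} → 1 ≤ n → f ^ n ≈ σ p f → σ p f * σ p f ≈ 0#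
      square {suc n} _ eq = begin
        σ p f * σ p f            ≈⟨ *-congʳ eq ⟨
        f * f ^ n * σ p f        ≈⟨ trans (*-congʳ (*-comm f (f ^ n))) (*-assoc (f ^ n) f (σ p f)) ⟩
        f ^ n * (f * σ p f)      ≈⟨ *-congˡ {x = f ^ n} fσf≈0 ⟩
        f ^ n * 0#               ≈⟨ zeroʳ (f ^ n) ⟩
        0#                       ∎
      power : 2 ≤ p → σ p f ^ p ≈ 0#
      power (s≤s (s≤s {n = n} z≤n)) = begin
        σ p f * (σ p f * σ p f ^ n)   ≈⟨ *-assoc (σ p f) (σ p f) (σ p f ^ n) ⟨
        σ p f * σ p f * σ p f ^ n     ≈⟨ *-congʳ (square {p} (s≤s z≤n) (frobenius f)) ⟩
        0# * σ p f ^ n                ≈⟨ zeroˡ (σ p f ^ n) ⟩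
        0#                            ∎

  -- Infinite divisibility and linear dependence over ℤ.

  n<2^n : ∀ n → n < 2 ℕ.^ n
  n<2^n zero    = s≤s z≤n
  n<2^n (suc n) = ℕ.≤-trans (s≤s (n<2^n n)) (ℕ.≤-trans (ℕ.+-monoˡ-≤ (2 ℕ.^ n) (ℕ.m^n>0 2 n))
    (ℕ.≤-reflexive (≡.cong (2 ℕ.^ n ℕ.+_) (≡.sym (ℕ.+-identityʳ (2 ℕ.^ n))))))

  -- The single exponent ∣ i ∣ suffices: p to the power ∣ i ∣ is at least 2 to that power, hence
  -- exceeds ∣ i ∣ and cannot divide a nonzero i.
  ∣powers⇒≡0 : ∀ {p} → 2 ≤ p → ∀ i → (∀ n → + (p ℕ.^ n) ℤ.∣ i) → i ≡ 0ℤ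
  ∣powers⇒≡0 {p} 2≤p i p∣i with i ℤ.≟ 0ℤ
  ... | yes i≡0 = i≡0
  ... | no  i≢0 = contradiction (ℕ.∣⇒≤ {{ℤ.≢-nonZero i≢0}} (ℤ.∣⇒∣ᵤ (p∣i ℤ.∣ i ∣)))
        (ℕ.<⇒≱ (ℕ.<-≤-trans (n<2^n ℤ.∣ i ∣) (ℕ.^-monoˡ-≤ ℤ.∣ i ∣ 2≤p)))

  -- Vectors of any length are represented by functions on ℕ.
  combination : ∀ {m} → Vec ℤ m → Vec (ℕ → ℤ) m → ℕ → ℤ
  combination []       []       r = 0ℤ
  combination (c ∷ cs) (v ∷ vs) r = c ℤ.* v r ℤ.+ combination cs vs r

  module _ where

    open ≡.≡-Reasoning
    open +-*-Solver

    combination-insertAt : ∀ {m} (cs : Vec ℤ m) (vs : Vec (ℕ → ℤ) (suc m)) i c r →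
      combination (insertAt cs i c) vs r ≡ c ℤ.* lookup vs i r ℤ.+ combination cs (removeAt vs i) r
    combination-insertAt cs       (v ∷ vs)         zero    c r = ≡.refl
    combination-insertAt (d ∷ cs) (v ∷ vs@(_ ∷ _)) (suc i) c r = begin
      d ℤ.* v r ℤ.+ combination (insertAt cs i c) vs r
        ≡⟨ ≡.cong (ℤ._+_ (d ℤ.* v r)) (combination-insertAt cs vs i c r) ⟩
      d ℤ.* v r ℤ.+ (c ℤ.* lookup vs i r ℤ.+ combination cs (removeAt vs i) r)
        ≡⟨ solve 3 (λ a b c → a :+ (b :+ c) := b :+ (a :+ c)) ≡.refl (d ℤ.* v r) (c ℤ.* lookup vs i r) (combination cs (removeAt vs i) r) ⟩
      c ℤ.* lookup vs i r ℤ.+ (d ℤ.* v r ℤ.+ combination cs (removeAt vs i) r) ∎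

    combination-map : ∀ {m} a (cs : Vec ℤ m) vs r →
      combination (Vec.map (ℤ._*_ a) cs) vs r ≡ a ℤ.* combination cs vs r
    combination-map a []       []       r = ≡.sym (ℤ.*-zeroʳ a)
    combination-map a (c ∷ cs) (v ∷ vs) r = begin
      a ℤ.* c ℤ.* v r ℤ.+ combination (Vec.map (ℤ._*_ a) cs) vs r  ≡⟨ ≡.cong (ℤ._+_ (a ℤ.* c ℤ.* v r)) (combination-map a cs vs r) ⟩
      a ℤ.* c ℤ.* v r ℤ.+ a ℤ.* combination cs vs r                 ≡⟨ solve 4 (λ a c v s → a :* c :* v :+ a :* s := a :* (c :* v :+ s)) ≡.refl a c (v r) (combination cs vs r) ⟩
      a ℤ.* (c ℤ.* v r ℤ.+ combination cs vs r)                     ∎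

    -- The n-th coordinate of the result is 0.
    eliminate : (ℕ → ℤ) → ℕ → (ℕ → ℤ) → ℕ → ℤ
    eliminate v n u r = v n ℤ.* u r ℤ.- u n ℤ.* v r

    -- Read from right to left: a relation cs among the eliminated vectors is a relation among the
    -- original ones, with weights v n · cs, and with the value at n of the combination, negated, as
    -- the weight of the pivot v.
    combination-eliminate : ∀ {m} v n (cs : Vec ℤ m) vs r →
      combination cs (Vec.map (eliminate v n) vs) r ≡ v n ℤ.* combination cs vs r ℤ.- combination cs vs n ℤ.* v r
    combination-eliminate v n []       []       r =
      solve 2 (λ a b → con 0ℤ := a :* con 0ℤ :- con 0ℤ :* b) ≡.refl (v n) (v r)
    combination-eliminate v n (c ∷ cs) (u ∷ us) r = begin
      c ℤ.* eliminate v n u r ℤ.+ combination cs (Vec.map (eliminate v n) us) r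
        ≡⟨ ≡.cong (ℤ._+_ (c ℤ.* eliminate v n u r)) (combination-eliminate v n cs us r) ⟩
      c ℤ.* eliminate v n u r ℤ.+ (v n ℤ.* combination cs us r ℤ.- combination cs us n ℤ.* v r)
        ≡⟨ solve 7 (λ a b c d e f g → c :* (a :* d :- e :* b) :+ (a :* f :- g :* b)
                                    := a :* (c :* d :+ f) :- (c :* e :+ g) :* b) ≡.refl
             (v n) (v r) c (u r) (u n) (combination cs us r) (combination cs us n) ⟩
      v n ℤ.* (c ℤ.* u r ℤ.+ combination cs us r) ℤ.- (c ℤ.* u n ℤ.+ combination cs us n) ℤ.* v r ∎

    -- Fraction-free Gaussian elimination on coordinate n. If all entries there vanish, one vector
    -- is discarded; otherwise a pivot clears that entry in the others. Either way n + 1 vectors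
    -- with n coordinates remain.
    dependence : ∀ n (vs : Vec (ℕ → ℤ) (suc n)) →
      ∃[ cs ] (∃[ i ] ¬ lookup cs i ≡ 0ℤ) × (∀ r → r < n → combination cs vs r ≡ 0ℤ)
    dependence zero    vs = 1ℤ ∷ [] , (zero , λ ()) , λ _ ()
    dependence (suc n) vs with Fin.any? (λ i → ¬? (lookup vs i n ℤ.≟ 0ℤ))
    dependence (suc n) (v ∷ vs) | no ∄i =
      let cs , (i , cᵢ≢0) , cs≡0 = dependence n vs
      in 0ℤ ∷ cs , (suc i , cᵢ≢0) , λ r r<1+n →
         ≡.trans (ℤ.+-identityˡ _) (case r cs vs (λ i → all0 (suc i)) (cs≡0 r) r<1+n)
      where
      all0 : ∀ i → lookup (v ∷ vs) i n ≡ 0ℤ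
      all0 i = decidable-stable (_ ℤ.≟ 0ℤ) λ p → ∄i (i , p)
      at-n : ∀ {m} (cs : Vec ℤ m) us → (∀ i → lookup us i n ≡ 0ℤ) → combination cs us n ≡ 0ℤ
      at-n []       []       p = ≡.refl
      at-n (c ∷ cs) (u ∷ us) p = ≡.cong₂ ℤ._+_ (≡.trans (≡.cong (ℤ._*_ c) (p zero)) (ℤ.*-zeroʳ c)) (at-n cs us (p ∘ suc))
      case : ∀ {m} r (cs : Vec ℤ m) us → (∀ i → lookup us i n ≡ 0ℤ) →
             (r < n → combination cs us r ≡ 0ℤ) → r < suc n → combination cs us r ≡ 0ℤ
      case r cs us p q r<1+n with r ℕ.≟ n
      ... | yes ≡.refl = at-n cs us p
      ... | no  r≢n    = q (ℕ.≤∧≢⇒< (ℕ.≤-pred r<1+n) r≢n)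
    ... | yes (i , a≢0) =
      let cs , (j , cⱼ≢0) , cs≡0 = dependence n (Vec.map (eliminate v n) us)
          s = combination cs us
      in insertAt (Vec.map (ℤ._*_ a) cs) i (ℤ.- s n)
       -- Scaling by the pivot entry a ≠ 0 keeps the nonzero weight nonzero.
       , (Fin.punchIn i j , λ eq → cⱼ≢0 (cancel (≡.trans (≡.sym (≡.trans (Vec.insertAt-punchIn (Vec.map (ℤ._*_ a) cs) i _ j)
                                                           (Vec.lookup-map j (ℤ._*_ a) cs))) eq)))
       , λ r r<1+n → begin
           combination (insertAt (Vec.map (ℤ._*_ a) cs) i (ℤ.- s n)) vs r
             ≡⟨ combination-insertAt (Vec.map (ℤ._*_ a) cs) vs i (ℤ.- s n) r ⟩
           ℤ.- s n ℤ.* v r ℤ.+ combination (Vec.map (ℤ._*_ a) cs) us r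
             ≡⟨ ≡.cong (ℤ._+_ (ℤ.- s n ℤ.* v r)) (combination-map a cs us r) ⟩
           ℤ.- s n ℤ.* v r ℤ.+ a ℤ.* s r
             ≡⟨ solve 4 (λ x y a z → :- x :* y :+ a :* z := a :* z :- x :* y) ≡.refl (s n) (v r) a (s r) ⟩
           a ℤ.* s r ℤ.- s n ℤ.* v r
             ≡⟨ case r cs (λ r<n → ≡.trans (≡.sym (combination-eliminate v n cs us r)) (cs≡0 r r<n)) r<1+n ⟩
           0ℤ ∎
      where
      v  = lookup vs i
      us = removeAt vs i
      a  = v n
      cancel : ∀ {c} → a ℤ.* c ≡ 0ℤ → c ≡ 0ℤ
      cancel eq with ℤ.i*j≡0⇒i≡0∨j≡0 a eq
      ... | inj₁ a≡0 = contradiction a≡0 a≢0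
      ... | inj₂ c≡0 = c≡0
      case : ∀ r cs → let s = combination cs us in
             (r < n → a ℤ.* s r ℤ.- s n ℤ.* v r ≡ 0ℤ) → r < suc n → a ℤ.* s r ℤ.- s n ℤ.* v r ≡ 0ℤ
      case r cs p r<1+n with r ℕ.≟ n
      ... | yes ≡.refl = solve 2 (λ a b → a :* b :- b :* a := con 0ℤ) ≡.refl a (combination cs us n)
      ... | no  r≢n    = p (ℕ.≤∧≢⇒< (ℕ.≤-pred r<1+n) r≢n)

  -- Annihilation in ℤ[x]/(xᵏ - 1) and its stability under σ.

  module IntegralGroupRing (k : ℕ) .{{_ : NonZero k}} where

    open GroupRing k idHom
    open Coefficients k idHom
    open CommutativeRing groupRing hiding (zero)
    open Exp commutativeSemiring using (_^_)
    open SetoidReasoning setoid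
    open Summation ℤ.+-*-commutativeRing using (∑-single)

    pair-constant* : ∀ c f θ → pair (monomial c 0 * f) θ ≡ c ℤ.* pair f θ
    pair-constant* c f θ = ≡.trans (pair-⊛ (monomial c 0) f θ) (ℤ.+-identityʳ _)

    coefficient-tabulate : ∀ v r → r < k → coefficient k (tabulate v k) r ≡ v r
    coefficient-tabulate v r r<k = ≡.trans (pair-tabulate v k (δ k r)) (≡.trans
      (∑-single k r<k λ s s<k s≢r → ≡.trans (≡.cong (ℤ._*_ (v s)) (δ-≢ k (s≢r ∘ ≡.trans (≡.sym (ℕ.m<n⇒m%n≡m s<k))))) (ℤ.*-zeroʳ (v s)))
      (≡.trans (≡.cong (ℤ._*_ (v r)) (≡.subst (λ s → δ k s r ≡ 1ℤ) (ℕ.m<n⇒m%n≡m r<k) (δ-≡ k r))) (ℤ.*-identityʳ (v r))))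

    -- Testing against the indicators shows that p divides every coefficient. The quotient is
    -- rebuilt in normal form, because the coefficients listed in f need not be divisible themselves
    -- before exponents are merged modulo k.
    divide : ∀ {p} f → GroupRing._≃_ k (moduloHom p) f [] → ∃[ g ] f ≈ monomial (+ p) 0 * g
    divide {p} f f≈0 = tabulate q k , coefficients⇒≃ {g = monomial (+ p) 0 * tabulate q k} λ r r<k → ≡.trans (q-spec r)
      (≡.sym (≡.trans (pair-constant* (+ p) (tabulate q k) (δ k r)) (≡.cong (ℤ._*_ (+ p)) (coefficient-tabulate q r r<k))))
      where
      module Zp = CommutativeRing (integersModulo p)
      p∣ : ∀ r → + p ℤ.∣ coefficient k f r
      p∣ r = ≡.subst (+ p ℤ.∣_) (≡.trans (ℤ.+-identityʳ _) (pair-modulo p f (δ k r))) (Congruent.divisible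
        (GroupRing.pair-≃ f≈0 (δ k r) λ n → Zp.reflexive (δ-periodic k r n)))
      q : ℕ → ℤ
      q r = ℤ._∣_.quotient (p∣ r)
      q-spec : ∀ r → coefficient k f r ≡ + p ℤ.* q r
      q-spec r = ≡.trans (ℤ._∣_.equality (p∣ r)) (ℤ.*-comm (q r) (+ p))

    -- A factor fixed by σ comes out of f σ(f) twice. With e = p this lets `descent` cancel p².
    σ-square : ∀ {a f} e g → σ a e ≈ e → f ≈ e * g → f * σ a f ≈ e * (e * (g * σ a g))
    σ-square {a} {f} e g σe≈e f≈eg = begin
      f * σ a f                ≈⟨ *-cong f≈eg (σ-cong a f≈eg) ⟩
      e * g * σ a (e * g)      ≈⟨ *-congˡ {e * g} (σ-⊛ a e g) ⟩
      e * g * (σ a e * σ a g)  ≈⟨ *-congˡ {e * g} (*-congʳ {σ a g} σe≈e) ⟩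
      e * g * (e * σ a g)      ≈⟨ *-assoc e g (e * σ a g) ⟩
      e * (g * (e * σ a g))    ≈⟨ *-congˡ {e} (x∙yz≈y∙xz g e (σ a g)) ⟩
      e * (e * (g * σ a g))    ∎
      where open CommutativeSemigroupProperties *-commutativeSemigroup using (x∙yz≈y∙xz)

    module _ {p} (pr : Prime p) (p⊥k : Coprime p k) where

      private
        instance
          _ = prime⇒nonZero pr

        constant-cancel : ∀ {g} → monomial (+ p) 0 * g ≈ 0# → g ≈ 0#
        constant-cancel {g} eq = equal λ θ per → ℤ.*-cancelˡ-≡ (+ p) _ _
          (≡.trans (≡.sym (pair-constant* (+ p) g θ)) (≡.trans (pair-≃ eq θ per) (≡.sym (ℤ.*-zeroʳ (+ p)))))

        σ-constant : σ p (monomial (+ p) 0) ≈ monomial (+ p) 0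
        σ-constant = reflexive (≡.cong (monomial (+ p)) (ℕ.*-zeroʳ p))

      -- By Frobenius p divides f, and the hypothesis passes to f / p.
      descent : ∀ n f → f * σ p f ≈ 0# → ∀ θ → Periodic θ → + (p ℕ.^ n) ℤ.∣ pair f θ
      descent zero    f fσf≈0 θ per = divides (pair f θ) (≡.sym (ℤ.*-identityʳ _))
      descent (suc n) f fσf≈0 θ per = ≡.subst₂ ℤ._∣_
        (≡.sym (ℤ.pos-* p (p ℕ.^ n)))
        (≡.sym (≡.trans (pair-≃ f≈pg θ per) (pair-constant* (+ p) g θ)))
        (ℤ.*-monoʳ-∣ (+ p) (descent n g gσg≈0 θ per))
        where
        f≈0 : GroupRing._≃_ k (moduloHom p) f []
        f≈0 = GroupRingModPrime.f*σf≈0⇒f≈0 k pr p⊥k f (Coefficients.≃ℤ⇒≃ k (moduloHom p) fσf≈0)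
        g = proj₁ (divide f f≈0)
        f≈pg : f ≈ monomial (+ p) 0 * g
        f≈pg = proj₂ (divide f f≈0)
        gσg≈0 : g * σ p g ≈ 0#
        gσg≈0 = constant-cancel (constant-cancel
          (trans (sym (σ-square {p} (monomial (+ p) 0) g σ-constant f≈pg)) fσf≈0))

      f*σf≈0⇒f≈0 : ∀ f → f * σ p f ≈ 0# → f ≈ 0#
      f*σf≈0⇒f≈0 f fσf≈0 = equal λ θ per →
        ∣powers⇒≡0 (ℕ.nonTrivial⇒n>1 p {{prime⇒nonTrivial pr}}) (pair f θ) λ n → descent n f fσf≈0 θ per

      -- For h = σ_p(f) g the product h σ_p(h) contains σ_p(f) σ_p(g) = σ_p(f g), which vanishes.
      σ-annihilates-prime : ∀ f g → f * g ≈ 0# → σ p f * g ≈ 0#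
      σ-annihilates-prime f g fg≈0 = f*σf≈0⇒f≈0 (σ p f * g) (begin
        σ p f * g * σ p (σ p f * g)              ≈⟨ *-congˡ {σ p f * g} (σ-⊛ p (σ p f) g) ⟩
        σ p f * g * (σ p (σ p f) * σ p g)        ≈⟨ swap (σ p f) g (σ p (σ p f)) (σ p g) ⟩
        σ p f * σ p g * (g * σ p (σ p f))        ≈⟨ *-congʳ {g * σ p (σ p f)} (σ-⊛ p f g) ⟨
        σ p (f * g) * (g * σ p (σ p f))          ≈⟨ *-congʳ {g * σ p (σ p f)} (σ-cong p fg≈0) ⟩
        0# * (g * σ p (σ p f))                   ∎)
        where
        open CommutativeSemigroupProperties *-commutativeSemigroup using (interchange)
        swap : ∀ a b c d → a * b * (c * d) ≈ a * d * (b * c)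
        swap a b c d = trans (*-congˡ {a * b} (*-comm c d)) (interchange a b d c)

    coprime-factors : ∀ {a b} → Coprime (a ℕ.* b) k → Coprime a k × Coprime b k
    coprime-factors {a} {b} c = (λ (d∣a , d∣k) → c (ℕ.∣-trans d∣a (ℕ.m∣m*n b) , d∣k))
                              , (λ (d∣b , d∣k) → c (ℕ.∣-trans d∣b (ℕ.n∣m*n a) , d∣k))

    -- Every prime factor of a is coprime to k, and σ of a product is a composite, so the prime case
    -- is iterated along a factorisation; this is why a must be nonzero.
    σ-annihilates : ∀ a .{{_ : NonZero a}} → Coprime a k → ∀ f g → f * g ≈ 0# → σ a f * g ≈ 0#
    σ-annihilates a a⊥k f g fg≈0 with factorise a
    ... | record { factors = ps ; isFactorisation = ≡.refl ; factorsPrime = prs } = go ps prs a⊥k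
      where
      go : ∀ ps → All Prime ps → Coprime (product ps) k → σ (product ps) f * g ≈ 0#
      go []       []         _ = trans (*-congʳ {g} {σ 1 f} {f} (equal λ θ _ → ≡.trans (pair-σ 1 f θ)
                                   (pair-cong f λ n → ≡.cong θ (ℕ.+-identityʳ n)))) fg≈0
      go (p ∷ ps) (pr ∷ prs) c = let p⊥k , ps⊥k = coprime-factors {p} c in
        trans (*-congʳ {g} (sym (σ-∘ p (product ps) f)))
          (σ-annihilates-prime pr p⊥k (σ (product ps) f) g (go ps prs ps⊥k))

    powers : ∀ m → Poly → Poly → Vec Poly m
    powers zero    f g = []
    powers (suc m) f g = g ∷ powers m f (f * g)

    horner : ∀ {m} → Poly → Vec ℤ m → Poly
    horner f []       = 0#
    horner f (c ∷ cs) = monomial c 0 + f * horner f cs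

    -- The factor g accumulates powers of f along the recursion. At g = 1 this identifies a linear
    -- relation between the coefficient vectors of 1, f, f², ... with a polynomial relation for f.
    horner-coefficient : ∀ {m} f (cs : Vec ℤ m) g r → r < k →
      coefficient k (g * horner f cs) r ≡ combination cs (Vec.map (coefficient k) (powers m f g)) r
    horner-coefficient f []       g r r<k = pair-≃ (zeroʳ g) (δ k r) (δ-periodic k r)
    horner-coefficient f (c ∷ cs) g r r<k = ≡.trans
      (pair-≃ eq (δ k r) (δ-periodic k r))
      (≡.trans (pair-++ (monomial c 0 * g) (f * g * horner f cs) (δ k r))
        (≡.cong₂ ℤ._+_ (pair-constant* c g (δ k r)) (horner-coefficient f cs (f * g) r r<k)))
      where
      open CommutativeSemigroupProperties *-commutativeSemigroup using (x∙yz≈yx∙z)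
      eq : g * (monomial c 0 + f * horner f cs) ≈ monomial c 0 * g + f * g * horner f cs
      eq = trans (distribˡ g (monomial c 0) (f * horner f cs))
             (+-cong (*-comm g (monomial c 0)) (x∙yz≈yx∙z g f (horner f cs)))

    -- Drops the vanishing lowest coefficients of a relation between the powers of f.
    lowest-term : ∀ {m} f (cs : Vec ℤ m) → (∃[ i ] ¬ lookup cs i ≡ 0ℤ) →
      ∃[ n ] ∃[ c ] ∃[ u ] (¬ c ≡ 0ℤ × horner f cs ≈ f ^ n * (monomial c 0 + f * u))
    lowest-term f (c ∷ cs) (i , cᵢ≢0) with c ℤ.≟ 0ℤ
    ... | no  c≢0 = 0 , c , horner f cs , c≢0 , sym (*-identityˡ _)
    lowest-term f (c ∷ cs) (zero  , c≢0)  | yes c≡0 = contradiction c≡0 c≢0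
    lowest-term f (c ∷ cs) (suc i , cᵢ≢0) | yes ≡.refl =
      let n , d , u , d≢0 , eq = lowest-term f cs (i , cᵢ≢0) in
      suc n , d , u , d≢0 , (begin
        monomial 0ℤ 0 + f * horner f cs              ≈⟨ +-congʳ {f * horner f cs} (equal λ _ _ → ≡.refl) ⟩
        0# + f * horner f cs                         ≈⟨ *-congˡ {f} eq ⟩
        f * (f ^ n * (monomial d 0 + f * u))         ≈⟨ *-assoc f (f ^ n) _ ⟨
        f * f ^ n * (monomial d 0 + f * u)           ∎)

    -- The k + 1 elements 1, f, …, fᵏ of a module of rank k are dependent.
    annihilator : ∀ f → ∃[ n ] ∃[ c ] ∃[ u ] (¬ c ≡ 0ℤ × f ^ n * (monomial c 0 + f * u) ≈ 0#)
    annihilator f =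
      let cs , cs≢0 , rel = dependence k (Vec.map (coefficient k) (powers (suc k) f 1#))
          n , c , u , c≢0 , eq = lowest-term f cs cs≢0
      in n , c , u , c≢0 , trans (sym eq) (coefficients⇒≃ λ r r<k →
           ≡.trans (≡.sym (pair-≃ (*-identityˡ (horner f cs)) (δ k r) (δ-periodic k r)))
             (≡.trans (horner-coefficient f cs 1# r r<k) (rel r r<k)))

  -- Evaluation at primitive roots of unity in a domain.

  xⁿ-1 : ℕ → Poly
  xⁿ-1 n = monomial 1ℤ n ++ ⊖ 𝟙

  -- Shaped for Cauchy reals: zero divisors are excluded by cancelling a factor refuted to be 0, not
  -- by deciding which factor vanishes, and stability stands in for decidability of x ≈ 0.
  record IsStableDomain {c ℓ} (D : CommutativeRing c ℓ) : Set (c ⊔ˡ ℓ) where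
    open CommutativeRing D hiding (zero)
    field
      1≉0    : ¬ 1# ≈ 0#
      cancel : ∀ {x y} → x * y ≈ 0# → ¬ x ≈ 0# → y ≈ 0#
      stable : ∀ {x} → ¬ ¬ x ≈ 0# → x ≈ 0#

    open Exp commutativeSemiring using (_^_)

    ^-zero : ∀ {x} n → x ^ n ≈ 0# → x ≈ 0#
    ^-zero {x} n eq = stable λ x≉0 → go x≉0 n eq
      where
      go : ¬ x ≈ 0# → ∀ n → ¬ x ^ n ≈ 0#
      go x≉0 zero    eq = 1≉0 eq
      go x≉0 (suc n) eq = go x≉0 n (cancel eq x≉0)

  module Evaluation {c ℓ} {D : CommutativeRing c ℓ} (H : IntegerHom D) where

    open CommutativeRing D hiding (zero)
    open IntegerHom H
    open Pairing H
    open Exp commutativeSemiring using (_^_; ^-homo-*; ^-assocʳ)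
    open SetoidReasoning setoid

    eval : Carrier → Poly → Carrier
    eval z f = pair f (z ^_)

    eval-⊛ : ∀ z f g → eval z (f ⊛ g) ≈ eval z f * eval z g
    eval-⊛ z f g = begin
      eval z (f ⊛ g)                                ≈⟨ pair-⊛ f g (z ^_) ⟩
      pair f (λ m → pair g (λ n → z ^ (m ℕ.+ n)))   ≈⟨ pair-cong f (λ m → trans (pair-cong g (λ n → ^-homo-* z m n)) (pair-*ˡ g (z ^ m) (z ^_))) ⟩
      pair f (λ m → z ^ m * eval z g)               ≈⟨ pair-cong f (λ m → *-comm (z ^ m) (eval z g)) ⟩
      pair f (λ m → eval z g * z ^ m)               ≈⟨ pair-*ˡ f (eval z g) (z ^_) ⟩
      eval z g * eval z f                           ≈⟨ *-comm _ _ ⟩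
      eval z f * eval z g                           ∎

    eval-σ : ∀ z a f → eval z (σ a f) ≈ eval (z ^ a) f
    eval-σ z a f = trans (pair-σ a f (z ^_)) (pair-cong f λ n → sym (^-assocʳ z a n))

    eval-constant : ∀ z c → eval z (monomial c 0) ≈ ι c
    eval-constant z c = trans (pair-monomial c 0 (z ^_)) (*-identityʳ _)

    eval-𝟙 : ∀ z → eval z 𝟙 ≈ 1#
    eval-𝟙 z = trans (eval-constant z 1ℤ) ι-1

    eval-monomial : ∀ z n → eval z (monomial 1ℤ n) ≈ z ^ n
    eval-monomial z n = trans (pair-monomial 1ℤ n (z ^_)) (trans (*-congʳ ι-1) (*-identityˡ _))

    eval-xⁿ-1 : ∀ z n → eval z (xⁿ-1 n) ≈ z ^ n - 1#
    eval-xⁿ-1 z n = trans (pair-++ (monomial 1ℤ n) (⊖ 𝟙) (z ^_))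
      (+-cong (eval-monomial z n) (trans (pair-⊖ 𝟙 (z ^_)) (-‿cong (eval-𝟙 z))))

    module _ (k : ℕ) .{{_ : NonZero k}} {z} (zᵏ≈1 : z ^ k ≈ 1#) where

      ^-periodic : GroupRing.Periodic k H (z ^_)
      ^-periodic n = trans (^-homo-* z k n) (trans (*-congʳ zᵏ≈1) (*-identityˡ _))

      -- The powers of a k-th root of unity are k-periodic, so evaluation there is well defined on
      -- the integral group ring.
      eval-cong : ∀ {f g} → GroupRing._≃_ k idHom f g → eval z f ≈ eval z g
      eval-cong f≃g = GroupRing.pair-≃ (Coefficients.≃ℤ⇒≃ k H f≃g) (z ^_) ^-periodic

    1^ : ∀ n → 1# ^ n ≈ 1#
    1^ zero    = refl
    1^ (suc n) = trans (*-identityˡ _) (1^ n)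

  cyclotomicProduct : ℕ → Poly
  cyclotomicProduct zero    = 𝟙
  cyclotomicProduct (suc n) = xⁿ-1 (suc n) ⊛ cyclotomicProduct n

  module PrimitiveRoot (k : ℕ) .{{_ : NonZero k}} (1<k : 1 < k) where

    private
      module A = CommutativeRing (GroupRing.groupRing k idHom)
      module AE = Exp A.commutativeSemiring
    open IntegralGroupRing k using (annihilator; σ-annihilates)

    -- Vanishes at all k-th roots of unity except the primitive ones.
    nonprimitive : Poly
    nonprimitive = cyclotomicProduct (ℕ.pred k)

    module _ {c ℓ} {D : CommutativeRing c ℓ} (dom : IsStableDomain D) (H : IntegerHom D) where

      open CommutativeRing D hiding (zero)
      open IsStableDomain dom
      open IntegerHom H
      open Evaluation H
      open Pairing H
      open Exp commutativeSemiring using (_^_; ^-congˡ; ^-homo-*; ^-assocʳ)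
      open SetoidReasoning setoid
      open RingProperties ring using (x∙y⁻¹≈ε⇒x≈y; x≈y⇒x∙y⁻¹≈ε; -‿distribˡ-*)
      open Summation D
      open Coefficients k H using (expansion; pair-∑)

      record IsPrimitive (z : Carrier) : Set ℓ where
        field
          zᵏ≈1 : z ^ k ≈ 1#
          zᵈ≉1 : ∀ d → 0 < d → d < k → ¬ z ^ d ≈ 1#

      cyclotomicProduct-zero : ∀ {w} n d → 0 < d → d ≤ n → w ^ d ≈ 1# → eval w (cyclotomicProduct n) ≈ 0#
      cyclotomicProduct-zero     zero    (suc d) _   ()
      cyclotomicProduct-zero {w} (suc n) d       0<d d≤1+n eq with d ℕ.≟ suc n
      ... | yes ≡.refl = trans (eval-⊛ w (xⁿ-1 (suc n)) (cyclotomicProduct n))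
            (trans (*-congʳ (trans (eval-xⁿ-1 w d) (x≈y⇒x∙y⁻¹≈ε eq))) (zeroˡ _))
      ... | no  d≢1+n  = trans (eval-⊛ w (xⁿ-1 (suc n)) (cyclotomicProduct n))
            (trans (*-congˡ (cyclotomicProduct-zero n d 0<d (ℕ.≤-pred (ℕ.≤∧≢⇒< d≤1+n d≢1+n)) eq)) (zeroʳ _))

      cyclotomicProduct-nonzero : ∀ {w} n → (∀ d → 0 < d → d ≤ n → ¬ w ^ d ≈ 1#) →
                                  ¬ eval w (cyclotomicProduct n) ≈ 0#
      cyclotomicProduct-nonzero {w} zero    p eq = 1≉0 (trans (sym (eval-𝟙 w)) eq)
      cyclotomicProduct-nonzero {w} (suc n) p eq =
        cyclotomicProduct-nonzero n (λ d 0<d d≤n → p d 0<d (ℕ.m≤n⇒m≤1+n d≤n))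
          (cancel (trans (sym (eval-⊛ w (xⁿ-1 (suc n)) (cyclotomicProduct n))) eq)
            λ eq′ → p (suc n) (s≤s z≤n) ℕ.≤-refl (x∙y⁻¹≈ε⇒x≈y _ _ (trans (sym (eval-xⁿ-1 w (suc n))) eq′)))

      -- Both sides are 1 + w + ... + wⁿ, with the top term split off on the left and the bottom
      -- term on the right.
      geometric-sum : ∀ w n → w ^ n + ∑ n (w ^_) ≈ 1# + w * ∑ n (w ^_)
      geometric-sum w zero    = +-congˡ (sym (zeroʳ w))
      geometric-sum w (suc n) = begin
        w * w ^ n + (w ^ n + S)      ≈⟨ +-congˡ (geometric-sum w n) ⟩
        w * w ^ n + (1# + w * S)     ≈⟨ x∙yz≈y∙xz _ _ _ ⟩
        1# + (w * w ^ n + w * S)     ≈⟨ +-congˡ (distribˡ _ _ _) ⟨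
        1# + w * (w ^ n + S)         ∎
        where
        S = ∑ n (w ^_)
        open CommutativeSemigroupProperties +-commutativeSemigroup using (x∙yz≈y∙xz)

      geometric-sum-zero : ∀ w → w ^ k ≈ 1# → ¬ w ≈ 1# → ∑ k (w ^_) ≈ 0#
      geometric-sum-zero w wᵏ≈1 w≉1 = cancel {w - 1#} (begin
        (w - 1#) * S            ≈⟨ distribʳ S w (- 1#) ⟩
        w * S + - 1# * S        ≈⟨ +-congˡ (trans (sym (-‿distribˡ-* 1# S)) (-‿cong (*-identityˡ S))) ⟩
        w * S - S               ≈⟨ x≈y⇒x∙y⁻¹≈ε (+-cancelˡ 1# _ _ (trans (sym (geometric-sum w k)) (+-congʳ wᵏ≈1))) ⟩
        0#                      ∎) (w≉1 ∘ x∙y⁻¹≈ε⇒x≈y w 1#)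
        where
        S = ∑ k (w ^_)
        open RingProperties ring using (+-cancelˡ)

      ∑-1 : ∀ n → ∑ n (λ _ → 1#) ≈ ι (+ n)
      ∑-1 zero    = sym ι-0
      ∑-1 (suc n) = trans (+-cong (sym ι-1) (∑-1 n)) (sym (ι-+ 1ℤ (+ n)))

      eval-^ : ∀ w f n → eval w (f AE.^ n) ≈ eval w f ^ n
      eval-^ w f zero    = eval-𝟙 w
      eval-^ w f (suc n) = trans (eval-⊛ w f (f AE.^ n)) (*-congˡ (eval-^ w f n))

      module _ {z} (z-prim : IsPrimitive z) where

        open IsPrimitive z-prim

        nonprimitive-nonzero : ¬ eval z nonprimitive ≈ 0#
        nonprimitive-nonzero = cyclotomicProduct-nonzero (ℕ.pred k) λ d 0<d d≤ → zᵈ≉1 d 0<d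
          (ℕ.≤-<-trans d≤ (ℕ.≤-reflexive (ℕ.suc-pred k)))

        zᵏᵐ≈1 : ∀ m → z ^ (k ℕ.* m) ≈ 1#
        zᵏᵐ≈1 m = trans (sym (^-assocʳ z k m)) (trans (^-congˡ m zᵏ≈1) (1^ m))

        -- With g = gcd(j, k) > 1, the exponent e = k / g lies strictly between 0 and k, and (zʲ)ᵉ =
        -- (zᵏ)^(j / g) = 1. So the factor xᵉ - 1 vanishes at zʲ.
        nonprimitive-zero : ∀ j → ¬ Coprime j k → eval (z ^ j) nonprimitive ≈ 0#
        nonprimitive-zero j ¬c = aux (gcd[m,n]∣m j k) (gcd[m,n]∣n j k)
          where
          g = gcd j k
          aux : g ℕ.∣ j → g ℕ.∣ k → eval (z ^ j) nonprimitive ≈ 0#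
          aux (ℕ.divides q j≡qg) (ℕ.divides e k≡eg) = cyclotomicProduct-zero (ℕ.pred k) e 0<e (ℕ.<⇒≤pred e<k) (begin
            (z ^ j) ^ e          ≈⟨ ^-assocʳ z j e ⟩
            z ^ (j ℕ.* e)        ≡⟨ ≡.cong (z ^_) eq ⟩
            z ^ (k ℕ.* q)        ≈⟨ zᵏᵐ≈1 q ⟩
            1#                   ∎)
            where
            open ℕ-Solver
            eq : j ℕ.* e ≡ k ℕ.* q
            eq = ≡.trans (≡.cong (ℕ._* e) j≡qg) (≡.trans
              (solve 3 (λ q g e → q :* g :* e := e :* g :* q) ≡.refl q g e) (≡.cong (ℕ._* q) (≡.sym k≡eg)))
            g≢1 : ¬ g ≡ 1
            g≢1 = ¬c ∘ Coprimality.gcd≡1⇒coprime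
            eg≢0 : NonZero (e ℕ.* g)
            eg≢0 = ≡.subst NonZero k≡eg (ℕ.>-nonZero (ℕ.<-trans (s≤s z≤n) 1<k))
            0<e : 0 < e
            0<e = ℕ.>-nonZero⁻¹ e {{ℕ.m*n≢0⇒m≢0 e {{eg≢0}}}}
            1<g : 1 < g
            1<g = ℕ.≤∧≢⇒< (ℕ.>-nonZero⁻¹ g {{ℕ.m*n≢0⇒n≢0 e {{eg≢0}}}}) (g≢1 ∘ ≡.sym)
            e<k : e < k
            e<k = ≡.subst (e <_) (≡.sym k≡eg) (ℕ.m<m*n e g {{ℕ.>-nonZero 0<e}} 1<g)

        -- Since f vanishes at z, the factor w = c + f u has value ι c there and can be cancelled.
        -- The exponent n is then removed by `^-zero`.
        conjugate-zero : ∀ f n c u → f AE.^ n A.* (monomial c 0 A.+ f A.* u) A.≈ A.0# → ¬ ι c ≈ 0# → eval z f ≈ 0# →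
                         ∀ a .{{_ : NonZero a}} → Coprime a k → eval (z ^ a) f ≈ 0#
        conjugate-zero f n c u fw≈0 c≉0 fz≈0 a a⊥k = ^-zero n (begin
          eval (z ^ a) f ^ n            ≈⟨ eval-^ (z ^ a) f n ⟨
          eval (z ^ a) (f AE.^ n)       ≈⟨ cancel (begin
              eval z w * eval (z ^ a) fⁿ       ≈⟨ *-congˡ (eval-σ z a fⁿ) ⟨
              eval z w * eval z (σ a fⁿ)       ≈⟨ *-comm _ _ ⟩
              eval z (σ a fⁿ) * eval z w       ≈⟨ eval-⊛ z (σ a fⁿ) w ⟨
              eval z (σ a fⁿ ⊛ w)              ≈⟨ eval-cong k zᵏ≈1 (σ-annihilates a a⊥k fⁿ w fw≈0) ⟩
              0#                               ∎) (λ w≈0 → c≉0 (trans (sym wz≈c) w≈0)) ⟩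
          0#                            ∎)
          where
          w  = monomial c 0 ++ f ⊛ u
          fⁿ = f AE.^ n
          wz≈c : eval z w ≈ ι c
          wz≈c = begin
            eval z (monomial c 0 ++ f ⊛ u)             ≈⟨ pair-++ (monomial c 0) (f ⊛ u) (z ^_) ⟩
            eval z (monomial c 0) + eval z (f ⊛ u)     ≈⟨ +-cong (eval-constant z c) (trans (eval-⊛ z f u) (trans (*-congʳ fz≈0) (zeroˡ _))) ⟩
            ι c + 0#                                   ≈⟨ +-identityʳ _ ⟩
            ι c                                        ∎

        -- Fourier inversion: k times the r-th coefficient is Σⱼ f(zʲ) z^(j(k − r)).
        all-zero : ∀ f → (∀ j → j < k → eval (z ^ j) f ≈ 0#) → ∀ r → r < k → ι (coefficient k f r) * ι (+ k) ≈ 0#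
        all-zero f f≈0 r r<k = begin
          ι (coefficient k f r) * ι (+ k)
            ≈⟨ *-congˡ (trans (sym (∑-1 k)) (∑-cong k λ j _ → sym (trans (^-congˡ j wᵣ≈1) (1^ j)))) ⟩
          ι (coefficient k f r) * θ r
            ≈⟨ ∑-single k r<k (λ s s<k s≢r → trans (*-congˡ (geometric-sum-zero (w s) (w^k s) (w≉1 s s<k s≢r))) (zeroʳ _)) ⟨
          ∑ k (λ s → ι (coefficient k f s) * θ s)
            ≈⟨ expansion f (λ n → ∑-cong k λ j _ → ^-congˡ j (w-periodic n)) ⟨
          pair f θ
            ≈⟨ pair-∑ f k (λ j n → w n ^ j) ⟩
          ∑ k (λ j → pair f (λ n → w n ^ j))
            ≈⟨ ∑-0 k (λ j j<k → trans (pair-cong f (factor j)) (trans (pair-*ˡ f _ ((z ^ j) ^_)) (trans (*-congˡ (f≈0 j j<k)) (zeroʳ _)))) ⟩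
          0# ∎
          where
          -- w n stands for z^(n - r), with k added to keep the exponent in ℕ. By orthogonality the
          -- sum θ of its powers is ι k at r and 0 at every other s < k.
          w : ℕ → Carrier
          w n = z ^ (n ℕ.+ (k ℕ.∸ r))
          θ : ℕ → Carrier
          θ n = ∑ k (w n ^_)
          wᵣ≈1 : w r ≈ 1#
          wᵣ≈1 = trans (reflexive (≡.cong (z ^_) (ℕ.m+[n∸m]≡n (ℕ.<⇒≤ r<k)))) zᵏ≈1
          w^k : ∀ s → w s ^ k ≈ 1#
          w^k s = trans (^-assocʳ z (s ℕ.+ (k ℕ.∸ r)) k) (trans (reflexive (≡.cong (z ^_) (ℕ.*-comm _ k))) (zᵏᵐ≈1 (s ℕ.+ (k ℕ.∸ r))))
          w-periodic : ∀ n → w (k ℕ.+ n) ≈ w n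
          w-periodic n = trans (reflexive (≡.cong (z ^_) (ℕ.+-assoc k n (k ℕ.∸ r)))) (^-periodic k zᵏ≈1 (n ℕ.+ (k ℕ.∸ r)))
          factor : ∀ j n → w n ^ j ≈ z ^ ((k ℕ.∸ r) ℕ.* j) * (z ^ j) ^ n
          factor j n = begin
            w n ^ j                                     ≈⟨ ^-assocʳ z (n ℕ.+ (k ℕ.∸ r)) j ⟩
            z ^ ((n ℕ.+ (k ℕ.∸ r)) ℕ.* j)               ≡⟨ ≡.cong (z ^_) (≡.trans (ℕ.*-distribʳ-+ j n _) (ℕ.+-comm (n ℕ.* j) _)) ⟩
            z ^ ((k ℕ.∸ r) ℕ.* j ℕ.+ n ℕ.* j)           ≈⟨ ^-homo-* z ((k ℕ.∸ r) ℕ.* j) (n ℕ.* j) ⟩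
            z ^ ((k ℕ.∸ r) ℕ.* j) * z ^ (n ℕ.* j)       ≈⟨ *-congˡ (trans (reflexive (≡.cong (z ^_) (ℕ.*-comm n j))) (sym (^-assocʳ z j n))) ⟩
            z ^ ((k ℕ.∸ r) ℕ.* j) * (z ^ j) ^ n         ∎
          w≉1 : ∀ s → s < k → ¬ s ≡ r → ¬ w s ≈ 1#
          w≉1 s s<k s≢r with ℕ.<-cmp s r
          -- Below r the exponent of w s lies strictly between 0 and k; above r it does so after k
          -- is removed.
          ... | tri< s<r _ _ = zᵈ≉1 _ (ℕ.<-≤-trans (ℕ.m<n⇒0<n∸m r<k) (ℕ.m≤n+m _ s))
                (≡.subst (s ℕ.+ (k ℕ.∸ r) <_) (ℕ.m+[n∸m]≡n (ℕ.<⇒≤ r<k)) (ℕ.+-monoˡ-< (k ℕ.∸ r) s<r))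
          ... | tri≈ _ s≡r _ = λ _ → s≢r s≡r
          ... | tri> _ _ r<s = λ w≈1 → zᵈ≉1 (s ℕ.∸ r) (ℕ.m<n⇒0<n∸m r<s) (ℕ.≤-<-trans (ℕ.m∸n≤m s r) s<k)
                (trans (sym (^-periodic k zᵏ≈1 (s ℕ.∸ r))) (trans (reflexive (≡.cong (z ^_) eq)) w≈1))
            where
            eq : k ℕ.+ (s ℕ.∸ r) ≡ s ℕ.+ (k ℕ.∸ r)
            eq = ≡.trans (≡.sym (ℕ.+-∸-assoc k (ℕ.<⇒≤ r<s))) (≡.trans (≡.cong (ℕ._∸ r) (ℕ.+-comm k s)) (ℕ.+-∸-assoc s (ℕ.<⇒≤ r<k)))

        -- At zʲ the conjugate of f vanishes if j is coprime to k, and `nonprimitive` vanishes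
        -- otherwise. The product therefore vanishes at all powers of z, and Fourier inversion
        -- applies.
        zero⇒coefficients-zero : ∀ f → ¬ ι (proj₁ (proj₂ (annihilator f))) ≈ 0# → eval z f ≈ 0# →
          ∀ r → r < k → ι (coefficient k (f ⊛ nonprimitive) r) * ι (+ k) ≈ 0#
        zero⇒coefficients-zero f c≉0 fz≈0 = all-zero (f ⊛ nonprimitive) λ j _ → trans (eval-⊛ (z ^ j) f nonprimitive) (at j)
          where
          at : ∀ j → eval (z ^ j) f * eval (z ^ j) nonprimitive ≈ 0#
          at j with Coprimality.coprime? j k
          ... | no ¬c = trans (*-congˡ (nonprimitive-zero j ¬c)) (zeroʳ _)
          -- 0 is coprime to k only when k = 1.
          at zero    | yes c = contradiction (≡.sym (Coprimality.0-coprimeTo-m⇒m≡1 c)) (ℕ.<⇒≢ 1<k)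
          at (suc j) | yes c = let n , d , u , _ , eq = annihilator f in
            trans (*-congʳ (conjugate-zero f n d u eq c≉0 fz≈0 (suc j) c)) (zeroˡ _)

        -- `nonprimitive` does not vanish at the primitive root z and can be cancelled. The
        -- hypothesis mentions no domain, so the vanishing of f travels through it from one domain
        -- to another.
        product-zero⇒zero : ∀ f → f ⊛ nonprimitive A.≈ [] → eval z f ≈ 0#
        product-zero⇒zero f eq = cancel (begin
          eval z nonprimitive * eval z f     ≈⟨ *-comm _ _ ⟩
          eval z f * eval z nonprimitive     ≈⟨ eval-⊛ z f nonprimitive ⟨
          eval z (f ⊛ nonprimitive)          ≈⟨ eval-cong k zᵏ≈1 eq ⟩
          0#                                 ∎) nonprimitive-nonzero

  -- Finite fields: a generator of a subgroup of order k is a primitive k-th root of unity.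

  module _ {c ℓ} (F : FiniteField c ℓ) where

    open FiniteField F
    open CommutativeRing commutativeRing hiding (zero)
    open RingProperties ring using (x∙y⁻¹≈ε⇒x≈y; x≈y⇒x∙y⁻¹≈ε; -‿distribʳ-*; -‿involutive; -0#≈0#)
    open Exp commutativeSemiring using (_^_; ^-homo-*; ^-assocʳ)
    open SetoidReasoning setoid

    finite-≈? : ∀ x y → Dec (x ≈ y)
    finite-≈? x y with Inverse.to finite x Fin.≟ Inverse.to finite y
    ... | yes eq = yes (trans (sym (Inverse.strictlyInverseʳ finite x))
                         (trans (Inverse.from-cong finite eq) (Inverse.strictlyInverseʳ finite y)))
    ... | no neq = no λ x≈y → neq (Inverse.to-cong finite x≈y)

    finiteField-isStableDomain : IsStableDomain commutativeRing
    finiteField-isStableDomain = record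
      { 1≉0    = nontrivial ∘ sym
      ; cancel = λ {x} {y} xy≈0 x≉0 → let x⁻¹ , xx⁻¹≈1 = inverse x x≉0 in begin
          y                ≈⟨ *-identityˡ y ⟨
          1# * y           ≈⟨ *-congʳ xx⁻¹≈1 ⟨
          x * x⁻¹ * y      ≈⟨ *-congʳ (*-comm x x⁻¹) ⟩
          x⁻¹ * x * y      ≈⟨ *-assoc x⁻¹ x y ⟩
          x⁻¹ * (x * y)    ≈⟨ *-congˡ xy≈0 ⟩
          x⁻¹ * 0#         ≈⟨ zeroʳ x⁻¹ ⟩
          0#               ∎
      ; stable = λ {x} → decidable-stable (finite-≈? x 0#)
      }
    open IsStableDomain finiteField-isStableDomain

    module _ {p} (Φ : UnitSubgroup F p) {k} .{{_ : NonZero k}} (1<k : 1 < k) (order : HasOrder F Φ k)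
      {φ} (φ-gen : IsGenerator F φ Φ) where

      open UnitSubgroup Φ
      private
        order-inverse : ∀ x → Inverse.from order (Inverse.to order x) .proj₁ ≈ x .proj₁
        order-inverse = Inverse.strictlyInverseʳ order

        φ^-member : ∀ n → member (φ ^ n)
        φ^-member zero    = 1-member
        φ^-member (suc n) = *-closed (proj₁ φ-gen) (φ^-member n)

        exponent : Fin k → ℕ
        exponent i = proj₁ (proj₂ φ-gen _ (proj₂ (Inverse.from order i)))

        exponent-spec : ∀ i → Inverse.from order i .proj₁ ≈ φ ^ exponent i
        exponent-spec i = proj₂ (proj₂ φ-gen _ (proj₂ (Inverse.from order i)))

      -- If φᵈ = 1, every member of Φ is a power of φ with exponent below d. Reducing exponents
      -- modulo d then embeds k elements into d < k residues.
      generator^-≉1 : ∀ d → 0 < d → d < k → ¬ φ ^ d ≈ 1#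
      generator^-≉1 d@(suc _) 0<d d<k φᵈ≈1 = ℕ.<⇒≱ d<k (Fin.injective⇒≤ {f = residue} injective)
        where
        φ^1 : ∀ n → (φ ^ d) ^ n ≈ 1#
        φ^1 zero    = refl
        φ^1 (suc n) = trans (*-cong φᵈ≈1 (φ^1 n)) (*-identityˡ 1#)
        φ^% : ∀ n → φ ^ n ≈ φ ^ (n % d)
        φ^% n = begin
          φ ^ n                                       ≡⟨ ≡.cong (φ ^_) (≡.trans (ℕ.m≡m%n+[m/n]*n n d) (≡.cong (n % d ℕ.+_) (ℕ.*-comm (n ℕ./ d) d))) ⟩
          φ ^ (n % d ℕ.+ d ℕ.* (n ℕ./ d))             ≈⟨ ^-homo-* φ (n % d) _ ⟩
          φ ^ (n % d) * φ ^ (d ℕ.* (n ℕ./ d))         ≈⟨ *-congˡ (trans (sym (^-assocʳ φ d (n ℕ./ d))) (φ^1 (n ℕ./ d))) ⟩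
          φ ^ (n % d) * 1#                            ≈⟨ *-identityʳ _ ⟩
          φ ^ (n % d)                                 ∎
        residue : Fin k → Fin d
        residue i = fromℕ< (ℕ.m%n<n (exponent i) d)
        injective : ∀ {i j} → residue i ≡ residue j → i ≡ j
        injective {i} {j} eq = ≡.trans (≡.sym (Inverse.strictlyInverseˡ order i))
          (≡.trans (Inverse.to-cong order (begin
            Inverse.from order i .proj₁        ≈⟨ trans (exponent-spec i) (φ^% (exponent i)) ⟩
            φ ^ (exponent i % d)               ≡⟨ ≡.cong (φ ^_) (Fin.fromℕ<-injective _ _ _ _ eq) ⟩
            φ ^ (exponent j % d)               ≈⟨ trans (exponent-spec j) (φ^% (exponent j)) ⟨
            Inverse.from order j .proj₁        ∎)) (Inverse.strictlyInverseˡ order j))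

      -- Among the k + 1 powers 1, φ, ..., φᵏ two coincide by the pigeonhole principle. Their
      -- exponents differ by at most k, and not by less, so φᵏ = 1.
      generator-isPrimitive : PrimitiveRoot.IsPrimitive k 1<k finiteField-isStableDomain (integerHom commutativeRing) φ
      generator-isPrimitive = record
        { zᵏ≈1 = let i , j , i<j , eq = Fin.pigeonhole (ℕ.n<1+n k) λ (i : Fin (suc k)) → Inverse.to order (φ ^ toℕ i , φ^-member (toℕ i))
                 in coincidence (toℕ i) (toℕ j) i<j (ℕ.≤-pred (Fin.toℕ<n j)) (trans (sym (order-inverse (_ , φ^-member (toℕ i)))) (trans (Inverse.from-cong order eq) (order-inverse (_ , φ^-member (toℕ j)))))
        ; zᵈ≉1 = generator^-≉1
        }
        where
        φ^-cancel : ∀ i j → i < j → φ ^ i ≈ φ ^ j → φ ^ (j ℕ.∸ i) ≈ 1#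
        φ^-cancel i j i<j φⁱ≈φʲ = x∙y⁻¹≈ε⇒x≈y _ _ (cancel {φ ^ i} (begin
          φ ^ i * (φ ^ e - 1#)                ≈⟨ distribˡ _ _ _ ⟩
          φ ^ i * φ ^ e + φ ^ i * - 1#        ≈⟨ +-cong (sym (^-homo-* φ i e)) (trans (sym (-‿distribʳ-* _ 1#)) (-‿cong (*-identityʳ _))) ⟩
          φ ^ (i ℕ.+ e) - φ ^ i               ≡⟨ ≡.cong (λ n → φ ^ n - φ ^ i) (ℕ.m+[n∸m]≡n (ℕ.<⇒≤ i<j)) ⟩
          φ ^ j - φ ^ i                       ≈⟨ x≈y⇒x∙y⁻¹≈ε (sym φⁱ≈φʲ) ⟩
          0#                                  ∎) (nonzero (φ^-member i)))
          where e = j ℕ.∸ i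
        coincidence : ∀ i j → i < j → j ≤ k → φ ^ i ≈ φ ^ j → φ ^ k ≈ 1#
        coincidence i j i<j j≤k φⁱ≈φʲ with ℕ.m≤n⇒m<n∨m≡n (ℕ.≤-trans (ℕ.m∸n≤m j i) j≤k)
        ... | inj₁ e<k    = contradiction (φ^-cancel i j i<j φⁱ≈φʲ) (generator^-≉1 (j ℕ.∸ i) (ℕ.m<n⇒0<n∸m i<j) e<k)
        ... | inj₂ ≡.refl = φ^-cancel i j i<j φⁱ≈φʲ

    integer-zero⇒∣ : ∀ {q} → HasCharacteristic F q → ∀ i → IntegerHom.ι (integerHom commutativeRing) i ≈ 0# → q ℕ.∣ ℤ.∣ i ∣
    integer-zero⇒∣ char (+ n)    eq = Equivalence.to (char n) eq
    integer-zero⇒∣ char -[1+ n ] eq =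
      Equivalence.to (char (suc n)) (trans (sym (-‿involutive _)) (trans (-‿cong eq) -0#≈0#))

  -- The bound, and the transfer between characteristic 0 and finite fields.

  maximum : ℕ → (ℕ → ℕ) → ℕ
  maximum zero    g = 0
  maximum (suc n) g = g n ℕ.⊔ maximum n g

  ≤-maximum : ∀ {i n} (g : ℕ → ℕ) → i < n → g i ≤ maximum n g
  ≤-maximum {i} {suc n} g i<1+n with ℕ.m≤n⇒m<n∨m≡n (ℕ.≤-pred i<1+n)
  ... | inj₁ i<n    = ℕ.≤-trans (≤-maximum g i<n) (ℕ.m≤n⊔m (g n) _)
  ... | inj₂ ≡.refl = ℕ.m≤m⊔n (g n) _

  relator : (ω i j s t : ℕ) → Poly
  relator ω i j s t = monomial 1ℤ ω ⊛ xⁿ-1 j ⊛ xⁿ-1 s ++ ⊖ (xⁿ-1 i ⊛ xⁿ-1 t)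

  module _ {c ℓ} {D : CommutativeRing c ℓ} (H : IntegerHom D) where

    open CommutativeRing D hiding (zero)
    open Evaluation H
    open Pairing H
    open Exp commutativeSemiring using (_^_)
    open RingProperties ring using (x∙y⁻¹≈ε⇒x≈y; x≈y⇒x∙y⁻¹≈ε)

    eval-relator : ∀ z ω i j s t → eval z (relator ω i j s t) ≈
      z ^ ω * (z ^ j - 1#) * (z ^ s - 1#) - (z ^ i - 1#) * (z ^ t - 1#)
    eval-relator z ω i j s t = trans (pair-++ (monomial 1ℤ ω ⊛ xⁿ-1 j ⊛ xⁿ-1 s) (⊖ (xⁿ-1 i ⊛ xⁿ-1 t)) (z ^_)) (+-cong
      (trans (eval-⊛ z (monomial 1ℤ ω ⊛ xⁿ-1 j) (xⁿ-1 s)) (*-cong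
        (trans (eval-⊛ z (monomial 1ℤ ω) (xⁿ-1 j)) (*-cong (eval-monomial z ω) (eval-xⁿ-1 z j)))
        (eval-xⁿ-1 z s)))
      (trans (pair-⊖ (xⁿ-1 i ⊛ xⁿ-1 t) (z ^_)) (-‿cong
        (trans (eval-⊛ z (xⁿ-1 i) (xⁿ-1 t)) (*-cong (eval-xⁿ-1 z i) (eval-xⁿ-1 z t))))))

    relator-zero : ∀ z ω i j s t → z ^ ω * (z ^ j - 1#) * (z ^ s - 1#) ≈ (z ^ i - 1#) * (z ^ t - 1#) →
                   eval z (relator ω i j s t) ≈ 0#
    relator-zero z ω i j s t eq = trans (eval-relator z ω i j s t) (x≈y⇒x∙y⁻¹≈ε eq)

    relator-zero⁻¹ : ∀ z ω i j s t → eval z (relator ω i j s t) ≈ 0# →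
                     z ^ ω * (z ^ j - 1#) * (z ^ s - 1#) ≈ (z ^ i - 1#) * (z ^ t - 1#)
    relator-zero⁻¹ z ω i j s t eq = x∙y⁻¹≈ε⇒x≈y _ _ (trans (sym (eval-relator z ω i j s t)) eq)

  -- Of the complex numbers only this is used: a stable domain in which nonzero integers stay
  -- nonzero, with a primitive root ζ.
  module Transfer (k : ℕ) .{{_ : NonZero k}} (1<k : 1 < k)
    {c₀ ℓ₀} {C : CommutativeRing c₀ ℓ₀} (C-dom : IsStableDomain C)
    (C-char : ∀ i → CommutativeRing._≈_ C (IntegerHom.ι (integerHom C) i) (CommutativeRing.0# C) → i ≡ 0ℤ)
    {ζ} (ζ-prim : PrimitiveRoot.IsPrimitive k 1<k C-dom (integerHom C) ζ) where

    open PrimitiveRoot k 1<k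
    private
      module C = CommutativeRing C
      module CE = Evaluation (integerHom C)
      module CO = Overlaps C.rawRing
      open IntegralGroupRing k using (annihilator)

      -- For r < k these integers all vanish exactly when f(ζ) = 0. They mediate between the two
      -- domains.
      residual : Poly → ℕ → ℤ
      residual f r = coefficient k (f ⊛ nonprimitive) r

      residual-zero : ∀ f → (∀ r → r < k → residual f r ≡ 0ℤ) → GroupRing._≃_ k idHom (f ⊛ nonprimitive) []
      residual-zero f eq = Coefficients.coefficients⇒≃ k idHom eq

      cancel-k : ∀ i → i ℤ.* + k ≡ 0ℤ → i ≡ 0ℤ
      cancel-k i eq with ℤ.i*j≡0⇒i≡0∨j≡0 i eq
      ... | inj₁ i≡0 = i≡0
      ... | inj₂ k≡0 = contradiction (ℤ.+-injective k≡0) (ℕ.≢-nonZero⁻¹ k)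

    C-zero : ∀ f → CE.eval ζ f C.≈ C.0# → ∀ r → r < k → residual f r ≡ 0ℤ
    C-zero f fζ≈0 r r<k = cancel-k _ (C-char _ (C.trans (IntegerHom.ι-* (integerHom C) (residual f r) (+ k))
      (zero⇒coefficients-zero C-dom (integerHom C) ζ-prim f
        (λ c≈0 → proj₁ (proj₂ (proj₂ (proj₂ (annihilator f)))) (C-char _ c≈0)) fζ≈0 r r<k)))

    -- In characteristic q above the weight, neither the constant of the annihilating product nor k
    -- times a residual coefficient becomes 0 unless it is 0 in ℤ.
    weight : Poly → ℕ
    weight f = ℤ.∣ proj₁ (proj₂ (annihilator f)) ∣ ℕ.⊔ maximum k (λ r → ℤ.∣ residual f r ℤ.* + k ∣)

    -- Including k places the prime divisors of k below the bound as well.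
    bound : ℕ
    bound = k ℕ.⊔ maximum k λ ω → maximum k λ i → maximum k λ j → maximum k λ s → maximum k λ t →
            weight (relator ω i j s t)

    weight≤bound : ∀ {ω i j s t} → ω < k → i < k → j < k → s < k → t < k → weight (relator ω i j s t) ≤ bound
    weight≤bound {ω} {i} {j} {s} {t} ω<k i<k j<k s<k t<k =
      ℕ.≤-trans (≤-maximum (λ t → weight (relator ω i j s t)) t<k)
      (ℕ.≤-trans (≤-maximum (λ s → maximum k λ t → weight (relator ω i j s t)) s<k)
      (ℕ.≤-trans (≤-maximum (λ j → maximum k λ s → maximum k λ t → weight (relator ω i j s t)) j<k)
      (ℕ.≤-trans (≤-maximum (λ i → maximum k λ j → maximum k λ s → maximum k λ t → weight (relator ω i j s t)) i<k)
      (ℕ.≤-trans (≤-maximum (λ ω → maximum k λ i → maximum k λ j → maximum k λ s → maximum k λ t → weight (relator ω i j s t)) ω<k)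
        (ℕ.m≤n⊔m k _)))))

    module _ {c ℓ p} (F : FiniteField c ℓ) (Φ : UnitSubgroup F p) (order : HasOrder F Φ k)
      {φ} (φ-gen : IsGenerator F φ Φ) where

      open FiniteField F using (commutativeRing)
      open CommutativeRing commutativeRing using (_≈_; 0#; trans)
      private
        F-dom = finiteField-isStableDomain F
        H = integerHom commutativeRing
        φ-prim = generator-isPrimitive F Φ 1<k order φ-gen
        module FE = Evaluation H

      -- The constant c of the annihilating product only has to survive in C, where f P = 0 is
      -- established; cancelling P works in any field. Hence this direction excludes no
      -- characteristic.
      C⇒F : ∀ f → CE.eval ζ f C.≈ C.0# → FE.eval φ f ≈ 0#
      C⇒F f fζ≈0 = product-zero⇒zero F-dom H φ-prim f (residual-zero f (C-zero f fζ≈0))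

      F⇒C : ∀ {q} → HasCharacteristic F q → ∀ f → weight f < q → FE.eval φ f ≈ 0# → CE.eval ζ f C.≈ C.0#
      F⇒C {q} char f w<q fφ≈0 = product-zero⇒zero C-dom (integerHom C) ζ-prim f (residual-zero f λ r r<k →
        cancel-k _ (small (residual f r ℤ.* + k)
          (ℕ.≤-<-trans (ℕ.≤-trans (≤-maximum (λ r → ℤ.∣ residual f r ℤ.* + k ∣) r<k) (ℕ.m≤n⊔m _ _)) w<q)
          (trans (IntegerHom.ι-* H (residual f r) (+ k))
            (zero⇒coefficients-zero F-dom H φ-prim f
              (λ c≈0 → proj₁ (proj₂ (proj₂ (proj₂ (annihilator f))))
                (small _ (ℕ.≤-<-trans (ℕ.m≤m⊔n _ _) w<q) c≈0))
              fφ≈0 r r<k))))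
        where
        -- An integer that vanishes in F is a multiple of q, and 0 is the only one of absolute value
        -- below q.
        small : ∀ i → ℤ.∣ i ∣ < q → IntegerHom.ι H i ≈ 0# → i ≡ 0ℤ
        small i i<q ι≈0 with i ℤ.≟ 0ℤ
        ... | yes i≡0 = i≡0
        ... | no  i≢0 = contradiction (ℕ.∣⇒≤ {{ℤ.≢-nonZero i≢0}} (integer-zero⇒∣ F char i ι≈0)) (ℕ.<⇒≱ i<q)

      -- The exponent ω is kept, and triviality depends on k and the indices only.
      𝒪C⊆𝒪F : CO.NontrivialOverlaps ζ k ⊆ 𝒪 F φ k
      𝒪C⊆𝒪F {i , j , s , t} (o , nontriv) = record
        { i-range = i-range ; j-range = j-range ; s-range = s-range ; t-range = t-range ; i≢s = i≢s
        ; relation = let ω , ω<k , eq = relation in ω , ω<k ,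
            relator-zero⁻¹ H φ ω i j s t (C⇒F (relator ω i j s t) (relator-zero (integerHom C) ζ ω i j s t eq))
        } , nontriv
        where open CO.IsOverlap o

      𝒪F⊆𝒪C : ∀ {q} → HasCharacteristic F q → bound < q → 𝒪 F φ k ⊆ CO.NontrivialOverlaps ζ k
      𝒪F⊆𝒪C char b<q {i , j , s , t} (o , nontriv) = record
        { i-range = i-range ; j-range = j-range ; s-range = s-range ; t-range = t-range ; i≢s = i≢s
        ; relation = let ω , ω<k , eq = relation in ω , ω<k ,
            relator-zero⁻¹ (integerHom C) ζ ω i j s t (F⇒C char (relator ω i j s t)
              (ℕ.≤-<-trans (weight≤bound ω<k (proj₂ i-range) (proj₂ j-range) (proj₂ s-range) (proj₂ t-range)) b<q)
              (relator-zero H φ ω i j s t eq))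
        } , nontriv
        where open Overlaps.IsOverlap o

    overlaps-finite-field : ∀ {c ℓ p} →
      ((F : FiniteField c ℓ) (Φ : UnitSubgroup F p) → HasOrder F Φ k →
        (φ : CommutativeRing.Carrier (FiniteField.commutativeRing F)) → IsGenerator F φ Φ →
        CO.NontrivialOverlaps ζ k ⊆ 𝒪 F φ k)
      × IsFinite (λ q → Prime q ×
          ( q ℕ.∣ k
          ⊎ Σ (FiniteField c ℓ) λ F →
            HasCharacteristic F q ×
            Σ (UnitSubgroup F p) λ Φ →
            HasOrder F Φ k ×
            ∃[ φ ] (IsGenerator F φ Φ × ¬ (𝒪 F φ k ≐ CO.NontrivialOverlaps ζ k))))
    overlaps-finite-field =
        (λ F Φ order φ φ-gen → 𝒪C⊆𝒪F F Φ order φ-gen)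
      -- The list runs from 0 to `bound` inclusive; beyond it both inclusions hold, which
      -- contradicts the inequality of the two sets.
      , upTo (suc bound) , λ where
          (_ , inj₁ q∣k) → ∈-upTo⁺ (s≤s (ℕ.≤-trans (ℕ.∣⇒≤ q∣k) (ℕ.m≤m⊔n k _)))
          (_ , inj₂ (F , char , Φ , order , φ , φ-gen , 𝒪F≉𝒪C)) → ∈-upTo⁺ (s≤s (ℕ.≮⇒≥ λ b<q →
            𝒪F≉𝒪C ((λ {o} → 𝒪F⊆𝒪C F Φ order φ-gen char b<q {o}) , (λ {o} → 𝒪C⊆𝒪F F Φ order φ-gen {o}))))

module ComplexRoots where

  open Estimates
  open CyclotomicTransfer
  open import Algebra.Bundles using (CommutativeRing)
  import Algebra.Properties.CommutativeSemiring.Exp as Exp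
  open import Data.Integer.Base using (+_; -[1+_]; 0ℤ)
  open import Data.Integer.Solver using () renaming (module +-*-Solver to ℤ-Solver)
  open import Data.Nat.Base as ℕ using (ℕ; zero; suc; NonZero)
  import Data.Nat.Divisibility as ℕ
  import Data.Nat.Properties as ℕ
  open import Data.Product.Base using (∃-syntax; _×_; _,_; proj₁; proj₂)
  open import Data.Rational.Base as ℚ using (ℚ; 0ℚ; 1ℚ; _+_; _*_; -_; _-_; ∣_∣; _≤_; _<_; _/_; toℚᵘ)
  import Data.Rational.Properties as ℚ
  open import Data.Rational.Solver using (module +-*-Solver)
  open import Data.Rational.Unnormalised.Base as ℚᵘ using (mkℚᵘ)
  import Data.Rational.Unnormalised.Properties as ℚᵘ
  open import Data.Sum.Base using (_⊎_; inj₁; inj₂; [_,_]′)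
  open import Function.Base using (_∘_; id)
  open import Level using (0ℓ)
  open import Relation.Binary.PropositionalEquality as ≡ using (_≡_)
  import Relation.Binary.Reasoning.Setoid as SetoidReasoning
  open import Relation.Nullary using (¬_; Dec; yes; no; contradiction)
  open +-*-Solver
  open Summation ℚ.+-*-commutativeRing

  -- Null sequences, and the complex numbers as a stable domain.

  <⇒≱ : ∀ {p q} → p < q → ¬ q ≤ p
  <⇒≱ p<q q≤p = ℚ.<-irrefl ≡.refl (ℚ.<-≤-trans p<q q≤p)

  -- x ≈ᴿ y unfolds to Null (λ n → seq x n - seq y n).
  Null : (ℕ → ℚ) → Set
  Null u = ∀ ε → 0ℚ < ε → ∃[ N ] ∀ n → N ℕ.≤ n → ∣ u n ∣ < ε

  Null-cong : ∀ {u v} → (∀ n → u n ≡ v n) → Null u → Null v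
  Null-cong u≡v p ε 0<ε = let N , q = p ε 0<ε in N , λ n N≤n → ≡.subst (λ z → ∣ z ∣ < ε) (u≡v n) (q n N≤n)

  Null-0 : Null (λ _ → 0ℚ)
  Null-0 ε 0<ε = 0 , λ _ _ → 0<ε

  Null-dominated : ∀ {u v} C → 0ℚ ≤ C → (∃[ N ] ∀ n → N ℕ.≤ n → ∣ u n ∣ ≤ C * ∣ v n ∣) → Null v → Null u
  Null-dominated C 0≤C (L , u≤Cv) p ε 0<ε =
    let δ , 0<δ , Cδ<ε = shrink C ε 0≤C 0<ε
        N , q          = p δ 0<δ
    in L ℕ.⊔ N , λ n L⊔N≤n → ℚ.≤-<-trans
         (ℚ.≤-trans (u≤Cv n (≤-max₁ {L} {N} L⊔N≤n)) (*-monoˡ-≤ 0≤C (ℚ.<⇒≤ (q n (≤-max₂ {L} {N} L⊔N≤n))))) Cδ<ε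

  Null-+ : ∀ {u v} → Null u → Null v → Null (λ n → u n + v n)
  Null-+ {u} {v} p q ε 0<ε =
    let δ , 0<δ , 2δ<ε = shrink (1ℚ + 1ℚ) ε (+-nonNeg 0≤1 0≤1) 0<ε
        M , p′         = p δ 0<δ
        N , q′         = q δ 0<δ
    in M ℕ.⊔ N , λ n M⊔N≤n → let open ℚ.≤-Reasoning in begin-strict
         ∣ u n + v n ∣          ≤⟨ ℚ.∣p+q∣≤∣p∣+∣q∣ (u n) (v n) ⟩
         ∣ u n ∣ + ∣ v n ∣      ≤⟨ ℚ.+-mono-≤ (ℚ.<⇒≤ (p′ n (≤-max₁ {M} {N} M⊔N≤n))) (ℚ.<⇒≤ (q′ n (≤-max₂ {M} {N} M⊔N≤n))) ⟩
         δ + δ                  ≡⟨ solve 1 (λ δ → δ :+ δ := (con 1ℚ :+ con 1ℚ) :* δ) ≡.refl δ ⟩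
         (1ℚ + 1ℚ) * δ          <⟨ 2δ<ε ⟩
         ε                      ∎

  Null-neg : ∀ {u} → Null u → Null (λ n → - u n)
  Null-neg {u} p ε 0<ε = let N , q = p ε 0<ε in N , λ n N≤n → ≡.subst (_< ε) (≡.sym (ℚ.∣-p∣≡∣p∣ (u n))) (q n N≤n)

  Null-* : ∀ x {u} → Null u → Null (λ n → seq x n * u n)
  Null-* x {u} p = let B , 0≤B , N , b = bounded x in
    Null-dominated B 0≤B (N , λ n N≤n → ℚ.≤-trans (ℚ.≤-reflexive (ℚ.∣p*q∣≡∣p∣*∣q∣ (seq x n) (u n)))
      (*-monoʳ-≤ (ℚ.0≤∣p∣ (u n)) (b n N≤n))) p

  Null-constant : ∀ {q} → Null (λ _ → q) → ¬ 1ℚ ≤ ∣ q ∣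
  Null-constant {q} p 1≤∣q∣ = let N , b = p 1ℚ 0<1 in <⇒≱ (b N ℕ.≤-refl) 1≤∣q∣

  ≈-refl : ∀ x → x ≈ᴿ x
  ≈-refl x = Null-cong (λ n → ≡.sym (ℚ.+-inverseʳ (seq x n))) Null-0

  pointwise : ∀ x y → (∀ n → seq x n ≡ seq y n) → x ≈ᴿ y
  pointwise x y eq = Null-cong (λ n → ≡.trans (≡.sym (ℚ.+-inverseʳ (seq x n))) (≡.cong (_-_ (seq x n)) (eq n))) Null-0

  ≈-sym : ∀ x y → x ≈ᴿ y → y ≈ᴿ x
  ≈-sym x y p = Null-cong (λ n → solve 2 (λ a b → :- (a :- b) := b :- a) ≡.refl (seq x n) (seq y n)) (Null-neg p)

  ≈-trans : ∀ x y z → x ≈ᴿ y → y ≈ᴿ z → x ≈ᴿ z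
  ≈-trans x y z p q = Null-cong (λ n → solve 3 (λ a b c → (a :- b) :+ (b :- c) := a :- c) ≡.refl (seq x n) (seq y n) (seq z n))
    (Null-+ p q)

  +ᴿ-cong : ∀ x x′ y y′ → x ≈ᴿ x′ → y ≈ᴿ y′ → x +ᴿ y ≈ᴿ x′ +ᴿ y′
  +ᴿ-cong x x′ y y′ p q = Null-cong
    (λ n → solve 4 (λ a b c d → (a :- b) :+ (c :- d) := (a :+ c) :- (b :+ d)) ≡.refl (seq x n) (seq x′ n) (seq y n) (seq y′ n))
    (Null-+ p q)

  -ᴿ-cong : ∀ x y → x ≈ᴿ y → -ᴿ x ≈ᴿ -ᴿ y
  -ᴿ-cong x y p = Null-cong (λ n → solve 2 (λ a b → :- (a :- b) := :- a :- :- b) ≡.refl (seq x n) (seq y n)) (Null-neg p)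

  *ᴿ-cong : ∀ x x′ y y′ → x ≈ᴿ x′ → y ≈ᴿ y′ → x *ᴿ y ≈ᴿ x′ *ᴿ y′
  *ᴿ-cong x x′ y y′ p q = Null-cong
    (λ n → solve 4 (λ a b c d → a :* (c :- d) :+ d :* (a :- b) := a :* c :- b :* d) ≡.refl (seq x n) (seq x′ n) (seq y n) (seq y′ n))
    (Null-+ (Null-* x q) (Null-* y′ p))

  ≈0⇒Null : ∀ x → x ≈ᴿ fromℚ 0ℚ → Null (seq x)
  ≈0⇒Null x = Null-cong (λ n → ℚ.+-identityʳ (seq x n))

  Null⇒≈0 : ∀ x → Null (seq x) → x ≈ᴿ fromℚ 0ℚ
  Null⇒≈0 x = Null-cong (λ n → ≡.sym (ℚ.+-identityʳ (seq x n)))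

  BoundedAway : (ℕ → ℚ) → Set
  BoundedAway u = ∃[ δ ] (0ℚ < δ × ∃[ N ] ∀ n → N ℕ.≤ n → δ ≤ ∣ u n ∣)

  boundedAway⇒¬Null : ∀ {u} → BoundedAway u → ¬ Null u
  boundedAway⇒¬Null (δ , 0<δ , M , far) p = let N , near = p δ 0<δ in
    <⇒≱ (near (M ℕ.⊔ N) (ℕ.m≤n⊔m M N)) (far (M ℕ.⊔ N) (ℕ.m≤m⊔n M N))

  -- A constructive substitute for deciding x ≈ 0. One approximation, beyond which the sequence
  -- moves by less than η, is compared with 2η: either the tail stays below 3η < ε, or it stays
  -- above η.
  near-or-far : ∀ x ε → 0ℚ < ε → (∃[ N ] ∀ n → N ℕ.≤ n → ∣ seq x n ∣ < ε) ⊎ BoundedAway (seq x)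
  near-or-far x ε 0<ε =
    let η , 0<η , 3η<ε = shrink (1ℚ + 1ℚ + 1ℚ) ε (+-nonNeg (+-nonNeg 0≤1 0≤1) 0≤1) 0<ε
        N , close      = cauchy x η 0<η
    in separate η 0<η 3η<ε N close (∣ seq x N ∣ ℚ.<? η + η)
    where
    separate : ∀ η → 0ℚ < η → (1ℚ + 1ℚ + 1ℚ) * η < ε →
               ∀ N → (∀ m n → N ℕ.≤ m → N ℕ.≤ n → ∣ seq x m - seq x n ∣ < η) → Dec (∣ seq x N ∣ < η + η) →
               (∃[ N ] ∀ n → N ℕ.≤ n → ∣ seq x n ∣ < ε) ⊎ BoundedAway (seq x)
    separate η 0<η 3η<ε N close (yes small) = inj₁ (N , λ n N≤n → let open ℚ.≤-Reasoning in begin-strict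
      ∣ seq x n ∣                              ≡⟨ ≡.cong ∣_∣ (solve 2 (λ a b → b := a :+ (b :- a)) ≡.refl (seq x N) (seq x n)) ⟩
      ∣ seq x N + (seq x n - seq x N) ∣        ≤⟨ ℚ.∣p+q∣≤∣p∣+∣q∣ (seq x N) (seq x n - seq x N) ⟩
      ∣ seq x N ∣ + ∣ seq x n - seq x N ∣      ≤⟨ ℚ.+-mono-≤ (ℚ.<⇒≤ small) (ℚ.<⇒≤ (close n N N≤n ℕ.≤-refl)) ⟩
      η + η + η                                ≡⟨ solve 1 (λ η → η :+ η :+ η := (con 1ℚ :+ con 1ℚ :+ con 1ℚ) :* η) ≡.refl η ⟩
      (1ℚ + 1ℚ + 1ℚ) * η                       <⟨ 3η<ε ⟩
      ε                                        ∎)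
    separate η 0<η 3η<ε N close (no large) = inj₂ (η , 0<η , N , λ n N≤n → let open ℚ.≤-Reasoning in begin
      η                                                  ≡⟨ solve 1 (λ η → η := η :+ η :- η) ≡.refl η ⟩
      η + η - η                                          ≤⟨ ℚ.+-mono-≤ (ℚ.≮⇒≥ large) (ℚ.neg-antimono-≤ (ℚ.<⇒≤ (close N n ℕ.≤-refl N≤n))) ⟩
      ∣ seq x N ∣ - ∣ seq x N - seq x n ∣                ≤⟨ ℚ.+-monoˡ-≤ (- ∣ seq x N - seq x n ∣) (begin
        ∣ seq x N ∣                                          ≡⟨ ≡.cong ∣_∣ (solve 2 (λ a b → a := b :+ (a :- b)) ≡.refl (seq x N) (seq x n)) ⟩
        ∣ seq x n + (seq x N - seq x n) ∣                    ≤⟨ ℚ.∣p+q∣≤∣p∣+∣q∣ (seq x n) (seq x N - seq x n) ⟩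
        ∣ seq x n ∣ + ∣ seq x N - seq x n ∣                  ∎) ⟩
      ∣ seq x n ∣ + ∣ seq x N - seq x n ∣ - ∣ seq x N - seq x n ∣  ≡⟨ solve 2 (λ a b → a :+ b :- b := a) ≡.refl ∣ seq x n ∣ ∣ seq x N - seq x n ∣ ⟩
      ∣ seq x n ∣                                        ∎)

  -- Each ε is settled separately by `near-or-far`; the far alternative is refuted by the
  -- hypothesis.
  Null-stable : ∀ x → ¬ ¬ Null (seq x) → Null (seq x)
  Null-stable x ¬¬null ε 0<ε =
    [ id , (λ far → contradiction (boundedAway⇒¬Null far) ¬¬null) ]′ (near-or-far x ε 0<ε)

  -- If x were bounded away from 0, division by that bound would make y null. So if y is not null,
  -- `near-or-far` answers near for every ε and x is null, against the hypothesis; stability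
  -- concludes.
  Null-cancel : ∀ x y → Null (λ n → seq x n * seq y n) → ¬ Null (seq x) → Null (seq y)
  Null-cancel x y xy-null ¬x-null = Null-stable y λ ¬y-null → ¬x-null λ ε 0<ε → null-x ¬y-null ε 0<ε
    where
    far⇒ : BoundedAway (seq x) → Null (seq y)
    far⇒ (δ , 0<δ , M , far) ε 0<ε = let N , near = xy-null (δ * ε) (*-pos 0<δ 0<ε) in
      M ℕ.⊔ N , λ n M⊔N≤n → ℚ.*-cancelˡ-<-nonNeg δ {{ℚ.nonNegative (ℚ.<⇒≤ 0<δ)}} (let open ℚ.≤-Reasoning in begin-strict
        δ * ∣ seq y n ∣                 ≤⟨ *-monoʳ-≤ (ℚ.0≤∣p∣ (seq y n)) (far n (≤-max₁ {M} {N} M⊔N≤n)) ⟩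
        ∣ seq x n ∣ * ∣ seq y n ∣       ≡⟨ ℚ.∣p*q∣≡∣p∣*∣q∣ (seq x n) (seq y n) ⟨
        ∣ seq x n * seq y n ∣           <⟨ near n (≤-max₂ {M} {N} M⊔N≤n) ⟩
        δ * ε                           ∎)
    null-x : ¬ Null (seq y) → Null (seq x)
    null-x ¬y-null ε 0<ε = [ id , (λ far → contradiction (far⇒ far) ¬y-null) ]′ (near-or-far x ε 0<ε)

  Null-square : ∀ x → Null (λ n → seq x n * seq x n) → Null (seq x)
  Null-square x p = Null-stable x λ ¬x-null → ¬x-null (Null-cancel x x p ¬x-null)

  0≤q*q : ∀ q → 0ℚ ≤ q * q
  0≤q*q q = ≡.subst (0ℚ ≤_) (∣q∣*∣q∣ q) (*-nonNeg (ℚ.0≤∣p∣ q) (ℚ.0≤∣p∣ q))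
    where
    ∣q∣*∣q∣ : ∀ q → ∣ q ∣ * ∣ q ∣ ≡ q * q
    ∣q∣*∣q∣ q with ℚ.∣p∣≡p∨∣p∣≡-p q
    ... | inj₁ eq = ≡.cong₂ _*_ eq eq
    ... | inj₂ eq = ≡.trans (≡.cong₂ _*_ eq eq) (solve 1 (λ q → :- q :* :- q := q :* q) ≡.refl q)

  Null-sum-of-squares : ∀ x y → Null (λ n → seq x n * seq x n + seq y n * seq y n) → Null (seq x)
  Null-sum-of-squares x y p = Null-square x (Null-dominated 1ℚ 0≤1 (0 , λ n _ → let open ℚ.≤-Reasoning in begin
    ∣ seq x n * seq x n ∣                            ≡⟨ ℚ.0≤p⇒∣p∣≡p (0≤q*q (seq x n)) ⟩
    seq x n * seq x n                                ≤⟨ p≤p+q (0≤q*q (seq y n)) ⟩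
    seq x n * seq x n + seq y n * seq y n            ≡⟨ ℚ.0≤p⇒∣p∣≡p (+-nonNeg (0≤q*q (seq x n)) (0≤q*q (seq y n))) ⟨
    ∣ seq x n * seq x n + seq y n * seq y n ∣        ≡⟨ ℚ.*-identityˡ _ ⟨
    1ℚ * ∣ seq x n * seq x n + seq y n * seq y n ∣   ∎) p)

  module ℂ-Raw = Algebra.Bundles.RawRing ℂ-rawRing

  ℂ-pointwise : ∀ z w → (∀ n → seq (re z) n ≡ seq (re w) n) → (∀ n → seq (im z) n ≡ seq (im w) n) → z ℂ-Raw.≈ w
  ℂ-pointwise z w p q = pointwise (re z) (re w) p , pointwise (im z) (im w) q

  ℂ-commutativeRing : CommutativeRing 0ℓ 0ℓ
  ℂ-commutativeRing = record
    { Carrier = ℂ ; _≈_ = ℂ-Raw._≈_ ; _+_ = ℂ-Raw._+_ ; _*_ = ℂ-Raw._*_ ; -_ = ℂ-Raw.-_ ; 0# = ℂ-Raw.0# ; 1# = ℂ-Raw.1#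
    ; isCommutativeRing = record
      { isRing = record
        { +-isAbelianGroup = record
          { isGroup = record
            { isMonoid = record
              { isSemigroup = record
                { isMagma = record
                  { isEquivalence = record
                    { refl  = λ {z} → ≈-refl (re z) , ≈-refl (im z)
                    ; sym   = λ {z} {w} (p , q) → ≈-sym (re z) (re w) p , ≈-sym (im z) (im w) q
                    ; trans = λ {z} {w} {v} (p , q) (p′ , q′) →
                        ≈-trans (re z) (re w) (re v) p p′ , ≈-trans (im z) (im w) (im v) q q′
                    }
                  ; ∙-cong = λ {z} {z′} {w} {w′} (p , q) (p′ , q′) →
                      +ᴿ-cong (re z) (re z′) (re w) (re w′) p p′ , +ᴿ-cong (im z) (im z′) (im w) (im w′) q q′
                  }
                ; assoc = λ u v w → ℂ-pointwise ((u ℂ-Raw.+ v) ℂ-Raw.+ w) (u ℂ-Raw.+ (v ℂ-Raw.+ w))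
                    (λ n → ℚ.+-assoc (seq (re u) n) (seq (re v) n) (seq (re w) n))
                    (λ n → ℚ.+-assoc (seq (im u) n) (seq (im v) n) (seq (im w) n))
                }
              ; identity = (λ z → ℂ-pointwise (ℂ-Raw.0# ℂ-Raw.+ z) z (λ n → ℚ.+-identityˡ _) (λ n → ℚ.+-identityˡ _))
                         , (λ z → ℂ-pointwise (z ℂ-Raw.+ ℂ-Raw.0#) z (λ n → ℚ.+-identityʳ _) (λ n → ℚ.+-identityʳ _))
              }
            ; inverse = (λ z → ℂ-pointwise ((ℂ-Raw.- z) ℂ-Raw.+ z) ℂ-Raw.0# (λ n → ℚ.+-inverseˡ (seq (re z) n)) (λ n → ℚ.+-inverseˡ (seq (im z) n)))
                      , (λ z → ℂ-pointwise (z ℂ-Raw.+ (ℂ-Raw.- z)) ℂ-Raw.0# (λ n → ℚ.+-inverseʳ (seq (re z) n)) (λ n → ℚ.+-inverseʳ (seq (im z) n)))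
            ; ⁻¹-cong = λ {z} {w} (p , q) → -ᴿ-cong (re z) (re w) p , -ᴿ-cong (im z) (im w) q
            }
          ; comm = λ z w → ℂ-pointwise (z ℂ-Raw.+ w) (w ℂ-Raw.+ z)
              (λ n → ℚ.+-comm (seq (re z) n) (seq (re w) n)) (λ n → ℚ.+-comm (seq (im z) n) (seq (im w) n))
          }
        ; *-cong = λ {z} {z′} {w} {w′} (p , q) (p′ , q′) →
              +ᴿ-cong (re z *ᴿ re w) (re z′ *ᴿ re w′) (-ᴿ (im z *ᴿ im w)) (-ᴿ (im z′ *ᴿ im w′))
                (*ᴿ-cong (re z) (re z′) (re w) (re w′) p p′)
                (-ᴿ-cong (im z *ᴿ im w) (im z′ *ᴿ im w′) (*ᴿ-cong (im z) (im z′) (im w) (im w′) q q′))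
            , +ᴿ-cong (re z *ᴿ im w) (re z′ *ᴿ im w′) (im z *ᴿ re w) (im z′ *ᴿ re w′)
                (*ᴿ-cong (re z) (re z′) (im w) (im w′) p q′) (*ᴿ-cong (im z) (im z′) (re w) (re w′) q p′)
        ; *-assoc = λ u v w → ℂ-pointwise ((u ℂ-Raw.* v) ℂ-Raw.* w) (u ℂ-Raw.* (v ℂ-Raw.* w))
            (λ n → solve 6 (λ a b c d e f → (a :* c :- b :* d) :* e :- (a :* d :+ b :* c) :* f
                                         := a :* (c :* e :- d :* f) :- b :* (c :* f :+ d :* e)) ≡.refl
               (seq (re u) n) (seq (im u) n) (seq (re v) n) (seq (im v) n) (seq (re w) n) (seq (im w) n))
            (λ n → solve 6 (λ a b c d e f → (a :* c :- b :* d) :* f :+ (a :* d :+ b :* c) :* e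
                                         := a :* (c :* f :+ d :* e) :+ b :* (c :* e :- d :* f)) ≡.refl
               (seq (re u) n) (seq (im u) n) (seq (re v) n) (seq (im v) n) (seq (re w) n) (seq (im w) n))
        ; *-identity = *-identityˡ′ , λ z → ≈ℂ-trans (z ℂ-Raw.* ℂ-Raw.1#) (ℂ-Raw.1# ℂ-Raw.* z) z (*-comm′ z ℂ-Raw.1#) (*-identityˡ′ z)
        ; distrib = distribˡ′ , λ u v w → ≈ℂ-trans ((v ℂ-Raw.+ w) ℂ-Raw.* u) (u ℂ-Raw.* (v ℂ-Raw.+ w)) ((v ℂ-Raw.* u) ℂ-Raw.+ (w ℂ-Raw.* u))
            (*-comm′ (v ℂ-Raw.+ w) u)
            (≈ℂ-trans (u ℂ-Raw.* (v ℂ-Raw.+ w)) ((u ℂ-Raw.* v) ℂ-Raw.+ (u ℂ-Raw.* w)) ((v ℂ-Raw.* u) ℂ-Raw.+ (w ℂ-Raw.* u))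
              (distribˡ′ u v w)
              (+ᴿ-cong (re (u ℂ-Raw.* v)) (re (v ℂ-Raw.* u)) (re (u ℂ-Raw.* w)) (re (w ℂ-Raw.* u)) (proj₁ (*-comm′ u v)) (proj₁ (*-comm′ u w))
              , +ᴿ-cong (im (u ℂ-Raw.* v)) (im (v ℂ-Raw.* u)) (im (u ℂ-Raw.* w)) (im (w ℂ-Raw.* u)) (proj₂ (*-comm′ u v)) (proj₂ (*-comm′ u w))))
        }
      ; *-comm = *-comm′
      }
    }
    where
    ≈ℂ-trans : ∀ u v w → u ℂ-Raw.≈ v → v ℂ-Raw.≈ w → u ℂ-Raw.≈ w
    ≈ℂ-trans u v w (p , q) (p′ , q′) = ≈-trans (re u) (re v) (re w) p p′ , ≈-trans (im u) (im v) (im w) q q′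
    *-comm′ : ∀ z w → z ℂ-Raw.* w ℂ-Raw.≈ w ℂ-Raw.* z
    *-comm′ z w = ℂ-pointwise (z ℂ-Raw.* w) (w ℂ-Raw.* z)
      (λ n → solve 4 (λ a b c d → a :* c :- b :* d := c :* a :- d :* b) ≡.refl (seq (re z) n) (seq (im z) n) (seq (re w) n) (seq (im w) n))
      (λ n → solve 4 (λ a b c d → a :* d :+ b :* c := c :* b :+ d :* a) ≡.refl (seq (re z) n) (seq (im z) n) (seq (re w) n) (seq (im w) n))
    *-identityˡ′ : ∀ z → ℂ-Raw.1# ℂ-Raw.* z ℂ-Raw.≈ z
    *-identityˡ′ z = ℂ-pointwise (ℂ-Raw.1# ℂ-Raw.* z) z
      (λ n → solve 2 (λ a b → con 1ℚ :* a :- con 0ℚ :* b := a) ≡.refl (seq (re z) n) (seq (im z) n))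
      (λ n → solve 2 (λ a b → con 1ℚ :* b :+ con 0ℚ :* a := b) ≡.refl (seq (re z) n) (seq (im z) n))
    distribˡ′ : ∀ u v w → u ℂ-Raw.* (v ℂ-Raw.+ w) ℂ-Raw.≈ (u ℂ-Raw.* v) ℂ-Raw.+ (u ℂ-Raw.* w)
    distribˡ′ u v w = ℂ-pointwise (u ℂ-Raw.* (v ℂ-Raw.+ w)) ((u ℂ-Raw.* v) ℂ-Raw.+ (u ℂ-Raw.* w))
      (λ n → solve 6 (λ a b c d e f → a :* (c :+ e) :- b :* (d :+ f) := (a :* c :- b :* d) :+ (a :* e :- b :* f)) ≡.refl
         (seq (re u) n) (seq (im u) n) (seq (re v) n) (seq (im v) n) (seq (re w) n) (seq (im w) n))
      (λ n → solve 6 (λ a b c d e f → a :* (d :+ f) :+ b :* (c :+ e) := (a :* d :+ b :* c) :+ (a :* f :+ b :* e)) ≡.refl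
         (seq (re u) n) (seq (im u) n) (seq (re v) n) (seq (im v) n) (seq (re w) n) (seq (im w) n))

  ℂ-isStableDomain : IsStableDomain ℂ-commutativeRing
  ℂ-isStableDomain = record
    { 1≉0    = λ (p , _) → Null-constant {1ℚ} p ℚ.≤-refl
    ; cancel = λ {z} {w} zw≈0 z≉0 → cancel z w zw≈0 z≉0
    ; stable = λ {z} ¬¬z≈0 →
          Null⇒≈0 (re z) (Null-stable (re z) λ ¬null → ¬¬z≈0 λ (p , _) → ¬null (≈0⇒Null (re z) p))
        , Null⇒≈0 (im z) (Null-stable (im z) λ ¬null → ¬¬z≈0 λ (_ , q) → ¬null (≈0⇒Null (im z) q))
    }
    where
    -- Multiplies z w by the conjugate of z.
    cancel : ∀ z w → z ℂ-Raw.* w ℂ-Raw.≈ ℂ-Raw.0# → ¬ z ℂ-Raw.≈ ℂ-Raw.0# → w ℂ-Raw.≈ ℂ-Raw.0#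
    cancel z w (p , q) z≉0 =
        Null⇒≈0 c (Null-cancel N c (Null-cong
          (λ n → solve 4 (λ a b c d → a :* (a :* c :- b :* d) :+ b :* (a :* d :+ b :* c) := (a :* a :+ b :* b) :* c) ≡.refl
            (seq a n) (seq b n) (seq c n) (seq d n))
          (Null-+ (Null-* a p′) (Null-* b q′))) ¬N)
      , Null⇒≈0 d (Null-cancel N d (Null-cong
          (λ n → solve 4 (λ a b c d → a :* (a :* d :+ b :* c) :- b :* (a :* c :- b :* d) := (a :* a :+ b :* b) :* d) ≡.refl
            (seq a n) (seq b n) (seq c n) (seq d n))
          (Null-+ (Null-* a q′) (Null-neg (Null-* b p′)))) ¬N)
      where
      a = re z
      b = im z
      c = re w
      d = im w
      N = a *ᴿ a +ᴿ b *ᴿ b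
      p′ = ≈0⇒Null (a *ᴿ c +ᴿ (-ᴿ (b *ᴿ d))) p
      q′ = ≈0⇒Null (a *ᴿ d +ᴿ b *ᴿ c) q
      ¬N : ¬ Null (seq N)
      ¬N null = z≉0 (Null⇒≈0 a (Null-sum-of-squares a b null)
                   , Null⇒≈0 b (Null-sum-of-squares b a (Null-cong (λ n → ℚ.+-comm (seq a n * seq a n) (seq b n * seq b n)) null)))

  -- The image of n has the constant sequence n as its real part, which is not null for n ≥ 1.
  ℂ-characteristic : ∀ i → IntegerHom.ι (integerHom ℂ-commutativeRing) i ℂ-Raw.≈ ℂ-Raw.0# → i ≡ 0ℤ
  ℂ-characteristic i (ι≈0 , _) = go i (≈0⇒Null (re (IntegerHom.ι (integerHom ℂ-commutativeRing) i)) ι≈0)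
    where
    n·1 : ∀ n m → seq (re (IntegerHom.ι (integerHom ℂ-commutativeRing) (+ n))) m ≡ fromℕ n
    n·1 zero    m = ≡.refl
    n·1 (suc n) m = ≡.trans (≡.cong (_+_ 1ℚ) (n·1 n m)) (≡.sym (fromℕ-suc n))
    large : ∀ n → ¬ Null (seq (re (IntegerHom.ι (integerHom ℂ-commutativeRing) (+ suc n))))
    large n null = Null-constant {fromℕ (suc n)} (Null-cong (n·1 (suc n)) null)
      (≡.subst (1ℚ ≤_) (≡.sym (ℚ.0≤p⇒∣p∣≡p {fromℕ (suc n)} (0≤fromℕ (suc n)))) (fromℕ-mono {1} {suc n} (ℕ.s≤s ℕ.z≤n)))
    go : ∀ i → Null (seq (re (IntegerHom.ι (integerHom ℂ-commutativeRing) i))) → i ≡ 0ℤ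
    go (+ zero)  null = ≡.refl
    go (+ suc n) null = contradiction null (large n)
    go -[1+ n ]  null = contradiction (Null-cong (λ m → solve 1 (λ q → :- :- q := q) ≡.refl (seq (re (IntegerHom.ι (integerHom ℂ-commutativeRing) (+ suc n))) m)) (Null-neg null)) (large n)

  -- Cauchy products and the addition theorem for the exponential.

  ∑-head : ∀ n g → ∑ (suc n) g ≡ g 0 + ∑ n (g ∘ suc)
  ∑-head zero    g = ≡.refl
  ∑-head (suc n) g = ≡.trans (≡.cong (_+_ (g (suc n))) (∑-head n g))
    (solve 3 (λ a b c → a :+ (b :+ c) := b :+ (a :+ c)) ≡.refl (g (suc n)) (g 0) (∑ n (g ∘ suc)))

  ∑-mono : ∀ n {g h} → (∀ r → r ℕ.< n → g r ≤ h r) → ∑ n g ≤ ∑ n h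
  ∑-mono zero    g≤h = ℚ.≤-refl
  ∑-mono (suc n) g≤h = ℚ.+-mono-≤ (g≤h n (ℕ.n<1+n n)) (∑-mono n λ r r<n → g≤h r (ℕ.<-trans r<n (ℕ.n<1+n n)))

  ∑-nonNeg : ∀ n {g} → (∀ r → 0ℚ ≤ g r) → 0ℚ ≤ ∑ n g
  ∑-nonNeg zero    0≤g = ℚ.≤-refl
  ∑-nonNeg (suc n) 0≤g = +-nonNeg (0≤g n) (∑-nonNeg n 0≤g)

  ∣∑∣≤ : ∀ n {g h} → (∀ r → r ℕ.< n → ∣ g r ∣ ≤ h r) → ∣ ∑ n g ∣ ≤ ∑ n h
  ∣∑∣≤ zero    ∣g∣≤h = ℚ.≤-refl
  ∣∑∣≤ (suc n) {g} ∣g∣≤h = ℚ.≤-trans (ℚ.∣p+q∣≤∣p∣+∣q∣ (g n) (∑ n g))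
    (ℚ.+-mono-≤ (∣g∣≤h n (ℕ.n<1+n n)) (∣∑∣≤ n λ r r<n → ∣g∣≤h r (ℕ.<-trans r<n (ℕ.n<1+n n))))

  ∑-growth : ∀ n d {g} → (∀ r → 0ℚ ≤ g r) → ∑ n g ≤ ∑ (d ℕ.+ n) g
  ∑-growth n zero    0≤g = ℚ.≤-refl
  ∑-growth n (suc d) 0≤g = ℚ.≤-trans (∑-growth n d 0≤g) (p≤q+p (0≤g (d ℕ.+ n)))

  ∑-growth-≤ : ∀ {m n} {g} → (∀ r → 0ℚ ≤ g r) → m ℕ.≤ n → ∑ m g ≤ ∑ n g
  ∑-growth-≤ {m} {n} {g} 0≤g m≤n = ≡.subst (λ z → ∑ m g ≤ ∑ z g) (ℕ.m∸n+n≡m m≤n) (∑-growth m (n ℕ.∸ m) 0≤g)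

  ∣∑-∑∣≤ : ∀ m d {g h} → (∀ r → ∣ g r ∣ ≤ h r) → ∣ ∑ (d ℕ.+ m) g - ∑ m g ∣ ≤ ∑ (d ℕ.+ m) h - ∑ m h
  ∣∑-∑∣≤ m zero    {g} {h} ∣g∣≤h = ℚ.≤-reflexive
    (≡.trans (≡.cong ∣_∣ (ℚ.+-inverseʳ (∑ m g))) (≡.sym (ℚ.+-inverseʳ (∑ m h))))
  ∣∑-∑∣≤ m (suc d) {g} {h} ∣g∣≤h = begin
    ∣ g n + ∑ n g - ∑ m g ∣          ≡⟨ ≡.cong ∣_∣ (ℚ.+-assoc (g n) (∑ n g) (- ∑ m g)) ⟩
    ∣ g n + (∑ n g - ∑ m g) ∣        ≤⟨ ℚ.∣p+q∣≤∣p∣+∣q∣ (g n) (∑ n g - ∑ m g) ⟩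
    ∣ g n ∣ + ∣ ∑ n g - ∑ m g ∣      ≤⟨ ℚ.+-mono-≤ (∣g∣≤h n) (∣∑-∑∣≤ m d ∣g∣≤h) ⟩
    h n + (∑ n h - ∑ m h)            ≡⟨ ℚ.+-assoc (h n) (∑ n h) (- ∑ m h) ⟨
    h n + ∑ n h - ∑ m h              ∎
    where
    open ℚ.≤-Reasoning
    n = d ℕ.+ m

  convolution : (ℕ → ℚ) → (ℕ → ℚ) → ℕ → ℚ
  convolution a b m = ∑ (suc m) λ j → a j * b (m ℕ.∸ j)

  -- The sum of a i · b j over i + j < n by antidiagonals: a partial sum of the Cauchy product.
  -- `triangle-rows` groups the same terms by i.
  triangle : (ℕ → ℚ) → (ℕ → ℚ) → ℕ → ℚ
  triangle a b n = ∑ n (convolution a b)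

  triangle-rows : ∀ a b n → triangle a b n ≡ ∑ n (λ i → a i * ∑ (n ℕ.∸ i) b)
  triangle-rows a b zero    = ≡.refl
  triangle-rows a b (suc n) = begin
    a n * b (n ℕ.∸ n) + ∑ n (λ j → a j * b (n ℕ.∸ j)) + triangle a b n
      ≡⟨ ≡.cong₂ _+_ (≡.cong (λ z → a n * b z + ∑ n (λ j → a j * b (n ℕ.∸ j))) (ℕ.n∸n≡0 n)) (triangle-rows a b n) ⟩
    a n * b 0 + ∑ n (λ j → a j * b (n ℕ.∸ j)) + ∑ n (λ i → a i * ∑ (n ℕ.∸ i) b)
      ≡⟨ ℚ.+-assoc (a n * b 0) (∑ n (λ j → a j * b (n ℕ.∸ j))) (∑ n (λ i → a i * ∑ (n ℕ.∸ i) b)) ⟩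
    a n * b 0 + (∑ n (λ j → a j * b (n ℕ.∸ j)) + ∑ n (λ i → a i * ∑ (n ℕ.∸ i) b))
      ≡⟨ ≡.cong₂ _+_ (≡.cong (a n *_) (≡.sym (ℚ.+-identityʳ (b 0)))) (≡.sym (∑-+ n (λ j → a j * b (n ℕ.∸ j)) (λ i → a i * ∑ (n ℕ.∸ i) b))) ⟩
    a n * ∑ 1 b + ∑ n (λ i → a i * b (n ℕ.∸ i) + a i * ∑ (n ℕ.∸ i) b)
      ≡⟨ ≡.cong₂ _+_ (≡.cong (λ z → a n * ∑ z b) (≡.sym (ℕ.m+n∸n≡m 1 n))) (∑-cong n row) ⟩
    a n * ∑ (suc n ℕ.∸ n) b + ∑ n (λ i → a i * ∑ (suc n ℕ.∸ i) b) ∎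
    where
    open ≡.≡-Reasoning
    row : ∀ i → i ℕ.< n → a i * b (n ℕ.∸ i) + a i * ∑ (n ℕ.∸ i) b ≡ a i * ∑ (suc n ℕ.∸ i) b
    row i i<n = ≡.trans (≡.sym (ℚ.*-distribˡ-+ (a i) (b (n ℕ.∸ i)) (∑ (n ℕ.∸ i) b)))
      (≡.cong (λ z → a i * ∑ z b) (≡.sym (ℕ.+-∸-assoc 1 (ℕ.<⇒≤ i<n))))

  -- What remains are the terms with i, j < n and i + j ≥ n, collected by rows.
  square-triangle : ∀ a b n → ∑ n a * ∑ n b - triangle a b n ≡ ∑ n (λ i → a i * (∑ n b - ∑ (n ℕ.∸ i) b))
  square-triangle a b n = begin
    ∑ n a * ∑ n b - triangle a b n
      ≡⟨ ≡.cong₂ _-_ (≡.trans (ℚ.*-comm (∑ n a) (∑ n b)) (≡.sym (∑-*ˡ n (∑ n b) a))) (triangle-rows a b n) ⟩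
    ∑ n (λ i → ∑ n b * a i) - ∑ n (λ i → a i * ∑ (n ℕ.∸ i) b)
      ≡⟨ ≡.cong (_+_ (∑ n (λ i → ∑ n b * a i))) (≡.trans (negate (∑ n c)) (≡.sym (∑-*ˡ n (- 1ℚ) c))) ⟩
    ∑ n (λ i → ∑ n b * a i) + ∑ n (λ i → - 1ℚ * c i)
      ≡⟨ ∑-+ n (λ i → ∑ n b * a i) (λ i → - 1ℚ * c i) ⟨
    ∑ n (λ i → ∑ n b * a i + - 1ℚ * c i)
      ≡⟨ ∑-cong n (λ i _ → regroup (∑ n b) (a i) (∑ (n ℕ.∸ i) b)) ⟩
    ∑ n (λ i → a i * (∑ n b - ∑ (n ℕ.∸ i) b)) ∎
    where
    open ≡.≡-Reasoning
    c : ℕ → ℚ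
    c i = a i * ∑ (n ℕ.∸ i) b
    negate : ∀ q → - q ≡ - 1ℚ * q
    negate = solve 1 (λ q → :- q := (:- con 1ℚ) :* q) ≡.refl
    regroup : ∀ B a C → B * a + - 1ℚ * (a * C) ≡ a * (B - C)
    regroup = solve 3 (λ B a C → B :* a :+ (:- con 1ℚ) :* (a :* C) := a :* (B :- C)) ≡.refl

  ∣square-triangle∣≤ : ∀ {a b t} → (∀ r → 0ℚ ≤ t r) → (∀ r → ∣ a r ∣ ≤ t r) → (∀ r → ∣ b r ∣ ≤ t r) → ∀ n →
    ∣ ∑ n a * ∑ n b - triangle a b n ∣ ≤ ∑ n t * ∑ n t - triangle t t n
  ∣square-triangle∣≤ {a} {b} {t} 0≤t a≤t b≤t n = begin
    ∣ ∑ n a * ∑ n b - triangle a b n ∣                     ≡⟨ ≡.cong ∣_∣ (square-triangle a b n) ⟩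
    ∣ ∑ n (λ i → a i * (∑ n b - ∑ (n ℕ.∸ i) b)) ∣          ≤⟨ ∣∑∣≤ n row ⟩
    ∑ n (λ i → t i * (∑ n t - ∑ (n ℕ.∸ i) t))              ≡⟨ square-triangle t t n ⟨
    ∑ n t * ∑ n t - triangle t t n                         ∎
    where
    open ℚ.≤-Reasoning
    row : ∀ i → i ℕ.< n → ∣ a i * (∑ n b - ∑ (n ℕ.∸ i) b) ∣ ≤ t i * (∑ n t - ∑ (n ℕ.∸ i) t)
    row i i<n = ℚ.≤-trans (ℚ.≤-reflexive (ℚ.∣p*q∣≡∣p∣*∣q∣ (a i) (∑ n b - ∑ (n ℕ.∸ i) b)))
      (*-mono-≤ (ℚ.0≤∣p∣ (a i)) (a≤t i) (ℚ.0≤∣p∣ (∑ n b - ∑ (n ℕ.∸ i) b))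
        (≡.subst (λ z → ∣ ∑ z b - ∑ (n ℕ.∸ i) b ∣ ≤ ∑ z t - ∑ (n ℕ.∸ i) t) (ℕ.m+[n∸m]≡n (ℕ.<⇒≤ i<n))
          (∣∑-∑∣≤ (n ℕ.∸ i) i b≤t)))

  -- The square i, j < n is contained in the triangle i + j < 2n, and no term is negative.
  square≤triangle : ∀ {t} → (∀ r → 0ℚ ≤ t r) → ∀ n → ∑ n t * ∑ n t ≤ triangle t t (n ℕ.+ n)
  square≤triangle {t} 0≤t n = begin
    ∑ n t * ∑ n t                                      ≡⟨ ∑-*ˡ n (∑ n t) t ⟨
    ∑ n (λ i → ∑ n t * t i)                            ≡⟨ ∑-cong n (λ i _ → ℚ.*-comm (∑ n t) (t i)) ⟩
    ∑ n (λ i → t i * ∑ n t)                            ≤⟨ ∑-mono n (λ i i<n → *-monoˡ-≤ (0≤t i) (∑-growth-≤ 0≤t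
                                                            (≡.subst (n ℕ.≤_) (≡.sym (ℕ.+-∸-assoc n (ℕ.<⇒≤ i<n))) (ℕ.m≤m+n n _)))) ⟩
    ∑ n (λ i → t i * ∑ (n ℕ.+ n ℕ.∸ i) t)              ≤⟨ ∑-growth-≤ (λ i → *-nonNeg (0≤t i) (∑-nonNeg (n ℕ.+ n ℕ.∸ i) 0≤t)) (ℕ.m≤m+n n n) ⟩
    ∑ (n ℕ.+ n) (λ i → t i * ∑ (n ℕ.+ n ℕ.∸ i) t)      ≡⟨ triangle-rows t t (n ℕ.+ n) ⟨
    triangle t t (n ℕ.+ n)                             ∎
    where open ℚ.≤-Reasoning

  expTerm-suc : ∀ n x → fromℕ (suc n) * expTerm (suc n) x ≡ x * expTerm n x
  expTerm-suc n x = begin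
    fromℕ (suc n) * (expTerm n x * x * recip n)    ≡⟨ solve 4 (λ f e x r → f :* (e :* x :* r) := (f :* r) :* (x :* e)) ≡.refl (fromℕ (suc n)) (expTerm n x) x (recip n) ⟩
    fromℕ (suc n) * recip n * (x * expTerm n x)    ≡⟨ ≡.cong (_* (x * expTerm n x)) (fromℕ*recip n) ⟩
    1ℚ * (x * expTerm n x)                         ≡⟨ ℚ.*-identityˡ (x * expTerm n x) ⟩
    x * expTerm n x                                ∎
    where open ≡.≡-Reasoning

  fromℕ-+ : ∀ m n → fromℕ (m ℕ.+ n) ≡ fromℕ m + fromℕ n
  fromℕ-+ zero    n = ≡.sym (ℚ.+-identityˡ (fromℕ n))
  fromℕ-+ (suc m) n = begin
    fromℕ (suc (m ℕ.+ n))          ≡⟨ fromℕ-suc (m ℕ.+ n) ⟩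
    1ℚ + fromℕ (m ℕ.+ n)           ≡⟨ ≡.cong (_+_ 1ℚ) (fromℕ-+ m n) ⟩
    1ℚ + (fromℕ m + fromℕ n)       ≡⟨ ℚ.+-assoc 1ℚ (fromℕ m) (fromℕ n) ⟨
    1ℚ + fromℕ m + fromℕ n         ≡⟨ ≡.cong (_+ fromℕ n) (fromℕ-suc m) ⟨
    fromℕ (suc m) + fromℕ n        ∎
    where open ≡.≡-Reasoning

  -- Splits m + 1 = j + (m + 1 − j) in each term.
  convolution-derivative : ∀ x y m → let e = λ z j → expTerm j z in
    fromℕ (suc m) * convolution (e x) (e y) (suc m) ≡ (x + y) * convolution (e x) (e y) m
  convolution-derivative x y m = begin
    fromℕ (suc m) * convolution a b (suc m)
      ≡⟨ ∑-*ˡ (suc (suc m)) (fromℕ (suc m)) (λ j → a j * b (suc m ℕ.∸ j)) ⟨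
    ∑ (suc (suc m)) (λ j → fromℕ (suc m) * (a j * b (suc m ℕ.∸ j)))
      ≡⟨ ∑-cong (suc (suc m)) (λ j j<m+2 → split j (ℕ.≤-pred j<m+2)) ⟩
    ∑ (suc (suc m)) (λ j → p j + q j)
      ≡⟨ ∑-+ (suc (suc m)) p q ⟩
    ∑ (suc (suc m)) p + ∑ (suc (suc m)) q
      ≡⟨ ≡.cong₂ _+_ left right ⟩
    x * convolution a b m + y * convolution a b m
      ≡⟨ ℚ.*-distribʳ-+ (convolution a b m) x y ⟨
    (x + y) * convolution a b m ∎
    where
    open ≡.≡-Reasoning
    a b p q : ℕ → ℚ
    a j = expTerm j x
    b j = expTerm j y
    p j = fromℕ j * a j * b (suc m ℕ.∸ j)
    q j = a j * (fromℕ (suc m ℕ.∸ j) * b (suc m ℕ.∸ j))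
    split : ∀ j → j ℕ.≤ suc m → fromℕ (suc m) * (a j * b (suc m ℕ.∸ j)) ≡ p j + q j
    split j j≤1+m = ≡.trans
      (≡.cong (_* (a j * b (suc m ℕ.∸ j))) (≡.trans (≡.cong fromℕ (≡.sym (ℕ.m+[n∸m]≡n j≤1+m))) (fromℕ-+ j (suc m ℕ.∸ j))))
      (solve 4 (λ f g a b → (f :+ g) :* (a :* b) := f :* a :* b :+ a :* (g :* b)) ≡.refl
        (fromℕ j) (fromℕ (suc m ℕ.∸ j)) (a j) (b (suc m ℕ.∸ j)))
    left : ∑ (suc (suc m)) p ≡ x * convolution a b m
    left = begin
      ∑ (suc (suc m)) p                                    ≡⟨ ∑-head (suc m) p ⟩
      p 0 + ∑ (suc m) (p ∘ suc)                            ≡⟨ ≡.cong₂ _+_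
        (solve 2 (λ a b → con 0ℚ :* a :* b := con 0ℚ) ≡.refl (a 0) (b (suc m)))
        (∑-cong (suc m) λ j _ → ≡.trans (≡.cong (_* b (m ℕ.∸ j)) (expTerm-suc j x)) (ℚ.*-assoc x (a j) (b (m ℕ.∸ j)))) ⟩
      0ℚ + ∑ (suc m) (λ j → x * (a j * b (m ℕ.∸ j)))       ≡⟨ ℚ.+-identityˡ _ ⟩
      ∑ (suc m) (λ j → x * (a j * b (m ℕ.∸ j)))            ≡⟨ ∑-*ˡ (suc m) x (λ j → a j * b (m ℕ.∸ j)) ⟩
      x * convolution a b m                                ∎
    right : ∑ (suc (suc m)) q ≡ y * convolution a b m
    right = begin
      q (suc m) + ∑ (suc m) q                              ≡⟨ ≡.cong₂ _+_
        (≡.trans (≡.cong (λ z → a (suc m) * (fromℕ z * b z)) (ℕ.n∸n≡0 (suc m)))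
          (solve 2 (λ a b → a :* (con 0ℚ :* b) := con 0ℚ) ≡.refl (a (suc m)) (b 0)))
        (∑-cong (suc m) λ j j<1+m → inner j (ℕ.≤-pred j<1+m)) ⟩
      0ℚ + ∑ (suc m) (λ j → y * (a j * b (m ℕ.∸ j)))       ≡⟨ ℚ.+-identityˡ _ ⟩
      ∑ (suc m) (λ j → y * (a j * b (m ℕ.∸ j)))            ≡⟨ ∑-*ˡ (suc m) y (λ j → a j * b (m ℕ.∸ j)) ⟩
      y * convolution a b m                                ∎
      where
      inner : ∀ j → j ℕ.≤ m → q j ≡ y * (a j * b (m ℕ.∸ j))
      inner j j≤m = begin
        a j * (fromℕ (suc m ℕ.∸ j) * b (suc m ℕ.∸ j))       ≡⟨ ≡.cong (λ z → a j * (fromℕ z * b z)) (ℕ.+-∸-assoc 1 j≤m) ⟩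
        a j * (fromℕ (suc (m ℕ.∸ j)) * b (suc (m ℕ.∸ j)))   ≡⟨ ≡.cong (a j *_) (expTerm-suc (m ℕ.∸ j) y) ⟩
        a j * (y * b (m ℕ.∸ j))                             ≡⟨ solve 3 (λ a y b → a :* (y :* b) := y :* (a :* b)) ≡.refl (a j) y (b (m ℕ.∸ j)) ⟩
        y * (a j * b (m ℕ.∸ j))                             ∎

  -- The binomial theorem divided by m !. Both sides start at 1 and satisfy (m + 1) c(m + 1) = (x +
  -- y) c(m).
  convolution-expTerm : ∀ x y m → convolution (λ j → expTerm j x) (λ j → expTerm j y) m ≡ expTerm m (x + y)
  convolution-expTerm x y zero    = ≡.refl
  convolution-expTerm x y (suc m) = begin
    c (suc m)                                    ≡⟨ ℚ.*-identityˡ (c (suc m)) ⟨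
    1ℚ * c (suc m)                               ≡⟨ ≡.cong (_* c (suc m)) (fromℕ*recip m) ⟨
    fromℕ (suc m) * recip m * c (suc m)          ≡⟨ solve 3 (λ f r c → f :* r :* c := f :* c :* r) ≡.refl (fromℕ (suc m)) (recip m) (c (suc m)) ⟩
    fromℕ (suc m) * c (suc m) * recip m          ≡⟨ ≡.cong (_* recip m) (convolution-derivative x y m) ⟩
    (x + y) * c m * recip m                      ≡⟨ ≡.cong (_* recip m) (≡.trans (≡.cong ((x + y) *_) (convolution-expTerm x y m)) (ℚ.*-comm (x + y) (expTerm m (x + y)))) ⟩
    expTerm m (x + y) * (x + y) * recip m        ∎
    where
    open ≡.≡-Reasoning
    c : ℕ → ℚ
    c = convolution (λ j → expTerm j x) (λ j → expTerm j y)

  term : (ℕ → ℚ) → ℚ → ℕ → ℚ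
  term c x j = c j * expTerm j x

  partialSum-∑ : ∀ c n x → partialSum c n x ≡ ∑ n (term c x)
  partialSum-∑ c zero    x = ≡.refl
  partialSum-∑ c (suc n) x = ≡.trans (ℚ.+-comm (partialSum c n x) (term c x n)) (≡.cong (_+_ (term c x n)) (partialSum-∑ c n x))

  -- `cosCoefficient n` and `sinCoefficient n` are the real and imaginary parts of iⁿ; the two rules
  -- express that powers of i multiply by adding exponents.
  cosCoefficient-+ : ∀ i j → cosCoefficient (i ℕ.+ j) ≡ cosCoefficient i * cosCoefficient j - sinCoefficient i * sinCoefficient j
  sinCoefficient-+ : ∀ i j → sinCoefficient (i ℕ.+ j) ≡ cosCoefficient i * sinCoefficient j + sinCoefficient i * cosCoefficient j
  cosCoefficient-+ zero    j = solve 2 (λ c s → c := con 1ℚ :* c :- con 0ℚ :* s) ≡.refl (cosCoefficient j) (sinCoefficient j)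
  cosCoefficient-+ (suc i) j = ≡.trans (≡.cong -_ (sinCoefficient-+ i j))
    (solve 4 (λ c s c′ s′ → :- (c :* s′ :+ s :* c′) := (:- s) :* c′ :- c :* s′) ≡.refl
      (cosCoefficient i) (sinCoefficient i) (cosCoefficient j) (sinCoefficient j))
  sinCoefficient-+ zero    j = solve 2 (λ c s → s := con 1ℚ :* s :+ con 0ℚ :* c) ≡.refl (cosCoefficient j) (sinCoefficient j)
  sinCoefficient-+ (suc i) j = ≡.trans (cosCoefficient-+ i j)
    (solve 4 (λ c s c′ s′ → c :* c′ :- s :* s′ := (:- s) :* s′ :+ c :* c′) ≡.refl
      (cosCoefficient i) (sinCoefficient i) (cosCoefficient j) (sinCoefficient j))

  -- The assumed rule splits each antidiagonal into two convolutions. Four free coefficient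
  -- sequences let one statement serve both cosine and sine.
  triangle-+ : ∀ c a b d f → (∀ i j → c (i ℕ.+ j) ≡ a i * b j + d i * f j) → ∀ n x y →
    ∑ n (term c (x + y)) ≡ triangle (term a x) (term b y) n + triangle (term d x) (term f y) n
  triangle-+ c a b d f c-+ n x y = ≡.trans (∑-cong n λ m _ → row m)
    (∑-+ n (convolution (term a x) (term b y)) (convolution (term d x) (term f y)))
    where
    open ≡.≡-Reasoning
    e : ℚ → ℕ → ℚ
    e z j = expTerm j z
    row : ∀ m → term c (x + y) m ≡ convolution (term a x) (term b y) m + convolution (term d x) (term f y) m
    row m = begin
      c m * expTerm m (x + y)                                        ≡⟨ ≡.cong (c m *_) (convolution-expTerm x y m) ⟨
      c m * convolution (e x) (e y) m                                ≡⟨ ∑-*ˡ (suc m) (c m) (λ j → e x j * e y (m ℕ.∸ j)) ⟨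
      ∑ (suc m) (λ j → c m * (e x j * e y (m ℕ.∸ j)))                ≡⟨ ∑-cong (suc m) (λ j j<1+m → entry j (ℕ.≤-pred j<1+m)) ⟩
      ∑ (suc m) (λ j → term a x j * term b y (m ℕ.∸ j) + term d x j * term f y (m ℕ.∸ j))
        ≡⟨ ∑-+ (suc m) (λ j → term a x j * term b y (m ℕ.∸ j)) (λ j → term d x j * term f y (m ℕ.∸ j)) ⟩
      convolution (term a x) (term b y) m + convolution (term d x) (term f y) m ∎
      where
      entry : ∀ j → j ℕ.≤ m → c m * (e x j * e y (m ℕ.∸ j)) ≡ term a x j * term b y (m ℕ.∸ j) + term d x j * term f y (m ℕ.∸ j)
      entry j j≤m = ≡.trans
        (≡.cong (_* (e x j * e y (m ℕ.∸ j))) (≡.trans (≡.cong c (≡.sym (ℕ.m+[n∸m]≡n j≤m))) (c-+ j (m ℕ.∸ j))))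
        (solve 6 (λ a b d f u v → (a :* b :+ d :* f) :* (u :* v) := a :* u :* (b :* v) :+ d :* u :* (f :* v)) ≡.refl
          (a j) (b (m ℕ.∸ j)) (d j) (f (m ℕ.∸ j)) (e x j) (e y (m ℕ.∸ j)))

  bounded₂ : ∀ x y → ∃[ B ] (0ℚ ≤ B × ∃[ N ] ∀ n → N ℕ.≤ n → ∣ seq x n ∣ ≤ B × ∣ seq y n ∣ ≤ B)
  bounded₂ x y =
    let A , 0≤A , K , a = bounded x
        B , 0≤B , L , b = bounded y
    in A + B , +-nonNeg 0≤A 0≤B , K ℕ.⊔ L , λ n K⊔L≤n →
         ℚ.≤-trans (a n (≤-max₁ {K} {L} K⊔L≤n)) (p≤p+q 0≤B) , ℚ.≤-trans (b n (≤-max₂ {K} {L} K⊔L≤n)) (p≤q+p 0≤A)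

  module Gap {B : ℚ} (0≤B : 0ℚ ≤ B) where

    private
      module B₁ = Bound 0≤B
      module B₂ = Bound (+-nonNeg 0≤B 0≤B)

    T₂-∑ : ∀ n → B₂.T n ≡ triangle B₁.t B₁.t n
    T₂-∑ zero    = ≡.refl
    T₂-∑ (suc n) = ≡.trans (ℚ.+-comm (B₂.T n) (B₂.t n))
      (≡.cong₂ _+_ (≡.sym (convolution-expTerm B B n)) (T₂-∑ n))

    gap : ℕ → ℚ
    gap n = ∑ n B₁.t * ∑ n B₁.t - triangle B₁.t B₁.t n

    -- The square fits into the triangle of size 2n, so the gap is at most the sum of the terms n,
    -- ..., 2n - 1 of the series of exp (B + B), and `U-anti` bounds this tail.
    gap≤ : ∀ n → B₂.M ℕ.≤ n → gap n ≤ B₂.t n + B₂.t n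
    gap≤ n M≤n = begin
      ∑ n B₁.t * ∑ n B₁.t - triangle B₁.t B₁.t n                          ≤⟨ ℚ.+-monoˡ-≤ (- triangle B₁.t B₁.t n) (square≤triangle B₁.0≤t n) ⟩
      triangle B₁.t B₁.t (n ℕ.+ n) - triangle B₁.t B₁.t n                 ≡⟨ ≡.cong₂ _-_ (T₂-∑ (n ℕ.+ n)) (T₂-∑ n) ⟨
      B₂.T (n ℕ.+ n) - B₂.T n                                             ≤⟨ ℚ.+-monoˡ-≤ (- B₂.T n) (ℚ.≤-trans
                                                                               (p≤p+q {B₂.T (n ℕ.+ n)} (+-nonNeg (B₂.0≤t (n ℕ.+ n)) (B₂.0≤t (n ℕ.+ n))))
                                                                               (B₂.U-anti M≤n (ℕ.m≤m+n n n))) ⟩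
      B₂.T n + (B₂.t n + B₂.t n) - B₂.T n                                 ≡⟨ solve 2 (λ a b → a :+ b :- a := b) ≡.refl (B₂.T n) (B₂.t n + B₂.t n) ⟩
      B₂.t n + B₂.t n                                                     ∎
      where open ℚ.≤-Reasoning

    t₂-Null : Null B₂.t
    t₂-Null ε 0<ε =
      let δ , 0<δ , δ<ε = shrink 1ℚ ε 0≤1 0<ε
          N , t≤δ       = B₂.t-small δ 0<δ
      in N , λ n N≤n → ℚ.≤-<-trans
           (ℚ.≤-trans (ℚ.≤-reflexive (ℚ.0≤p⇒∣p∣≡p (B₂.0≤t n))) (ℚ.≤-trans (t≤δ n N≤n) (ℚ.≤-reflexive (≡.sym (ℚ.*-identityˡ δ))))) δ<ε

  -- The arguments `seq x n` and `seq y n` change with n, so an error estimate uniform on [- B, B]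
  -- is required; `gap` supplies it.
  product-Null : ∀ {c d} → (∀ n → ∣ c n ∣ ≤ 1ℚ) → (∀ n → ∣ d n ∣ ≤ 1ℚ) → ∀ x y →
    Null (λ n → ∑ n (term c (seq x n)) * ∑ n (term d (seq y n)) - triangle (term c (seq x n)) (term d (seq y n)) n)
  product-Null {c} {d} c≤1 d≤1 x y =
    let B , 0≤B , N , b = bounded₂ x y
        module B₁ = Bound 0≤B
        module B₂ = Bound (+-nonNeg 0≤B 0≤B)
        open Gap 0≤B
    in Null-dominated (1ℚ + 1ℚ) (+-nonNeg 0≤1 0≤1) (N ℕ.⊔ B₂.M , λ n h → let open ℚ.≤-Reasoning in begin
         _                                 ≤⟨ ∣square-triangle∣≤ B₁.0≤t
                                                (λ r → ℚ.≤-trans (Series.∣c*∣≤ c≤1 0≤B r _) (B₁.term-bound r (proj₁ (b n (≤-max₁ {N} {B₂.M} h)))))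
                                                (λ r → ℚ.≤-trans (Series.∣c*∣≤ d≤1 0≤B r _) (B₁.term-bound r (proj₂ (b n (≤-max₁ {N} {B₂.M} h))))) n ⟩
         gap n                             ≤⟨ gap≤ n (≤-max₂ {N} {B₂.M} h) ⟩
         B₂.t n + B₂.t n                   ≡⟨ solve 1 (λ t → t :+ t := (con 1ℚ :+ con 1ℚ) :* t) ≡.refl (B₂.t n) ⟩
         (1ℚ + 1ℚ) * B₂.t n                ≡⟨ ≡.cong ((1ℚ + 1ℚ) *_) (ℚ.0≤p⇒∣p∣≡p (B₂.0≤t n)) ⟨
         (1ℚ + 1ℚ) * ∣ B₂.t n ∣            ∎) t₂-Null

  exp-+ : ∀ x y → exp[i x +ᴿ y ] ℂ-Raw.≈ exp[i x ] ℂ-Raw.* exp[i y ]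
  exp-+ x y =
      Null-cong (λ n → ≡.trans
        (solve 6 (λ p q r s u v → (:- (p :* q :- u)) :+ (r :* s :- v) := (u :- v) :- (p :* q :- r :* s)) ≡.refl
          (Σ c x n) (Σ c y n) (Σ s x n) (Σ s y n) (tri c c n) (tri s s n))
        (≡.cong₂ _-_ (≡.sym (≡.trans (partialSum-∑ c n _) (≡.trans
            -- The minus sign of the cosine rule is absorbed into the coefficients `-_ ∘ s`, and
            -- `triangle-neg` takes it out again.
            (triangle-+ c c c (-_ ∘ s) s (λ i j → ≡.trans (cosCoefficient-+ i j) (≡.cong (_+_ (c i * c j)) (ℚ.neg-distribˡ-* (s i) (s j)))) n (seq x n) (seq y n))
            (≡.cong (_+_ (tri c c n)) (triangle-neg n)))))
          (≡.sym (≡.cong₂ _-_ (≡.cong₂ _*_ (partialSum-∑ c n (seq x n)) (partialSum-∑ c n (seq y n)))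
                              (≡.cong₂ _*_ (partialSum-∑ s n (seq x n)) (partialSum-∑ s n (seq y n)))))))
        (Null-+ (Null-neg (product-Null ∣cosCoefficient∣≤1 ∣cosCoefficient∣≤1 x y)) (product-Null ∣sinCoefficient∣≤1 ∣sinCoefficient∣≤1 x y))
    , Null-cong (λ n → ≡.trans
        (solve 6 (λ p q r s u v → (:- (p :* q :- u)) :- (r :* s :- v) := (u :+ v) :- (p :* q :+ r :* s)) ≡.refl
          (Σ c x n) (Σ s y n) (Σ s x n) (Σ c y n) (tri c s n) (tri s c n))
        (≡.cong₂ _-_ (≡.sym (≡.trans (partialSum-∑ s n _) (triangle-+ s c s s c sinCoefficient-+ n (seq x n) (seq y n))))
          (≡.sym (≡.cong₂ _+_ (≡.cong₂ _*_ (partialSum-∑ c n (seq x n)) (partialSum-∑ s n (seq y n)))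
                              (≡.cong₂ _*_ (partialSum-∑ s n (seq x n)) (partialSum-∑ c n (seq y n)))))))
        (Null-+ (Null-neg (product-Null ∣cosCoefficient∣≤1 ∣sinCoefficient∣≤1 x y)) (Null-neg (product-Null ∣sinCoefficient∣≤1 ∣cosCoefficient∣≤1 x y)))
    where
    c s : ℕ → ℚ
    c = cosCoefficient
    s = sinCoefficient
    Σ : (ℕ → ℚ) → ℝ → ℕ → ℚ
    Σ a z n = ∑ n (term a (seq z n))
    tri : (ℕ → ℚ) → (ℕ → ℚ) → ℕ → ℚ
    tri a b n = triangle (term a (seq x n)) (term b (seq y n)) n
    negate : ∀ n g → ∑ n (λ j → - g j) ≡ - ∑ n g
    negate zero    g = ≡.refl
    negate (suc n) g = ≡.trans (≡.cong (_+_ (- g n)) (negate n g)) (≡.sym (ℚ.neg-distrib-+ (g n) (∑ n g)))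
    triangle-neg : ∀ n → triangle (term (-_ ∘ s) (seq x n)) (term s (seq y n)) n ≡ - tri s s n
    triangle-neg n = ≡.trans (∑-cong n λ m _ → ≡.trans
        (∑-cong (suc m) λ j _ → solve 3 (λ a e b → (:- a) :* e :* b := :- (a :* e :* b)) ≡.refl
          (s j) (expTerm j (seq x n)) (term s (seq y n) (m ℕ.∸ j)))
        (negate (suc m) (λ j → term s (seq x n) j * term s (seq y n) (m ℕ.∸ j))))
      (negate n (convolution (term s (seq x n)) (term s (seq y n))))

  -- Continuity, parity and the value at 0.

  -- On [- B, B] all late partial sums are Lipschitz with the same constant K.
  sumSeries-cong : ∀ {c} (c≤1 : ∀ n → ∣ c n ∣ ≤ 1ℚ) x y → x ≈ᴿ y → sumSeries c c≤1 x ≈ᴿ sumSeries c c≤1 y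
  sumSeries-cong {c} c≤1 x y x≈y =
    let B , 0≤B , N , b = bounded₂ x y
        module B = Bound 0≤B
    in Null-dominated B.K B.0≤K (N ℕ.⊔ B.M , λ n h →
         ℚ.≤-trans (Series.lipschitz {c} c≤1 0≤B n (proj₁ (b n (≤-max₁ {N} {B.M} h))) (proj₂ (b n (≤-max₁ {N} {B.M} h))))
           (*-monoʳ-≤ (ℚ.0≤∣p∣ (seq x n - seq y n)) (ℚ.≤-trans (B.T′≤T n) (B.T≤K n (≤-max₂ {N} {B.M} h))))) x≈y

  exp-cong : ∀ x y → x ≈ᴿ y → exp[i x ] ℂ-Raw.≈ exp[i y ]
  exp-cong x y x≈y = sumSeries-cong ∣cosCoefficient∣≤1 x y x≈y , sumSeries-cong ∣sinCoefficient∣≤1 x y x≈y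

  cosTerm-even : ∀ n q → cosCoefficient n * expTerm n (- q) ≡ cosCoefficient n * expTerm n q
  sinTerm-odd  : ∀ n q → sinCoefficient n * expTerm n (- q) ≡ - (sinCoefficient n * expTerm n q)
  cosTerm-even zero    q = ≡.refl
  cosTerm-even (suc n) q = ≡.trans
    (solve 4 (λ s e q r → (:- s) :* (e :* (:- q) :* r) := s :* e :* (q :* r)) ≡.refl (sinCoefficient n) (expTerm n (- q)) q (recip n))
    (≡.trans (≡.cong (_* (q * recip n)) (sinTerm-odd n q))
      (solve 4 (λ s e q r → (:- (s :* e)) :* (q :* r) := (:- s) :* (e :* q :* r)) ≡.refl (sinCoefficient n) (expTerm n q) q (recip n)))
  sinTerm-odd zero    q = solve 1 (λ e → con 0ℚ :* e := :- (con 0ℚ :* e)) ≡.refl 1ℚ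
  sinTerm-odd (suc n) q = ≡.trans
    (solve 4 (λ c e q r → c :* (e :* (:- q) :* r) := c :* e :* (:- (q :* r))) ≡.refl (cosCoefficient n) (expTerm n (- q)) q (recip n))
    (≡.trans (≡.cong (_* (- (q * recip n))) (cosTerm-even n q))
      (solve 4 (λ c e q r → c :* e :* (:- (q :* r)) := :- (c :* (e :* q :* r))) ≡.refl (cosCoefficient n) (expTerm n q) q (recip n)))

  cosSum-even : ∀ n q → partialSum cosCoefficient n (- q) ≡ partialSum cosCoefficient n q
  cosSum-even zero    q = ≡.refl
  cosSum-even (suc n) q = ≡.cong₂ _+_ (cosSum-even n q) (cosTerm-even n q)

  sinSum-odd : ∀ n q → partialSum sinCoefficient n (- q) ≡ - partialSum sinCoefficient n q
  sinSum-odd zero    q = ≡.refl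
  sinSum-odd (suc n) q = ≡.trans (≡.cong₂ _+_ (sinSum-odd n q) (sinTerm-odd n q))
    (≡.sym (ℚ.neg-distrib-+ (partialSum sinCoefficient n q) (sinCoefficient n * expTerm n q)))

  partialSum-0 : ∀ c n → partialSum c (suc n) 0ℚ ≡ c 0
  partialSum-0 c zero    = solve 1 (λ c → con 0ℚ :+ c :* con 1ℚ := c) ≡.refl (c 0)
  partialSum-0 c (suc n) = ≡.trans (≡.cong (_+ c (suc n) * expTerm (suc n) 0ℚ) (partialSum-0 c n))
    (solve 4 (λ a b e r → a :+ b :* (e :* con 0ℚ :* r) := a) ≡.refl (c 0) (c (suc n)) (expTerm n 0ℚ) (recip n))

  exp-0 : exp[i fromℚ 0ℚ ] ℂ-Raw.≈ ℂ-Raw.1#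
  exp-0 = eventually cosCoefficient , eventually sinCoefficient
    where
    eventually : ∀ c → Null (λ n → partialSum c n 0ℚ - c 0)
    -- Index 0 is skipped: the empty partial sum is 0, not c 0.
    eventually c ε 0<ε = 1 , λ where
      (suc n) _ → ≡.subst (_< ε) (≡.cong ∣_∣ (≡.sym (≡.trans (≡.cong (_- c 0) (partialSum-0 c n)) (ℚ.+-inverseʳ (c 0))))) 0<ε

  2/≡ : ∀ k → + 2 / suc k ≡ recip k + recip k
  2/≡ k = ℚ.toℚᵘ-injective (begin-equality
    toℚᵘ (+ 2 / suc k)                      ≃⟨ toℚᵘ-/ (+ 2) k ⟩
    mkℚᵘ (+ 2) k                            ≃⟨ ℚᵘ.*≡* (ℤ-Solver.solve 1 (λ k → 𝟐 ⊗ (k ⊗ k) ⊜ (𝟏 ⊗ k ⊕ 𝟏 ⊗ k) ⊗ k) ≡.refl (+ suc k)) ⟩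
    mkℚᵘ (+ 1) k ℚᵘ.+ mkℚᵘ (+ 1) k          ≃⟨ ℚᵘ.+-cong (toℚᵘ-/ (+ 1) k) (toℚᵘ-/ (+ 1) k) ⟨
    toℚᵘ (recip k) ℚᵘ.+ toℚᵘ (recip k)      ≃⟨ ℚ.toℚᵘ-homo-+ (recip k) (recip k) ⟨
    toℚᵘ (recip k + recip k)                ∎)
    where
    open ℚᵘ.≤-Reasoning
    open ℤ-Solver using () renaming (_:*_ to _⊗_; _:+_ to _⊕_; _:=_ to _⊜_)
    𝟏 𝟐 : ℤ-Solver.Polynomial 1
    𝟏 = ℤ-Solver.con (+ 1)
    𝟐 = ℤ-Solver.con (+ 2)

  -- Primitivity of exp(2πi/k).

  module _ {c ℓ} {D : CommutativeRing c ℓ} (dom : IsStableDomain D) where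

    open CommutativeRing D using (Carrier; _≈_; 1#; setoid; *-congˡ; sym; trans; reflexive) renaming (_*_ to _·_)
    open Exp (CommutativeRing.commutativeSemiring D) using (_^_)
    open SetoidReasoning setoid

    -- e models q ↦ exp(iπq). The margin r keeps x away from 0 and 1 by an explicit amount, which
    -- the strict inequalities of reals in the application call for.
    module _ (e : ℚ → Carrier) (e-+ : ∀ p q → e (p + q) ≈ e p · e q) (e-0 : e 0ℚ ≈ 1#) (e-2 : e (1ℚ + 1ℚ) ≈ 1#)
      (double-nonzero : ∀ x r → 0ℚ < r → r ≤ x → r ≤ 1ℚ - x → ¬ e (x + x) ≈ 1#) where

      power : ∀ h d → e h ^ d ≈ e (fromℕ d * h)
      power h zero    = sym (trans (reflexive (≡.cong e (ℚ.*-zeroˡ h))) e-0)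
      power h (suc d) = begin
        e h · e h ^ d                ≈⟨ *-congˡ (power h d) ⟩
        e h · e (fromℕ d * h)        ≈⟨ e-+ h (fromℕ d * h) ⟨
        e (h + fromℕ d * h)          ≡⟨ ≡.cong e (solve 2 (λ h f → h :+ f :* h := (con 1ℚ :+ f) :* h) ≡.refl h (fromℕ d)) ⟩
        e ((1ℚ + fromℕ d) * h)       ≡⟨ ≡.cong (λ f → e (f * h)) (fromℕ-suc d) ⟨
        e (fromℕ (suc d) * h)        ∎

      -- The d-th power is e (x + x) with x = d / k. For 0 < d < k the margin r = 1 / k separates x
      -- from 0 and 1; for d = k the argument is 2.
      isPrimitive : ∀ k .{{_ : NonZero k}} (1<k : 1 ℕ.< k) → PrimitiveRoot.IsPrimitive k 1<k dom (integerHom D) (e (+ 2 / k))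
      isPrimitive k@(suc k′) 1<k = record
        { zᵏ≈1 = trans (power-double k) (trans (reflexive (≡.cong e (≡.cong₂ _+_ (fromℕ*recip k′) (fromℕ*recip k′)))) e-2)
        ; zᵈ≉1 = λ d 0<d d<k eq → double-nonzero (fromℕ d * r) r (0<recip k′) (r≤ d 0<d) (≤1-r d d<k)
                   (trans (sym (power-double d)) eq)
        }
        where
        r = recip k′
        power-double : ∀ d → e (+ 2 / k) ^ d ≈ e (fromℕ d * r + fromℕ d * r)
        power-double d = trans (power (+ 2 / k) d) (reflexive (≡.cong e
          (≡.trans (≡.cong (fromℕ d *_) (2/≡ k′)) (ℚ.*-distribˡ-+ (fromℕ d) r r))))
        r≤ : ∀ d → 0 ℕ.< d → r ≤ fromℕ d * r
        r≤ d 0<d = ℚ.≤-trans (ℚ.≤-reflexive (≡.sym (ℚ.*-identityˡ r))) (*-monoʳ-≤ (0≤recip k′) (fromℕ-mono {1} {d} 0<d))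
        ≤1-r : ∀ d → d ℕ.< k → r ≤ 1ℚ - fromℕ d * r
        ≤1-r d d<k = ℚ.≤-trans (ℚ.≤-reflexive (≡.trans
            (solve 2 (λ r f → r := (con 1ℚ :+ f) :* r :- f :* r) ≡.refl r (fromℕ d))
            (≡.cong (λ f → f * r - fromℕ d * r) (≡.sym (fromℕ-suc d)))))
          (ℚ.≤-trans (ℚ.+-monoˡ-≤ (- (fromℕ d * r)) (*-monoʳ-≤ (0≤recip k′) (fromℕ-mono {suc d} {k} d<k)))
            (ℚ.≤-reflexive (≡.cong (_- fromℕ d * r) (fromℕ*recip k′))))

  module RootsOfUnity {π : ℝ} (isPi : IsPi π) where

    open IsPi isPi
    open CommutativeRing ℂ-commutativeRing using () renaming (_≈_ to _≈ℂ_; _*_ to _*ℂ_; 1# to 1ℂ; trans to ≈ℂ-trans; sym to ≈ℂ-sym)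

    e : ℚ → ℂ
    e q = exp[i fromℚ q *ᴿ π ]

    C S : ℚ → ℝ
    C q = cos (fromℚ q *ᴿ π)
    S q = sin (fromℚ q *ᴿ π)

    e-+ : ∀ p q → e (p + q) ≈ℂ e p *ℂ e q
    e-+ p q = ≈ℂ-trans {e (p + q)} {exp[i fromℚ p *ᴿ π +ᴿ fromℚ q *ᴿ π ]} {e p *ℂ e q}
      (exp-cong (fromℚ (p + q) *ᴿ π) (fromℚ p *ᴿ π +ᴿ fromℚ q *ᴿ π)
        (pointwise (fromℚ (p + q) *ᴿ π) (fromℚ p *ᴿ π +ᴿ fromℚ q *ᴿ π) λ n → ℚ.*-distribʳ-+ (seq π n) p q))
      (exp-+ (fromℚ p *ᴿ π) (fromℚ q *ᴿ π))

    e-0 : e 0ℚ ≈ℂ 1ℂ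
    e-0 = ≈ℂ-trans {e 0ℚ} {exp[i fromℚ 0ℚ ]} {1ℂ}
      (exp-cong (fromℚ 0ℚ *ᴿ π) (fromℚ 0ℚ) (pointwise (fromℚ 0ℚ *ᴿ π) (fromℚ 0ℚ) λ n → ℚ.*-zeroˡ (seq π n))) exp-0

    -- The real part of e (q) e (- q) = e (0) = 1, rewritten by the parity of cosine and sine.
    circle : ∀ q → Null (λ n → seq (C q) n * seq (C q) n + seq (S q) n * seq (S q) n - 1ℚ)
    circle q = Null-cong
      (λ n → ≡.cong (_- 1ℚ) (≡.trans
        (≡.cong₂ (λ c s → seq (C q) n * c - seq (S q) n * s)
          (≡.trans (≡.cong (partialSum cosCoefficient n) (≡.sym (ℚ.neg-distribˡ-* q (seq π n)))) (cosSum-even n (q * seq π n)))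
          (≡.trans (≡.cong (partialSum sinCoefficient n) (≡.sym (ℚ.neg-distribˡ-* q (seq π n)))) (sinSum-odd n (q * seq π n))))
        (solve 2 (λ c s → c :* c :- s :* (:- s) := c :* c :+ s :* s) ≡.refl (seq (C q) n) (seq (S q) n))))
      (proj₁ (≈ℂ-trans {e q *ℂ e (- q)} {e (q - q)} {1ℂ} (≈ℂ-sym {e (q - q)} {e q *ℂ e (- q)} (e-+ q (- q)))
        (≡.subst (λ z → e z ≈ℂ 1ℂ) (≡.sym (ℚ.+-inverseʳ q)) e-0)))

    S₁-Null : Null (seq (S 1ℚ))
    S₁-Null = ≈0⇒Null (S 1ℚ) (≈-trans (S 1ℚ) (sin π) (fromℚ 0ℚ)
      (sumSeries-cong ∣sinCoefficient∣≤1 (fromℚ 1ℚ *ᴿ π) π (pointwise (fromℚ 1ℚ *ᴿ π) π λ n → ℚ.*-identityˡ (seq π n))) sinπ≈0)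

    -- Squaring e 1 makes the sign of cos π irrelevant: sin π = 0 and cos² + sin² = 1 suffice.
    e-2 : e (1ℚ + 1ℚ) ≈ℂ 1ℂ
    e-2 = ≈ℂ-trans {e (1ℚ + 1ℚ)} {e 1ℚ *ℂ e 1ℚ} {1ℂ} (e-+ 1ℚ 1ℚ)
      ( Null-cong (λ n → solve 2 (λ c s → (c :* c :+ s :* s :- con 1ℚ) :- (s :* s :+ s :* s) := c :* c :- s :* s :- con 1ℚ) ≡.refl (seq (C 1ℚ) n) (seq (S 1ℚ) n))
          (Null-+ (circle 1ℚ) (Null-neg (Null-+ (Null-* (S 1ℚ) S₁-Null) (Null-* (S 1ℚ) S₁-Null))))
      , Null-cong (λ n → solve 2 (λ c s → c :* s :+ c :* s := c :* s :+ s :* c :- con 0ℚ) ≡.refl (seq (C 1ℚ) n) (seq (S 1ℚ) n))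
          (Null-+ (Null-* (C 1ℚ) S₁-Null) (Null-* (C 1ℚ) S₁-Null)))

    -- cos 2x = 1 − 2 sin² x
    e-double≈1⇒sin≈0 : ∀ x → e (x + x) ≈ℂ 1ℂ → S x ≈ᴿ fromℚ 0ℚ
    e-double≈1⇒sin≈0 x eq = Null⇒≈0 (S x) (Null-square (S x) (Null-cong
      (λ n → solve 2 (λ c s → con ℚ.½ :* ((c :* c :+ s :* s :- con 1ℚ) :- (c :* c :- s :* s :- con 1ℚ)) := s :* s) ≡.refl (seq (C x) n) (seq (S x) n))
      (Null-* (fromℚ ℚ.½) (Null-+ (circle x) (Null-neg (proj₁ (≈ℂ-trans {e x *ℂ e x} {e (x + x)} {1ℂ} (≈ℂ-sym {e (x + x)} {e x *ℂ e x} (e-+ x x)) eq)))))))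

    -- The minimality of π applied to xπ. If ε is an eventual lower bound of π, then r ε separates
    -- xπ both from 0 and from π.
    sin-nonzero : ∀ x r → 0ℚ < r → r ≤ x → r ≤ 1ℚ - x → ¬ S x ≈ᴿ fromℚ 0ℚ
    sin-nonzero x r 0<r r≤x r≤1-x = minimal (fromℚ x *ᴿ π)
      (let ε , 0<ε , N , ε≤π = 0<π in r * ε , *-pos 0<r 0<ε , N , λ n N≤n → ℚ.≤-trans
        (*-mono-≤ (ℚ.<⇒≤ 0<r) r≤x (ℚ.<⇒≤ 0<ε) (ε≤π n N≤n))
        (ℚ.≤-reflexive (solve 2 (λ x p → x :* (p :- con 0ℚ) := x :* p :- con 0ℚ) ≡.refl x (seq π n))))
      (let ε , 0<ε , N , ε≤π = 0<π in r * ε , *-pos 0<r 0<ε , N , λ n N≤n → ℚ.≤-trans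
        (*-mono-≤ (ℚ.<⇒≤ 0<r) r≤1-x (ℚ.<⇒≤ 0<ε) (ε≤π n N≤n))
        (ℚ.≤-reflexive (solve 2 (λ x p → (con 1ℚ :- x) :* (p :- con 0ℚ) := p :- x :* p) ≡.refl x (seq π n))))

    double-nonzero : ∀ x r → 0ℚ < r → r ≤ x → r ≤ 1ℚ - x → ¬ e (x + x) ≈ℂ 1ℂ
    double-nonzero x r 0<r r≤x r≤1-x eq = sin-nonzero x r 0<r r≤x r≤1-x (e-double≈1⇒sin≈0 x eq)

  root-isPrimitive : ∀ {π} → IsPi π → ∀ k .{{_ : NonZero k}} (1<k : 1 ℕ.< k) →
    PrimitiveRoot.IsPrimitive k 1<k ℂ-isStableDomain (integerHom ℂ-commutativeRing) (rootOfUnity π k)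
  root-isPrimitive isPi k 1<k = isPrimitive ℂ-isStableDomain e e-+ e-0 e-2 double-nonzero k 1<k
    where open RootsOfUnity isPi

open import Algebra.Bundles using (CommutativeRing)
open import Data.Nat.Base as Nat using (ℕ; NonZero; _≤_)
import Data.Nat.Properties as Nat
open import Data.Product using (_×_)
open import Relation.Unary using (_⊆_)
open CyclotomicTransfer using (module Transfer)
open ComplexRoots using (ℂ-commutativeRing; ℂ-isStableDomain; ℂ-characteristic; root-isPrimitive)

theorem9 : ∀ {c ℓ p} (π : ℝ) → IsPi π → (k : ℕ) .{{_ : NonZero k}} → 3 ≤ k →
    ((F : FiniteField c ℓ) (Φ : UnitSubgroup F p) → HasOrder F Φ k →
    (φ : CommutativeRing.Carrier (FiniteField.commutativeRing F)) → IsGenerator F φ Φ →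
    𝒪ℂ π k ⊆ 𝒪 F φ k)
    × IsFinite (ExceptionalPrime c ℓ p π k)
theorem9 {c} {ℓ} {p} π isPi k {{k≢0}} 3≤k =
  Transfer.overlaps-finite-field k {{k≢0}} 1<k {C = ℂ-commutativeRing} ℂ-isStableDomain ℂ-characteristic
    {rootOfUnity π k {{k≢0}}} (root-isPrimitive {π} isPi k {{k≢0}} 1<k) {c} {ℓ} {p}
  where
  1<k : 1 Nat.< k
  1<k = Nat.<-trans (Nat.n<1+n 1) 3≤k
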